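{- From $\mathcal{G}(M)$, one can deduce whether a matroid $M$ is a proper free product; that is, if $M$ and $M'$ are matroids with $\mathcal{G}(M)=\mathcal{G}(M')$, then $M$ is a proper free product if and only if $M'$ is. Also, for each pinchpoint $X$ of $\mathcal{Z}(M)$, the $\mathcal{G}$-invariants of the constituents of the corresponding sharp free product factorization $M=(M|X)\mathbin{\Box}(M/X)$ can be derived from $\mathcal{G}(M)$ and $r(X)$; that is, if $\mathcal{G}(M)=\mathcal{G}(M')$, $X$ is a pinchpoint of $\mathcal{Z}(M)$, $X'$ is a pinchpoint of $\mathcal{Z}(M')$, and $r_M(X)=r_{M'}(X')$, then $\mathcal{G}(M|X)=\mathcal{G}(M'|X')$ and $\mathcal{G}(M/X)=\mathcal{G}(M'/X')$.
   Context: A cyclic flat of a matroid $M$ is a flat that is a union of circuits (equivalently, a flat $X$ such that $M|X$ has no coloops). $\mathcal{Z}(M)$ is the lattice of cyclic flats of $M$, ordered by inclusion. A pinchpoint of $\mathcal{Z}(M)$ is a cyclic flat, neither the maximum nor the minimum of $\mathcal{Z}(M)$, that each cyclic flat either contains or is contained in. For matroids $M_1,M_2$ of ranks $r_1,r_2$ on disjoint sets $E_1,E_2$, the free product $M_1\mathbin{\Box}M_2$ is the matroid on $E_1\cup E_2$ whose bases are the subsets $B$ of size $r_1+r_2$ such that $B\cap E_1$ is independent in $M_1$ and $B\cap E_2$ spans $M_2$. A free product $M_1\mathbin{\Box}M_2$ is proper if each of $M_1$ and $M_2$ has at least two cyclic flats; it is sharp if it is proper, $M_1$ has no coloops, and $M_2$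 has no loops. It is known (Crapo–Schmitt) that $M$ is a proper free product if and only if $\mathcal{Z}(M)$ has a pinchpoint, and that $X\mapsto(M|X)\mathbin{\Box}(M/X)$ is a bijection from the set of pinchpoints of $\mathcal{Z}(M)$ onto the set of sharp free product factorizations of $M$. $\mathcal{G}(n,r)$ is the vector space over a field of characteristic zero with basis the formal symbols $[\underline{r}]$, one for each $0,1$-sequence of length $n$ with exactly $r$ ones. For a rank-$r$ matroid $M$ with rank function $r(\cdot)$ on an $n$-element set $E$ and a permutation (linear ordering) $\pi$ of $E$, the rank sequence $\underline{r}(\pi)=r_1\ldots r_n$ has $r_j=r(\{\pi(1),\ldots,\pi(j)\})-r(\{\pi(1),\ldots,\pi(j-1)\})$, and $\mathcal{G}(M)=\sum_\pi[\underline{r}(\pi)]\in\mathcal{G}(n,r)$ over all $n!$ permutations of $E$. -}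

module Defs where

open import Algebra.Apartness.Bundles using (HeytingField; HeytingCommutativeRing)
open import Algebra.Bundles using (CommutativeRing)
import Algebra.Definitions.RawMonoid as RawMonoid
open import Data.Bool.Base using (if_then_else_)
open import Data.Empty using (⊥-elim)
open import Data.Fin.Base using (Fin; zero; suc; toℕ; fromℕ<)
open import Data.Fin.Patterns using (0F; 1F)
open import Data.Fin.Permutation as Perm using (Permutation′; _⟨$⟩ʳ_; _⟨$⟩ˡ_)
open import Data.Fin.Properties using () renaming (_≟_ to _≟ᶠ_)
open import Data.Fin.Subset
open import Data.Fin.Subset.Properties
open import Data.List.Base as List using (List; []; _∷_; _∷ʳ_)
open import Data.List.Membership.Propositional using () renaming (_∈_ to _∈ˡ_)
open import Data.List.Membership.Propositional.Properties
  using (∈-tabulate⁺; ∈-tabulate⁻; ∈-++⁻)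
open import Data.List.Properties using (take-all; length-tabulate)
open import Data.List.Relation.Unary.All using (All)
open import Data.List.Relation.Unary.Any using (here; there)
open import Data.Nat.Base using (ℕ; zero; suc; _+_; _∸_; _≤_; _<_; z≤n; s≤s)
open import Data.Nat.Properties
open import Data.Product.Base
  using (∃; Σ-syntax; ∃-syntax; _×_; _,_; proj₁; proj₂)
open import Data.Sum.Base using (_⊎_; inj₁; inj₂; [_,_]′)
open import Data.Vec.Base as Vec using (Vec; []; _∷_; here; there; lookup; count)
open import Data.Vec.Properties using (≡-dec; lookup-map)
open import Function.Base using (_∘_)
open import Function.Bundles using (_⇔_)
open import Level using (_⊔_)
open import Relation.Binary.Definitions using (Maximum; Minimum)
open import Relation.Binary.PropositionalEquality hiding ([_])
open import Relation.Nullary using (¬_; does)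

-- A matroid on the finite set E ⊆ Fin N, given by its rank function.  Only
-- the values of `rank` on subsets of E carry meaning.

record Matroid {N : ℕ} (E : Subset N) : Set where
  field
    rank            : Subset N → ℕ
    rank-bounded    : ∀ A → A ⊆ E → rank A ≤ ∣ A ∣
    rank-monotone   : ∀ A B → A ⊆ B → B ⊆ E → rank A ≤ rank B
    rank-submodular : ∀ A B → A ⊆ E → B ⊆ E →
                      rank (A ∪ B) + rank (A ∩ B) ≤ rank A + rank B

open Matroid public using (rank)

∪-lub : ∀ {N} {A B C : Subset N} → A ⊆ C → B ⊆ C → A ∪ B ⊆ C
∪-lub {A = A} {B} A⊆C B⊆C x∈A∪B = [ A⊆C , B⊆C ]′ (x∈p∪q⁻ A B x∈A∪B)

module _ {N : ℕ} {E : Subset N} (M : Matroid E) where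

  Independent : Subset N → Set
  Independent I = I ⊆ E × rank M I ≡ ∣ I ∣

  Spanning : Subset N → Set
  Spanning S = S ⊆ E × rank M S ≡ rank M E

  Basis : Subset N → Set
  Basis B = Independent B × Spanning B

  Circuit : Subset N → Set
  Circuit C = C ⊆ E × ¬ Independent C × (∀ D → D ⊂ C → Independent D)

  Flat : Subset N → Set
  Flat F = F ⊆ E × (∀ e → e ∈ E → e ∉ F → rank M F < rank M (F ∪ ⁅ e ⁆))

  CyclicFlat : Subset N → Set
  CyclicFlat Z = Flat Z × (∃[ 𝒞 ] All Circuit 𝒞 × Z ≡ ⋃ 𝒞)

  -- The underlying set of the lattice of cyclic flats.

  𝓩 : Set
  𝓩 = ∃ CyclicFlat

  infix 4 _⊑_

  _⊑_ : 𝓩 → 𝓩 → Set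
  X ⊑ Y = proj₁ X ⊆ proj₁ Y

  Pinchpoint : 𝓩 → Set
  Pinchpoint X = ¬ Maximum _⊑_ X × ¬ Minimum _⊑_ X × (∀ Y → X ⊑ Y ⊎ Y ⊑ X)

  AtLeastTwoCyclicFlats : Set
  AtLeastTwoCyclicFlats = ∃[ X ] ∃[ Y ] CyclicFlat X × CyclicFlat Y × X ≢ Y

restrict : ∀ {N} {E : Subset N} → Matroid E → ∀ X → X ⊆ E → Matroid X
restrict M X X⊆E = record
  { rank            = rank M
  ; rank-bounded    = λ A A⊆X → M.rank-bounded A (X⊆E ∘ A⊆X)
  ; rank-monotone   = λ A B A⊆B B⊆X → M.rank-monotone A B A⊆B (X⊆E ∘ B⊆X)
  ; rank-submodular = λ A B A⊆X B⊆X →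
                      M.rank-submodular A B (X⊆E ∘ A⊆X) (X⊆E ∘ B⊆X)
  }
  where module M = Matroid M

contract : ∀ {N} {E : Subset N} → Matroid E → ∀ X → X ⊆ E → Matroid (E ─ X)
contract {N} {E} M X X⊆E = record
  { rank            = λ A → rank M (A ∪ X) ∸ rank M X
  ; rank-bounded    = bounded
  ; rank-monotone   = λ A B A⊆B B⊆E─X → ∸-monoˡ-≤ (rank M X)
      (M.rank-monotone (A ∪ X) (B ∪ X)
        (∪-lub {A = A} (p⊆p∪q X ∘ A⊆B) (q⊆p∪q B X)) (∪X⊆E B B⊆E─X))
  ; rank-submodular = submodular
  }
  where
  module M = Matroid M

  ─⊆ : ∀ {A} → A ⊆ E ─ X → A ⊆ E
  ─⊆ A⊆E─X = p─q⊆p E X ∘ A⊆E─X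

  ∪X⊆E : ∀ A → A ⊆ E ─ X → A ∪ X ⊆ E
  ∪X⊆E A A⊆E─X = ∪-lub {A = A} (─⊆ A⊆E─X) X⊆E

  bounded : ∀ A → A ⊆ E ─ X → rank M (A ∪ X) ∸ rank M X ≤ ∣ A ∣
  bounded A A⊆E─X = begin
    rank M (A ∪ X) ∸ rank M X            ≤⟨ ∸-monoˡ-≤ (rank M X) lemma ⟩
    (rank M A + rank M X) ∸ rank M X     ≡⟨ m+n∸n≡m (rank M A) (rank M X) ⟩
    rank M A                             ≤⟨ M.rank-bounded A (─⊆ A⊆E─X) ⟩
    ∣ A ∣                                ∎
    where
    open ≤-Reasoning
    lemma : rank M (A ∪ X) ≤ rank M A + rank M X
    lemma = m+n≤o⇒m≤o (rank M (A ∪ X)) (M.rank-submodular A X (─⊆ A⊆E─X) X⊆E)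

  ∸-submodular : ∀ {a b c d} x → x ≤ a → x ≤ b → x ≤ c → x ≤ d →
                 a + b ≤ c + d → (a ∸ x) + (b ∸ x) ≤ (c ∸ x) + (d ∸ x)
  ∸-submodular {a} {b} {c} {d} x x≤a x≤b x≤c x≤d a+b≤c+d = begin
    (a ∸ x) + (b ∸ x)   ≡⟨ regroup x≤a x≤b ⟩
    (a + b) ∸ (x + x)   ≤⟨ ∸-monoˡ-≤ (x + x) a+b≤c+d ⟩
    (c + d) ∸ (x + x)   ≡⟨ regroup x≤c x≤d ⟨
    (c ∸ x) + (d ∸ x)   ∎
    where
    open ≤-Reasoning
    regroup : ∀ {m n} → x ≤ m → x ≤ n → (m ∸ x) + (n ∸ x) ≡ (m + n) ∸ (x + x)
    regroup {m} {n} x≤m x≤n = begin-equality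
      (m ∸ x) + (n ∸ x)   ≡⟨ +-∸-assoc (m ∸ x) x≤n ⟨
      ((m ∸ x) + n) ∸ x   ≡⟨ cong (_∸ x) (+-∸-comm n x≤m) ⟨
      ((m + n) ∸ x) ∸ x   ≡⟨ ∸-+-assoc (m + n) x x ⟩
      (m + n) ∸ (x + x)   ∎

  X≤ : ∀ A → A ⊆ E ─ X → rank M X ≤ rank M (A ∪ X)
  X≤ A A⊆ = M.rank-monotone X (A ∪ X) (q⊆p∪q A X) (∪X⊆E A A⊆)

  submodular : ∀ A B → A ⊆ E ─ X → B ⊆ E ─ X →
    (rank M ((A ∪ B) ∪ X) ∸ rank M X) + (rank M ((A ∩ B) ∪ X) ∸ rank M X) ≤
    (rank M (A ∪ X) ∸ rank M X) + (rank M (B ∪ X) ∸ rank M X)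
  submodular A B A⊆ B⊆ = ∸-submodular (rank M X)
    (X≤ (A ∪ B) (∪-lub {A = A} A⊆ B⊆)) (X≤ (A ∩ B) (A⊆ ∘ p∩q⊆p A B))
    (X≤ A A⊆) (X≤ B B⊆)
    (subst₂ (λ U V → rank M U + rank M V ≤ rank M (A ∪ X) + rank M (B ∪ X))
      union (sym (∪-distribʳ-∩ X A B))
      (M.rank-submodular (A ∪ X) (B ∪ X) (∪X⊆E A A⊆) (∪X⊆E B B⊆)))
    where
    union : (A ∪ X) ∪ (B ∪ X) ≡ (A ∪ B) ∪ X
    union = ⊆-antisym
      (∪-lub {A = A ∪ X}
        (∪-lub {A = A} (p⊆p∪q X ∘ p⊆p∪q B) (q⊆p∪q (A ∪ B) X))
        (∪-lub {A = B} (p⊆p∪q X ∘ q⊆p∪q A B) (q⊆p∪q (A ∪ B) X)))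
      (∪-lub {A = A ∪ B}
        (∪-lub {A = A} (p⊆p∪q (B ∪ X) ∘ p⊆p∪q X) (q⊆p∪q (A ∪ X) (B ∪ X) ∘ p⊆p∪q X))
        (p⊆p∪q (B ∪ X) ∘ q⊆p∪q A X))

restrictZ : ∀ {N} {E : Subset N} (M : Matroid E) (X : 𝓩 M) → Matroid (proj₁ X)
restrictZ M (X , (X⊆E , _) , _) = restrict M X X⊆E

contractZ : ∀ {N} {E : Subset N} (M : Matroid E) (X : 𝓩 M) → Matroid (E ─ proj₁ X)
contractZ M (X , (X⊆E , _) , _) = contract M X X⊆E

-- M = M₁ □ M₂.  A matroid is determined by its ground set and its bases, so
-- this equality is expressed by listing the bases of M.

record IsFreeProduct {N : ℕ} {E E₁ E₂ : Subset N}
  (M : Matroid E) (M₁ : Matroid E₁) (M₂ : Matroid E₂) : Set where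
  field
    disjoint : Empty (E₁ ∩ E₂)
    ground   : E ≡ E₁ ∪ E₂
    bases    : ∀ B → B ⊆ E →
               Basis M B ⇔
               (∣ B ∣ ≡ rank M₁ E₁ + rank M₂ E₂ ×
                Independent M₁ (B ∩ E₁) × Spanning M₂ (B ∩ E₂))

IsProperFreeProduct : ∀ {N} {E : Subset N} → Matroid E → Set
IsProperFreeProduct {N} M =
  Σ[ E₁ ∈ Subset N ] Σ[ E₂ ∈ Subset N ]
  Σ[ M₁ ∈ Matroid E₁ ] Σ[ M₂ ∈ Matroid E₂ ]
    IsFreeProduct M M₁ M₂ × AtLeastTwoCyclicFlats M₁ × AtLeastTwoCyclicFlats M₂

record Symbol (n r : ℕ) : Set where
  field
    bits  : Vec (Fin 2) n
    .ones : count (_≟ᶠ 1F) bits ≡ r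

open Symbol public using (bits)

fromList : ∀ {N} → List (Fin N) → Subset N
fromList = ⋃ ∘ List.map ⁅_⁆

elements : ∀ {N} (E : Subset N) → Vec (Fin N) ∣ E ∣
elements []            = []
elements (inside  ∷ E) = zero ∷ Vec.map suc (elements E)
elements (outside ∷ E) = Vec.map suc (elements E)

-- A linear ordering of E is encoded as a permutation of the positions
-- 0, …, ∣ E ∣ − 1 in the increasing enumeration of E.

ordering : ∀ {N} (E : Subset N) → Permutation′ ∣ E ∣ → List (Fin N)
ordering E π = List.tabulate (λ i → lookup (elements E) (π ⟨$⟩ʳ i))

prefix : ∀ {N} (E : Subset N) → Permutation′ ∣ E ∣ → ℕ → Subset N
prefix E π j = fromList (List.take j (ordering E π))

-- `insert zero i π` sends 0 to i and acts as π on the other positions, so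
-- each of the n! permutations of Fin n is listed exactly once.

permutations : ∀ n → List (Permutation′ n)
permutations zero    = Perm.id ∷ []
permutations (suc n) =
  List.cartesianProductWith (Perm.insert zero) (List.allFin (suc n)) (permutations n)

∈-fromList⁺ : ∀ {N} {x : Fin N} {xs} → x ∈ˡ xs → x ∈ fromList xs
∈-fromList⁺ {x = x} (here refl)             = x∈p∪q⁺ (inj₁ (x∈⁅x⁆ x))
∈-fromList⁺ {xs = y ∷ xs} (there x∈xs) = x∈p∪q⁺ {p = ⁅ y ⁆} (inj₂ (∈-fromList⁺ x∈xs))

∈-fromList⁻ : ∀ {N} {x : Fin N} xs → x ∈ fromList xs → x ∈ˡ xs
∈-fromList⁻ []       x∈⊥ = ⊥-elim (∉⊥ x∈⊥)
∈-fromList⁻ (y ∷ xs) x∈  with x∈p∪q⁻ ⁅ y ⁆ (fromList xs) x∈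
... | inj₁ x∈⁅y⁆ = here (x∈⁅y⁆⇒x≡y y x∈⁅y⁆)
... | inj₂ x∈xs  = there (∈-fromList⁻ xs x∈xs)

∈-take : ∀ {a} {A : Set a} {x : A} j xs → x ∈ˡ List.take j xs → x ∈ˡ xs
∈-take (suc j) (y ∷ xs) (here x≡y) = here x≡y
∈-take (suc j) (y ∷ xs) (there x∈) = there (∈-take j xs x∈)

take-step : ∀ {a} {A : Set a} j (xs : List A) →
            (List.take (suc j) xs ≡ List.take j xs) ⊎
            (∃[ x ] x ∈ˡ xs × List.take (suc j) xs ≡ List.take j xs ∷ʳ x)
take-step zero    []       = inj₁ refl
take-step (suc j) []       = inj₁ refl
take-step zero    (x ∷ xs) = inj₂ (x , here refl , refl)
take-step (suc j) (y ∷ xs) with take-step j xs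
... | inj₁ eq              = inj₁ (cong (y ∷_) eq)
... | inj₂ (x , x∈xs , eq) = inj₂ (x , there x∈xs , cong (y ∷_) eq)

elements-∈ : ∀ {N} (E : Subset N) i → lookup (elements E) i ∈ E
elements-∈ (inside  ∷ E) zero    = here
elements-∈ (inside  ∷ E) (suc i) =
  subst (_∈ inside ∷ E) (sym (lookup-map i suc (elements E))) (there (elements-∈ E i))
elements-∈ (outside ∷ E) i       =
  subst (_∈ outside ∷ E) (sym (lookup-map i suc (elements E))) (there (elements-∈ E i))

elements-surjective : ∀ {N} (E : Subset N) {x} → x ∈ E →
                      ∃[ i ] lookup (elements E) i ≡ x
elements-surjective (inside ∷ E) here = zero , refl
elements-surjective (inside ∷ E) (there x∈E) with elements-surjective E x∈E
... | i , eq = suc i , trans (lookup-map i suc (elements E)) (cong suc eq)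
elements-surjective (outside ∷ E) (there x∈E) with elements-surjective E x∈E
... | i , eq = i , trans (lookup-map i suc (elements E)) (cong suc eq)

module _ {N : ℕ} (E : Subset N) (π : Permutation′ ∣ E ∣) where

  ordering-⊆ : ∀ {x} → x ∈ˡ ordering E π → x ∈ E
  ordering-⊆ x∈ with ∈-tabulate⁻ x∈
  ... | i , refl = elements-∈ E (π ⟨$⟩ʳ i)

  ordering-⊇ : ∀ {x} → x ∈ E → x ∈ˡ ordering E π
  ordering-⊇ x∈E with elements-surjective E x∈E
  ... | i , refl = subst (λ k → lookup (elements E) k ∈ˡ ordering E π)
                         (Perm.inverseʳ π {i}) (∈-tabulate⁺ (π ⟨$⟩ˡ i))

  prefix-⊆ : ∀ j → prefix E π j ⊆ E
  prefix-⊆ j = ordering-⊆ ∘ ∈-take j (ordering E π) ∘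
               ∈-fromList⁻ (List.take j (ordering E π))

  prefix-all : prefix E π ∣ E ∣ ≡ E
  prefix-all = ⊆-antisym (prefix-⊆ ∣ E ∣)
    λ x∈E → subst (λ xs → _ ∈ fromList xs)
      (sym (take-all ∣ E ∣ (ordering E π) (≤-reflexive (length-tabulate _))))
      (∈-fromList⁺ (ordering-⊇ x∈E))

  prefix-step : ∀ j → (prefix E π (suc j) ≡ prefix E π j) ⊎
                (∃[ x ] x ∈ E × prefix E π (suc j) ≡ prefix E π j ∪ ⁅ x ⁆)
  prefix-step j with take-step j (ordering E π)
  ... | inj₁ eq              = inj₁ (cong fromList eq)
  ... | inj₂ (x , x∈xs , eq) =
    inj₂ (x , ordering-⊆ x∈xs , trans (cong fromList eq) (snoc (List.take j (ordering E π))))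
    where
    snoc : ∀ ys → fromList (ys ∷ʳ x) ≡ fromList ys ∪ ⁅ x ⁆
    snoc []       = trans (∪-identityʳ ⁅ x ⁆) (sym (∪-identityˡ ⁅ x ⁆))
    snoc (y ∷ ys) = trans (cong (⁅ y ⁆ ∪_) (snoc ys))
                          (sym (∪-assoc ⁅ y ⁆ (fromList ys) ⁅ x ⁆))

  module _ (M : Matroid E) where

    private module M = Matroid M

    rank-prefix-mono : ∀ j → rank M (prefix E π j) ≤ rank M (prefix E π (suc j))
    rank-prefix-mono j with prefix-step j
    ... | inj₁ eq           = ≤-reflexive (cong (rank M) (sym eq))
    ... | inj₂ (x , _ , eq) =
      M.rank-monotone _ _ (λ y∈ → subst (_ ∈_) (sym eq) (p⊆p∪q ⁅ x ⁆ y∈)) (prefix-⊆ (suc j))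

    rank-prefix-step : ∀ j → rank M (prefix E π (suc j)) ∸ rank M (prefix E π j) < 2
    rank-prefix-step j with prefix-step j
    ... | inj₁ eq rewrite eq | n∸n≡0 (rank M (prefix E π j)) = s≤s z≤n
    ... | inj₂ (x , x∈E , eq) rewrite eq = s≤s (begin
      rank M (P ∪ ⁅ x ⁆) ∸ rank M P         ≤⟨ ∸-monoˡ-≤ (rank M P)
                                                 (m+n≤o⇒m≤o _ (M.rank-submodular P ⁅ x ⁆ (prefix-⊆ j) x⊆E)) ⟩
      (rank M P + rank M ⁅ x ⁆) ∸ rank M P  ≡⟨ m+n∸m≡n (rank M P) (rank M ⁅ x ⁆) ⟩
      rank M ⁅ x ⁆                          ≤⟨ M.rank-bounded ⁅ x ⁆ x⊆E ⟩
      ∣ ⁅ x ⁆ ∣                             ≡⟨ ∣⁅x⁆∣≡1 x ⟩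
      1                                     ∎)
      where
      open ≤-Reasoning
      P : Subset N
      P = prefix E π j
      x⊆E : ⁅ x ⁆ ⊆ E
      x⊆E y∈ rewrite x∈⁅y⁆⇒x≡y x y∈ = x∈E

increments : ∀ n (g : ℕ → ℕ) → (∀ j → g (suc j) ∸ g j < 2) → Vec (Fin 2) n
increments n g step = Vec.tabulate (λ j → fromℕ< {m = g (suc (toℕ j)) ∸ g (toℕ j)} (step (toℕ j)))

telescope : ∀ n (g : ℕ → ℕ) (mono : ∀ j → g j ≤ g (suc j))
            (step : ∀ j → g (suc j) ∸ g j < 2) →
            g 0 + count (_≟ᶠ 1F) (increments n g step) ≡ g n
telescope zero    g mono step = +-identityʳ (g 0)
telescope (suc n) g mono step
  with g 1 ∸ g 0 in eq | step 0 | telescope n (g ∘ suc) (mono ∘ suc) (step ∘ suc)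
... | 0 | _ | ih = trans (cong (_+ tail) (≤-antisym (mono 0) (m∸n≡0⇒m≤n eq))) ih
  where
  tail : ℕ
  tail = count (_≟ᶠ 1F) (increments n (g ∘ suc) (step ∘ suc))
... | 1 | _ | ih = trans (trans (+-suc (g 0) tail) (cong (_+ tail) g₁)) ih
  where
  tail : ℕ
  tail = count (_≟ᶠ 1F) (increments n (g ∘ suc) (step ∘ suc))
  g₁ : suc (g 0) ≡ g 1
  g₁ = trans (cong (_+ g 0) (sym eq)) (m∸n+n≡m (mono 0))
... | suc (suc _) | s≤s (s≤s ()) | _

-- The j-th bit is r{π(1),…,π(j)} − r{π(1),…,π(j−1)}; the matroid axioms make it
-- 0 or 1, and the differences sum to rank M E.

rankSequence : ∀ {N} {E : Subset N} (M : Matroid E) →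
               Permutation′ ∣ E ∣ → Symbol ∣ E ∣ (rank M E)
rankSequence {N} {E} M π = record
  { bits = increments ∣ E ∣ r (rank-prefix-step E π M)
  ; ones = begin
      ones#           ≡⟨ cong (_+ ones#) r₀ ⟨
      r 0 + ones#     ≡⟨ telescope ∣ E ∣ r (rank-prefix-mono E π M) (rank-prefix-step E π M) ⟩
      r ∣ E ∣         ≡⟨ cong (rank M) (prefix-all E π) ⟩
      rank M E        ∎
  }
  where
  open ≡-Reasoning
  r : ℕ → ℕ
  r j = rank M (prefix E π j)
  ones# : ℕ
  ones# = count (_≟ᶠ 1F) (increments ∣ E ∣ r (rank-prefix-step E π M))
  r₀ : r 0 ≡ 0
  r₀ = n≤0⇒n≡0 (≤-trans (Matroid.rank-bounded M _ (prefix-⊆ E π 0)) (≤-reflexive (∣⊥∣≡0 N)))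

module _ {c ℓ₁ ℓ₂} (K : HeytingField c ℓ₁ ℓ₂) where

  private module K = HeytingField K

  private
    commutativeRing = HeytingCommutativeRing.commutativeRing K.heytingCommutativeRing

  CharacteristicZero : Set ℓ₁
  CharacteristicZero = ∀ n → n ×ᴷ K.1# K.≈ K.0# → n ≡ 0
    where
    infixr 8 _×ᴷ_
    _×ᴷ_ : ℕ → K.Carrier → K.Carrier
    _×ᴷ_ = RawMonoid._×_ (CommutativeRing.+-rawMonoid commutativeRing)

  -- The vector space with basis Symbol n r.  That basis is finite, so its
  -- vectors are all the coefficient functions.

  𝒢 : ℕ → ℕ → Set c
  𝒢 n r = Symbol n r → K.Carrier

  [_] : ∀ {n r} → Symbol n r → 𝒢 n r
  [ s ] t = if does (≡-dec _≟ᶠ_ (bits s) (bits t)) then K.1# else K.0#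

  𝟎 : ∀ {n r} → 𝒢 n r
  𝟎 _ = K.0#

  infixl 6 _⊕_

  _⊕_ : ∀ {n r} → 𝒢 n r → 𝒢 n r → 𝒢 n r
  (u ⊕ v) s = u s K.+ v s

  -- Equality of vectors of two of the spaces 𝒢 n r: they must lie in the same
  -- space and have the same coefficients.

  data Equal {n r : ℕ} (u : 𝒢 n r) : ∀ {n′ r′} → 𝒢 n′ r′ → Set (c ⊔ ℓ₁) where
    equal : {v : 𝒢 n r} → (∀ s → u s K.≈ v s) → Equal u v

  𝒢-invariant : ∀ {N} {E : Subset N} (M : Matroid E) → 𝒢 ∣ E ∣ (rank M E)
  𝒢-invariant {E = E} M =
    List.foldr _⊕_ 𝟎 (List.map (λ π → [ rankSequence M π ]) (permutations ∣ E ∣))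

  Same𝒢 : ∀ {N N′} {E : Subset N} {E′ : Subset N′} → Matroid E → Matroid E′ → Set (c ⊔ ℓ₁)
  Same𝒢 M M′ = Equal (𝒢-invariant M) (𝒢-invariant M′)

{-# OPTIONS --safe #-}
module Submission where

-- In characteristic zero the 𝒢-invariant records, for every sequence, the number of linear
-- orders of E with that rank sequence.  Call X dominant if every other set at least as large
-- as X has greater rank.  A pinchpoint X is dominant, so the orders that start with X are
-- recognised by the rank of their first ∣ X ∣ elements, and their rank sequences are the
-- concatenations of those of M|X and M/X: this yields the invariants of the two factors.
--
-- For the first claim, call X a free separator if every B with ∣ B ∣ = r(M), B ∩ X independent
-- and B ∪ X spanning is a basis, that is, if M = M|X □ M/X.  If M is a proper free product, then
-- deleting the coloops of M|E₁ from E₁ and taking the closure gives a dominant free separator X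
-- of M.  Its rank and size single out a dominant set X′ of M′.  Every basis of M′ is one of the
-- sets B above for X′; the number of these sets depends only on the rank sequences of the orders
-- starting with X′, hence it is the same for X and X′, as is the number of bases.  So X′ is a
-- free separator of M′.

-- The first claim is not proved through pinchpoints. Being a free separator is the equality case of
-- an inequality between two counts, so it can be read off rank sequences. Properness is likewise
-- rephrased by sizes and ranks of sets S ⊆ X ⊆ T, since chains of sets with prescribed sizes and
-- ranks are visible in rank sequences.
--
-- For the second claim only r(X) = r(X′) is given, and the sizes have to be compared first. This is
-- why dominance also speaks of larger sets: a copy in one matroid of the larger of two dominant
-- sets of equal rank must coincide with the smaller one.
--
-- Coloops are removed and the closure is taken for the sake of dominance: a coloop e of M|X could
-- be exchanged for an element outside X without raising the rank, and an element outside X in its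
-- closure could be added to X.
--
-- All counting takes place in ℕ, with sums of arbitrary weights of rank sequences; the field
-- appears only in the passage to these sums and back.

open import Defs
open import Algebra.Apartness.Bundles using (HeytingField; HeytingCommutativeRing)
open import Algebra.Bundles using (CommutativeRing)
open import Algebra.Properties.Group using (∙-cancelˡ)
open import Data.Bool.Base using (true; false; if_then_else_)
import Data.Bool.Properties as Boolₚ
import Data.Empty as Empty
open import Data.Fin.Base as Fin using (Fin; zero; suc; toℕ; punchIn)
open import Data.Fin.Patterns using (1F)
open import Data.Fin.Permutation using (_⟨$⟩ʳ_; insert)
open import Data.Fin.Properties using (any?; all?; toℕ-injective; toℕ-fromℕ<) renaming (_≟_ to _≟ᶠ_)
open import Data.Fin.Subset
open import Data.Fin.Subset.Properties
open import Data.List.Base as List using (List; []; _∷_; _++_; map; concatMap; filter; length; take; drop; allFin; applyUpTo; cartesianProductWith)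
open import Data.List.Membership.Propositional using (lose) renaming (_∈_ to _∈ˡ_)
open import Data.List.Membership.Propositional.Properties
  using (∈-map⁺; ∈-map⁻; ∈-++⁺ˡ; ∈-++⁺ʳ; ∈-concatMap⁺; ∈-concatMap⁻; ∈-∃++; ∈-filter⁺; ∈-filter⁻)
import Data.List.Properties as Listₚ
open import Data.List.Properties
  using (length-map; length-take; length-drop; length-applyUpTo; length-tabulate; map-tabulate; map-injective; tabulate-cong; take++drop≡id)
open import Data.List.Relation.Binary.Permutation.Propositional using (_↭_; ↭-refl; ↭-sym; ↭-trans; prep; swap)
open import Data.List.Relation.Binary.Permutation.Propositional.Properties using (∈-resp-↭; drop-∷; ↭-length; ++⁺; ++⁺ʳ)
open import Data.List.Relation.Ternary.Interleaving.Propositional using (Interleaving; []; consˡ; consʳ; toPermutation)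
open import Data.List.Relation.Unary.All as All using (All)
open import Data.List.Relation.Unary.Any using (Any; here; there)
open import Data.Nat.Base hiding (∣_-_∣)
open import Data.Nat.ListAction using (sum)
open import Data.Nat.Properties
open import Algebra.Properties.CommutativeSemigroup +-commutativeSemigroup using (interchange; x∙yz≈y∙xz; xy∙z≈xz∙y)
open import Data.Product.Base using (∃-syntax; _×_; _,_; proj₁; proj₂)
open import Data.Sum.Base using (_⊎_; inj₁; inj₂; [_,_]′)
open import Data.Vec.Base as Vec using (Vec; []; _∷_; here; there; lookup; removeAt; toList; count)
open import Data.Vec.Properties using (≡-dec; cast-is-id; length-toList; toList-injective; toList-map)
open import Function.Base using (_∘_; id)
open import Function.Bundles using (_⇔_; mk⇔; Equivalence)
open import Relation.Binary.Definitions using (DecidableEquality)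
open import Relation.Binary.PropositionalEquality hiding ([_])
open import Relation.Nullary using (¬_; Dec; yes; no; does; contradiction)
open import Relation.Nullary.Decidable using (dec-true; dec-false; recompute; _×-dec_; _→-dec_; ¬?)

-- Finite sums

∑ : ∀ {a} {A : Set a} → List A → (A → ℕ) → ℕ
∑ xs f = sum (map f xs)

module _ {a} {A : Set a} where

  ∑-++ : ∀ (xs ys : List A) f → ∑ (xs ++ ys) f ≡ ∑ xs f + ∑ ys f
  ∑-++ []       ys f = refl
  ∑-++ (x ∷ xs) ys f = trans (cong (f x +_) (∑-++ xs ys f)) (sym (+-assoc (f x) _ _))

  ∑-cong-∈ : ∀ (xs : List A) {f g} → (∀ {x} → x ∈ˡ xs → f x ≡ g x) → ∑ xs f ≡ ∑ xs g
  ∑-cong-∈ []       f≡g = refl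
  ∑-cong-∈ (x ∷ xs) f≡g = cong₂ _+_ (f≡g (here refl)) (∑-cong-∈ xs (f≡g ∘ there))

  ∑-cong : ∀ (xs : List A) {f g} → (∀ x → f x ≡ g x) → ∑ xs f ≡ ∑ xs g
  ∑-cong xs f≡g = ∑-cong-∈ xs (λ {x} _ → f≡g x)

  ∑-zero : ∀ (xs : List A) {f} → (∀ {x} → x ∈ˡ xs → f x ≡ 0) → ∑ xs f ≡ 0
  ∑-zero []       f≡0 = refl
  ∑-zero (x ∷ xs) f≡0 = cong₂ _+_ (f≡0 (here refl)) (∑-zero xs (f≡0 ∘ there))

  ∑-distrib-+ : ∀ (xs : List A) f g → ∑ xs (λ x → f x + g x) ≡ ∑ xs f + ∑ xs g
  ∑-distrib-+ []       f g = refl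
  ∑-distrib-+ (x ∷ xs) f g =
    trans (cong ((f x + g x) +_) (∑-distrib-+ xs f g)) (interchange (f x) (g x) (∑ xs f) (∑ xs g))

  ∑-const : ∀ (xs : List A) c → ∑ xs (λ _ → c) ≡ length xs * c
  ∑-const []       c = refl
  ∑-const (x ∷ xs) c = cong (c +_) (∑-const xs c)

  ∑-*-distribˡ : ∀ c (xs : List A) f → ∑ xs (λ x → c * f x) ≡ c * ∑ xs f
  ∑-*-distribˡ c []       f = sym (*-zeroʳ c)
  ∑-*-distribˡ c (x ∷ xs) f =
    trans (cong (c * f x +_) (∑-*-distribˡ c xs f)) (sym (*-distribˡ-+ c (f x) _))

  ∑-mono-≤ : ∀ (xs : List A) {f g} → (∀ {x} → x ∈ˡ xs → f x ≤ g x) → ∑ xs f ≤ ∑ xs g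
  ∑-mono-≤ []       f≤g = z≤n
  ∑-mono-≤ (x ∷ xs) f≤g = +-mono-≤ (f≤g (here refl)) (∑-mono-≤ xs (f≤g ∘ there))

  -- This turns an equality of counts into an implication between the counted properties, order by
  -- order. It serves for free separators and for the uniqueness of `X′`.
  ∑-tight : ∀ (xs : List A) {f g} → (∀ {x} → x ∈ˡ xs → f x ≤ g x) → ∑ xs g ≤ ∑ xs f →
            ∀ {x} → x ∈ˡ xs → g x ≤ f x
  ∑-tight (x ∷ xs) {f} {g} f≤g ∑g≤∑f (here refl) =
    +-cancelʳ-≤ (∑ xs g) (g x) (f x)
      (≤-trans ∑g≤∑f (+-monoʳ-≤ (f x) (∑-mono-≤ xs (f≤g ∘ there))))
  ∑-tight (x ∷ xs) {f} {g} f≤g ∑g≤∑f (there y∈) = ∑-tight xs (f≤g ∘ there)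
    (+-cancelˡ-≤ (g x) (∑ xs g) (∑ xs f)
      (≤-trans ∑g≤∑f (+-monoˡ-≤ (∑ xs f) (f≤g (here refl))))) y∈

  ∑-positive : ∀ {xs : List A} {f x} → x ∈ˡ xs → 0 < f x → 0 < ∑ xs f
  ∑-positive {f = f} (here refl)         0<fx = ≤-trans 0<fx (m≤m+n _ _)
  ∑-positive {x ∷ xs} {f = f} (there y∈) 0<fy = ≤-trans (∑-positive y∈ 0<fy) (m≤n+m _ (f x))

  ∑-positive⁻ : ∀ (xs : List A) {f} → 0 < ∑ xs f → ∃[ x ] x ∈ˡ xs × 0 < f x
  ∑-positive⁻ (x ∷ xs) {f} 0<∑ with f x in eq
  ... | suc _ = x , here refl , subst (0 <_) (sym eq) (s≤s z≤n)
  ... | zero with ∑-positive⁻ xs 0<∑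
  ...   | y , y∈ , 0<fy = y , there y∈ , 0<fy

module _ {a b} {A : Set a} {B : Set b} where

  ∑-map : ∀ (h : A → B) xs f → ∑ (map h xs) f ≡ ∑ xs (f ∘ h)
  ∑-map h []       f = refl
  ∑-map h (x ∷ xs) f = cong (f (h x) +_) (∑-map h xs f)

  ∑-concatMap : ∀ (h : A → List B) xs f → ∑ (concatMap h xs) f ≡ ∑ xs (λ x → ∑ (h x) f)
  ∑-concatMap h []       f = refl
  ∑-concatMap h (x ∷ xs) f =
    trans (∑-++ (h x) (concatMap h xs) f) (cong (∑ (h x) f +_) (∑-concatMap h xs f))

  ∑-swap : ∀ (xs : List A) (ys : List B) (f : A → B → ℕ) →
           ∑ xs (λ x → ∑ ys (f x)) ≡ ∑ ys (λ y → ∑ xs (λ x → f x y))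
  ∑-swap []       ys f = sym (∑-zero ys (λ _ → refl))
  ∑-swap (x ∷ xs) ys f =
    trans (cong (∑ ys (f x) +_) (∑-swap xs ys f))
          (sym (∑-distrib-+ ys (f x) (λ y → ∑ xs (λ x → f x y))))

𝟙 : ∀ {p} {P : Set p} → Dec P → ℕ
𝟙 P? = if does P? then 1 else 0

module _ {p} {P : Set p} where

  𝟙-true : (P? : Dec P) → P → 𝟙 P? ≡ 1
  𝟙-true P? p = cong (if_then 1 else 0) (dec-true P? p)

  𝟙-false : (P? : Dec P) → ¬ P → 𝟙 P? ≡ 0
  𝟙-false P? ¬p = cong (if_then 1 else 0) (dec-false P? ¬p)

  𝟙-positive⁻ : (P? : Dec P) → 0 < 𝟙 P? → P
  𝟙-positive⁻ (yes p) _ = p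

𝟙-mono : ∀ {p q} {P : Set p} {Q : Set q} (P? : Dec P) (Q? : Dec Q) → (P → Q) → 𝟙 P? ≤ 𝟙 Q?
𝟙-mono (no _)  Q? _   = z≤n
𝟙-mono (yes p) Q? P→Q = ≤-reflexive (sym (𝟙-true Q? (P→Q p)))

𝟙-cong : ∀ {p q} {P : Set p} {Q : Set q} (P? : Dec P) (Q? : Dec Q) → (P → Q) → (Q → P) → 𝟙 P? ≡ 𝟙 Q?
𝟙-cong P? Q? P→Q Q→P = ≤-antisym (𝟙-mono P? Q? P→Q) (𝟙-mono Q? P? Q→P)

module _ {a} {A : Set a} (_≟_ : DecidableEquality A) where

  multiplicity : A → List A → ℕ
  multiplicity x ys = ∑ ys (λ y → 𝟙 (y ≟ x))

  private
    ∑-mid : ∀ (l : List A) x r f → ∑ (l ++ x ∷ r) f ≡ f x + ∑ (l ++ r) f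
    ∑-mid l x r f = begin
      ∑ (l ++ x ∷ r) f         ≡⟨ ∑-++ l (x ∷ r) f ⟩
      ∑ l f + (f x + ∑ r f)    ≡⟨ +-assoc (∑ l f) (f x) _ ⟨
      (∑ l f + f x) + ∑ r f    ≡⟨ cong (_+ ∑ r f) (+-comm (∑ l f) (f x)) ⟩
      (f x + ∑ l f) + ∑ r f    ≡⟨ +-assoc (f x) _ _ ⟩
      f x + (∑ l f + ∑ r f)    ≡⟨ cong (f x +_) (∑-++ l r f) ⟨
      f x + ∑ (l ++ r) f       ∎
      where open ≡-Reasoning

  -- The head of `xs` has positive multiplicity in `ys`, so it occurs there and can be struck from
  -- both lists. With multiplicities read as coefficients, this leads from equal 𝒢-invariants to
  -- equal sums of any weight.
  ∑-multiplicity : ∀ xs ys → (∀ z → multiplicity z xs ≡ multiplicity z ys) →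
                   ∀ f → ∑ xs f ≡ ∑ ys f
  ∑-multiplicity []       []       _  f = refl
  ∑-multiplicity []       (y ∷ ys) eq f with trans (eq y) (cong (_+ multiplicity y ys) (𝟙-true (y ≟ y) refl))
  ... | ()
  ∑-multiplicity (x ∷ xs) ys       eq f
    with ∑-positive⁻ ys (subst (0 <_) (eq x)
           (≤-trans (≤-reflexive (sym (𝟙-true (x ≟ x) refl))) (m≤m+n _ _)))
  ... | y , y∈ , 0<𝟙 with 𝟙-positive⁻ (y ≟ x) 0<𝟙
  ...   | refl with ∈-∃++ y∈
  ...     | l , r , refl = trans
    (cong (f x +_) (∑-multiplicity xs (l ++ r)
      (λ z → +-cancelˡ-≡ (𝟙 (x ≟ z)) _ _ (trans (eq z) (∑-mid l x r (λ y → 𝟙 (y ≟ z))))) f))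
    (sym (∑-mid l x r f))

-- Orderings and shuffles

module _ {a} {A : Set a} where

  picks : List A → List (A × List A)
  picks []       = []
  picks (x ∷ xs) = (x , xs) ∷ map (λ (y , ys) → y , x ∷ ys) (picks xs)

  -- Meaningful only when the first argument is the length of the list.

  orderings : ℕ → List A → List (List A)
  orderings zero    _  = [] ∷ []
  orderings (suc n) xs = concatMap (λ (x , ys) → map (x ∷_) (orderings n ys)) (picks xs)

  ∑-orderings-suc : ∀ n xs (F : List A → ℕ) →
    ∑ (orderings (suc n) xs) F ≡ ∑ (picks xs) (λ (x , ys) → ∑ (orderings n ys) (F ∘ (x ∷_)))
  ∑-orderings-suc n xs F = trans
    (∑-concatMap (λ (x , ys) → map (x ∷_) (orderings n ys)) (picks xs) F)
    (∑-cong (picks xs) (λ (x , ys) → ∑-map (x ∷_) (orderings n ys) F))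

  picks-↭ : ∀ {x ys} (xs : List A) → (x , ys) ∈ˡ picks xs → xs ↭ x ∷ ys
  picks-↭ (x ∷ xs) (here refl) = ↭-refl
  picks-↭ (x ∷ xs) (there p∈) with ∈-map⁻ _ p∈
  ... | (y , ys) , q∈ , refl = ↭-trans (prep x (picks-↭ xs q∈)) (swap x y ↭-refl)

  picks-length : ∀ {x ys} (xs : List A) → (x , ys) ∈ˡ picks xs → length xs ≡ suc (length ys)
  picks-length xs p∈ = ↭-length (picks-↭ xs p∈)

  ∈⇒picks : ∀ {x} {xs : List A} → x ∈ˡ xs → ∃[ ys ] (x , ys) ∈ˡ picks xs
  ∈⇒picks (here refl) = _ , here refl
  ∈⇒picks (there x∈) with ∈⇒picks x∈
  ... | ys , p∈ = _ , there (∈-map⁺ _ p∈)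

  length-picks : ∀ (xs : List A) → length (picks xs) ≡ length xs
  length-picks []       = refl
  length-picks (x ∷ xs) = cong suc (trans (length-map _ (picks xs)) (length-picks xs))

  ∈-orderings⇒↭ : ∀ n {l} (xs : List A) → length xs ≡ n → l ∈ˡ orderings n xs → l ↭ xs
  ∈-orderings⇒↭ zero    []       _  (here refl) = ↭-refl
  ∈-orderings⇒↭ (suc n) xs       eq l∈
    with ∈-concatMap⁻ (λ (x , ys) → map (x ∷_) (orderings n ys)) {xs = picks xs} l∈
  ... | any = go (picks xs) (λ p∈ → p∈) any
    where
    -- The list of picks shrinks in the recursion; `sub` remembers that it came from `picks xs`.
    go : ∀ {l} ps → (∀ {p} → p ∈ˡ ps → p ∈ˡ picks xs) →
         Any (λ (x , ys) → l ∈ˡ map (x ∷_) (orderings n ys)) ps → l ↭ xs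
    go (p@(x , ys) ∷ ps) sub (here l∈′) with ∈-map⁻ (x ∷_) l∈′
    ... | l′ , l′∈ , refl = ↭-trans
      (prep x (∈-orderings⇒↭ n ys (suc-injective (trans (sym (picks-length xs p∈)) eq)) l′∈))
      (↭-sym (picks-↭ xs p∈))
      where
      p∈ : p ∈ˡ picks xs
      p∈ = sub (here refl)
    go (p ∷ ps) sub (there any) = go ps (sub ∘ there) any

  ↭⇒∈-orderings : ∀ n {l} (xs : List A) → length l ≡ n → l ↭ xs → l ∈ˡ orderings n xs
  ↭⇒∈-orderings zero    {[]}    xs _  _    = here refl
  ↭⇒∈-orderings (suc n) {x ∷ l} xs eq l↭xs with ∈⇒picks (∈-resp-↭ l↭xs (here refl))
  ... | ys , p∈ = ∈-concatMap⁺ (λ (x , ys) → map (x ∷_) (orderings n ys)) {xs = picks xs}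
    (lose p∈ (∈-map⁺ (x ∷_) (↭⇒∈-orderings n ys (suc-injective eq)
      (drop-∷ (↭-trans l↭xs (picks-↭ xs p∈))))))

  length-orderings : ∀ n (xs : List A) → length xs ≡ n → length (orderings n xs) ≡ n !
  length-orderings zero    xs eq = refl
  length-orderings (suc n) xs eq = begin
    length (orderings (suc n) xs)                                       ≡⟨ *-identityʳ _ ⟨
    length (orderings (suc n) xs) * 1                                   ≡⟨ ∑-const (orderings (suc n) xs) 1 ⟨
    ∑ (orderings (suc n) xs) (λ _ → 1)                                  ≡⟨ ∑-orderings-suc n xs (λ _ → 1) ⟩
    ∑ (picks xs) (λ (_ , ys) → ∑ (orderings n ys) (λ _ → 1))            ≡⟨ ∑-cong-∈ (picks xs) step ⟩
    ∑ (picks xs) (λ _ → n !)                                            ≡⟨ ∑-const (picks xs) (n !) ⟩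
    length (picks xs) * n !                                             ≡⟨ cong (_* n !) (trans (length-picks xs) eq) ⟩
    suc n * n !                                                         ∎
    where
    open ≡-Reasoning
    step : ∀ {p} → p ∈ˡ picks xs → ∑ (orderings n (proj₂ p)) (λ _ → 1) ≡ n !
    step {_ , ys} p∈ = begin
      ∑ (orderings n ys) (λ _ → 1)   ≡⟨ ∑-const (orderings n ys) 1 ⟩
      length (orderings n ys) * 1    ≡⟨ *-identityʳ _ ⟩
      length (orderings n ys)        ≡⟨ length-orderings n ys (suc-injective (trans (sym (picks-length xs p∈)) eq)) ⟩
      n !                            ∎

-- A shuffle pattern without the shuffled lists. It depends on two sizes only, so the same shapes
-- serve for `M` and `M′`.
data Shape : ℕ → ℕ → Set where
  []    : Shape 0 0
  left  : ∀ {a b} → Shape a b → Shape (suc a) b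
  right : ∀ {a b} → Shape a b → Shape a (suc b)

shapes : ∀ a b → List (Shape a b)
shapes zero    zero    = [] ∷ []
shapes zero    (suc b) = map right (shapes zero b)
shapes (suc a) zero    = map left (shapes a zero)
shapes (suc a) (suc b) = map left (shapes a (suc b)) ++ map right (shapes (suc a) b)

blocks : ∀ a b → Shape a b
blocks zero    zero    = []
blocks zero    (suc b) = right (blocks zero b)
blocks (suc a) b       = left (blocks a b)

lefts rights : ∀ {a b} → ℕ → Shape a b → ℕ
lefts zero    σ         = 0
lefts (suc j) []        = 0
lefts (suc j) (left σ)  = suc (lefts j σ)
lefts (suc j) (right σ) = lefts j σ
rights zero    σ         = 0
rights (suc j) []        = 0
rights (suc j) (left σ)  = rights j σ
rights (suc j) (right σ) = suc (rights j σ)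

lefts≤ : ∀ {a b} j (σ : Shape a b) → lefts j σ ≤ a
lefts≤ zero    σ         = z≤n
lefts≤ (suc j) []        = z≤n
lefts≤ (suc j) (left σ)  = s≤s (lefts≤ j σ)
lefts≤ (suc j) (right σ) = lefts≤ j σ

rights≤ : ∀ {a b} j (σ : Shape a b) → rights j σ ≤ b
rights≤ zero    σ         = z≤n
rights≤ (suc j) []        = z≤n
rights≤ (suc j) (left σ)  = rights≤ j σ
rights≤ (suc j) (right σ) = s≤s (rights≤ j σ)

lefts+rights : ∀ {a b} j (σ : Shape a b) → j ≤ a + b → lefts j σ + rights j σ ≡ j
lefts+rights zero    σ         _   = refl
lefts+rights (suc j) (left σ)  (s≤s j≤) = cong suc (lefts+rights j σ j≤)
lefts+rights {a} (suc j) (right {b = b} σ) j≤ = trans (+-suc (lefts j σ) (rights j σ))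
  (cong suc (lefts+rights j σ (s≤s⁻¹ (≤-trans j≤ (≤-reflexive (+-suc a b))))))

-- A shape with no `right` among its first `a` letters has used up every `left` there, hence is
-- `blocks a b`; all other terms vanish.
∑-shapes-blocks : ∀ a b (H : Shape a b → ℕ) → (∀ σ → 0 < rights a σ → H σ ≡ 0) →
                  ∑ (shapes a b) H ≡ H (blocks a b)
∑-shapes-blocks zero    zero    H _   = +-identityʳ (H [])
∑-shapes-blocks zero    (suc b) H H≡0 =
  trans (∑-map right (shapes zero b) H) (∑-shapes-blocks zero b (H ∘ right) (λ _ ()))
∑-shapes-blocks (suc a) zero    H H≡0 =
  trans (∑-map left (shapes a zero) H) (∑-shapes-blocks a zero (H ∘ left) (λ σ → H≡0 (left σ)))
∑-shapes-blocks (suc a) (suc b) H H≡0 = begin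
  ∑ (map left (shapes a (suc b)) ++ map right (shapes (suc a) b)) H
    ≡⟨ ∑-++ (map left (shapes a (suc b))) _ H ⟩
  ∑ (map left (shapes a (suc b))) H + ∑ (map right (shapes (suc a) b)) H
    ≡⟨ cong₂ _+_ (∑-map left (shapes a (suc b)) H) (∑-map right (shapes (suc a) b) H) ⟩
  ∑ (shapes a (suc b)) (H ∘ left) + ∑ (shapes (suc a) b) (H ∘ right)
    ≡⟨ cong₂ _+_ (∑-shapes-blocks a (suc b) (H ∘ left) (λ σ → H≡0 (left σ)))
                 (∑-zero (shapes (suc a) b) (λ {σ} _ → H≡0 (right σ) (s≤s z≤n))) ⟩
  H (blocks (suc a) (suc b)) + 0
    ≡⟨ +-identityʳ _ ⟩
  H (blocks (suc a) (suc b)) ∎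
  where open ≡-Reasoning

module _ {ℓ} {A : Set ℓ} where

  -- Meaningful only for lists of lengths a and b.

  merge : ∀ {a b} → Shape a b → List A → List A → List A
  merge (left σ)  (x ∷ α) β       = x ∷ merge σ α β
  merge (right σ) α       (y ∷ β) = y ∷ merge σ α β
  merge _         _       _       = []

  merge-interleaving : ∀ {a b} (σ : Shape a b) α β → length α ≡ a → length β ≡ b →
                       ∀ j → Interleaving (take (lefts j σ) α) (take (rights j σ) β) (take j (merge σ α β))
  merge-interleaving σ         α       β       _   _   zero    = []
  merge-interleaving []        []      []      _   _   (suc j) = []
  merge-interleaving (left σ)  (x ∷ α) β       |α| |β| (suc j) =
    consˡ (merge-interleaving σ α β (suc-injective |α|) |β| j)
  merge-interleaving (right σ) α       (y ∷ β) |α| |β| (suc j) =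
    consʳ (merge-interleaving σ α β |α| (suc-injective |β|) j)

  merge-blocks : ∀ a b (α β : List A) → length α ≡ a → length β ≡ b →
                 merge (blocks a b) α β ≡ α ++ β
  merge-blocks zero    zero    []      []      _   _   = refl
  merge-blocks zero    (suc b) []      (y ∷ β) _   |β| = cong (y ∷_) (merge-blocks zero b [] β refl (suc-injective |β|))
  merge-blocks (suc a) b       (x ∷ α) β       |α| |β| = cong (x ∷_) (merge-blocks a b α β (suc-injective |α|) |β|)

  -- An element picked from `zs` belongs to one of the two parts, and what remains is again an
  -- interleaving. `G₁` and `G₂` are kept apart from `G` because in `∑-shuffle` they are already
  -- sums over the shuffles of the shorter lists.
  ∑-picks-interleaving : ∀ {xs ys zs : List A} → Interleaving xs ys zs →
    ∀ (G G₁ G₂ : A × List A → ℕ) →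
    (∀ x xs′ zs′ → length xs ≡ suc (length xs′) → Interleaving xs′ ys zs′ → G (x , zs′) ≡ G₁ (x , xs′)) →
    (∀ y ys′ zs′ → length ys ≡ suc (length ys′) → Interleaving xs ys′ zs′ → G (y , zs′) ≡ G₂ (y , ys′)) →
    ∑ (picks zs) G ≡ ∑ (picks xs) G₁ + ∑ (picks ys) G₂
  ∑-picks-interleaving []       G G₁ G₂ h₁ h₂ = refl
  ∑-picks-interleaving {x ∷ xs} {ys} {_ ∷ zs} (consˡ i) G G₁ G₂ h₁ h₂ = begin
    G (x , zs) + ∑ (map (λ (y , l) → y , x ∷ l) (picks zs)) G
      ≡⟨ cong₂ _+_ (h₁ x xs zs refl i) (∑-map (λ (y , l) → y , x ∷ l) (picks zs) G) ⟩
    G₁ (x , xs) + ∑ (picks zs) (λ (y , l) → G (y , x ∷ l))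
      ≡⟨ cong (G₁ (x , xs) +_) (∑-picks-interleaving i (λ (y , l) → G (y , x ∷ l)) (λ (y , l) → G₁ (y , x ∷ l)) G₂
           (λ y l l′ eq j → h₁ y (x ∷ l) (x ∷ l′) (cong suc eq) (consˡ j))
           (λ y l l′ eq j → h₂ y l (x ∷ l′) eq (consˡ j))) ⟩
    G₁ (x , xs) + (∑ (picks xs) (λ (y , l) → G₁ (y , x ∷ l)) + ∑ (picks ys) G₂)
      ≡⟨ +-assoc (G₁ (x , xs)) _ _ ⟨
    (G₁ (x , xs) + ∑ (picks xs) (λ (y , l) → G₁ (y , x ∷ l))) + ∑ (picks ys) G₂
      ≡⟨ cong (λ s → (G₁ (x , xs) + s) + ∑ (picks ys) G₂) (∑-map (λ (y , l) → y , x ∷ l) (picks xs) G₁) ⟨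
    ∑ (picks (x ∷ xs)) G₁ + ∑ (picks ys) G₂ ∎
    where open ≡-Reasoning
  ∑-picks-interleaving {xs} {x ∷ ys} {_ ∷ zs} (consʳ i) G G₁ G₂ h₁ h₂ = begin
    G (x , zs) + ∑ (map (λ (y , l) → y , x ∷ l) (picks zs)) G
      ≡⟨ cong₂ _+_ (h₂ x ys zs refl i) (∑-map (λ (y , l) → y , x ∷ l) (picks zs) G) ⟩
    G₂ (x , ys) + ∑ (picks zs) (λ (y , l) → G (y , x ∷ l))
      ≡⟨ cong (G₂ (x , ys) +_) (∑-picks-interleaving i (λ (y , l) → G (y , x ∷ l)) G₁ (λ (y , l) → G₂ (y , x ∷ l))
           (λ y l l′ eq j → h₁ y l (x ∷ l′) eq (consʳ j))
           (λ y l l′ eq j → h₂ y (x ∷ l) (x ∷ l′) (cong suc eq) (consʳ j))) ⟩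
    G₂ (x , ys) + (∑ (picks xs) G₁ + ∑ (picks ys) (λ (y , l) → G₂ (y , x ∷ l)))
      ≡⟨ x∙yz≈y∙xz (G₂ (x , ys)) (∑ (picks xs) G₁) _ ⟩
    ∑ (picks xs) G₁ + (G₂ (x , ys) + ∑ (picks ys) (λ (y , l) → G₂ (y , x ∷ l)))
      ≡⟨ cong (λ s → ∑ (picks xs) G₁ + (G₂ (x , ys) + s)) (∑-map (λ (y , l) → y , x ∷ l) (picks ys) G₂) ⟨
    ∑ (picks xs) G₁ + ∑ (picks (x ∷ ys)) G₂ ∎
    where open ≡-Reasoning

  ∑-merge : ∀ {a b} → Shape a b → List A → List A → (List A → ℕ) → ℕ
  ∑-merge {a} {b} σ xs ys F = ∑ (orderings a xs) (λ α → ∑ (orderings b ys) (λ β → F (merge σ α β)))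

  private
    interleaving-[]ˡ : ∀ {ys zs : List A} → Interleaving [] ys zs → zs ≡ ys
    interleaving-[]ˡ []        = refl
    interleaving-[]ˡ (consʳ i) = cong (_ ∷_) (interleaving-[]ˡ i)

  -- An ordering of a disjoint union is a shuffle of an ordering of each part.

  ∑-shuffle : ∀ a b {xs ys zs : List A} → Interleaving xs ys zs → length xs ≡ a → length ys ≡ b →
              ∀ F → ∑ (orderings (a + b) zs) F ≡ ∑ (shapes a b) (λ σ → ∑-merge σ xs ys F)
  -- A shape that begins with `left` takes its first entry from the order of `xs`, and choosing this
  -- entry is the first step in building that order.
  ∑-lefts : ∀ a b (xs ys : List A) F →
    ∑ (picks xs) (λ (x , xs′) → ∑ (shapes a b) (λ σ → ∑-merge σ xs′ ys (F ∘ (x ∷_)))) ≡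
    ∑ (map left (shapes a b)) (λ σ → ∑-merge σ xs ys F)
  ∑-rights : ∀ a b (xs ys : List A) F →
    ∑ (picks ys) (λ (y , ys′) → ∑ (shapes a b) (λ σ → ∑-merge σ xs ys′ (F ∘ (y ∷_)))) ≡
    ∑ (map right (shapes a b)) (λ σ → ∑-merge σ xs ys F)

  ∑-lefts a b xs ys F = begin
    ∑ (picks xs) (λ (x , xs′) → ∑ (shapes a b) (λ σ → ∑-merge σ xs′ ys (F ∘ (x ∷_))))
      ≡⟨ ∑-swap (picks xs) (shapes a b) (λ (x , xs′) σ → ∑-merge σ xs′ ys (F ∘ (x ∷_))) ⟩
    ∑ (shapes a b) (λ σ → ∑ (picks xs) (λ (x , xs′) → ∑-merge σ xs′ ys (F ∘ (x ∷_))))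
      ≡⟨ ∑-cong (shapes a b) (λ σ → sym (∑-orderings-suc a xs
           (λ α → ∑ (orderings b ys) (λ β → F (merge (left σ) α β))))) ⟩
    ∑ (shapes a b) (λ σ → ∑-merge (left σ) xs ys F)
      ≡⟨ ∑-map left (shapes a b) (λ σ → ∑-merge σ xs ys F) ⟨
    ∑ (map left (shapes a b)) (λ σ → ∑-merge σ xs ys F) ∎
    where open ≡-Reasoning

  ∑-rights a b xs ys F = begin
    ∑ (picks ys) (λ (y , ys′) → ∑ (shapes a b) (λ σ → ∑-merge σ xs ys′ (F ∘ (y ∷_))))
      ≡⟨ ∑-swap (picks ys) (shapes a b) (λ (y , ys′) σ → ∑-merge σ xs ys′ (F ∘ (y ∷_))) ⟩
    ∑ (shapes a b) (λ σ → ∑ (picks ys) (λ (y , ys′) → ∑-merge σ xs ys′ (F ∘ (y ∷_))))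
      -- The order of `xs` is summed outside that of `ys`, so the pick from `ys` has to move inside
      -- the sum over `α`.
      ≡⟨ ∑-cong (shapes a b) (λ σ → ∑-swap (picks ys) (orderings a xs)
           (λ (y , ys′) α → ∑ (orderings b ys′) (λ β → F (y ∷ merge σ α β)))) ⟩
    ∑ (shapes a b) (λ σ → ∑ (orderings a xs) (λ α →
      ∑ (picks ys) (λ (y , ys′) → ∑ (orderings b ys′) (λ β → F (y ∷ merge σ α β)))))
      ≡⟨ ∑-cong (shapes a b) (λ σ → ∑-cong (orderings a xs) (λ α → sym
           (∑-orderings-suc b ys (λ β → F (merge (right σ) α β))))) ⟩
    ∑ (shapes a b) (λ σ → ∑-merge (right σ) xs ys F)
      ≡⟨ ∑-map right (shapes a b) (λ σ → ∑-merge σ xs ys F) ⟨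
    ∑ (map right (shapes a b)) (λ σ → ∑-merge σ xs ys F) ∎
    where open ≡-Reasoning

  ∑-shuffle zero    zero    {[]} {[]} [] _ _ F = sym (trans (+-identityʳ _) (+-identityʳ _))
  ∑-shuffle zero    (suc b) {[]} {ys} {zs} i _ |ys| F with interleaving-[]ˡ i
  ... | refl = begin
    ∑ (orderings (suc b) ys) F
      ≡⟨ ∑-orderings-suc b ys F ⟩
    ∑ (picks ys) (λ (y , ys′) → ∑ (orderings b ys′) (F ∘ (y ∷_)))
      ≡⟨ ∑-cong-∈ (picks ys) (λ {(y , ys′)} p∈ → ∑-shuffle zero b (all-right ys′) refl
           (suc-injective (trans (sym (picks-length ys p∈)) |ys|)) (F ∘ (y ∷_))) ⟩
    ∑ (picks ys) (λ (y , ys′) → ∑ (shapes zero b) (λ σ → ∑-merge σ [] ys′ (F ∘ (y ∷_))))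
      ≡⟨ ∑-rights zero b [] ys F ⟩
    ∑ (shapes zero (suc b)) (λ σ → ∑-merge σ [] ys F) ∎
    where
    open ≡-Reasoning
    all-right : ∀ ys → Interleaving [] ys ys
    all-right []       = []
    all-right (y ∷ ys) = consʳ (all-right ys)
  ∑-shuffle (suc a) zero    {xs} {[]} {zs} i |xs| _ F = begin
    ∑ (orderings (suc (a + 0)) zs) F
      ≡⟨ ∑-orderings-suc (a + 0) zs F ⟩
    ∑ (picks zs) (λ (z , zs′) → ∑ (orderings (a + 0) zs′) (F ∘ (z ∷_)))
      ≡⟨ ∑-picks-interleaving i _ _ (λ _ → 0)
           (λ x xs′ zs′ eq j → ∑-shuffle a zero j (suc-injective (trans (sym eq) |xs|)) refl (F ∘ (x ∷_)))
           (λ _ _ _ ()) ⟩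
    ∑ (picks xs) (λ (x , xs′) → ∑ (shapes a zero) (λ σ → ∑-merge σ xs′ [] (F ∘ (x ∷_)))) + 0
      ≡⟨ +-identityʳ _ ⟩
    ∑ (picks xs) (λ (x , xs′) → ∑ (shapes a zero) (λ σ → ∑-merge σ xs′ [] (F ∘ (x ∷_))))
      ≡⟨ ∑-lefts a zero xs [] F ⟩
    ∑ (shapes (suc a) zero) (λ σ → ∑-merge σ xs [] F) ∎
    where open ≡-Reasoning
  ∑-shuffle (suc a) (suc b) {xs} {ys} {zs} i |xs| |ys| F = begin
    ∑ (orderings (suc (a + suc b)) zs) F
      ≡⟨ ∑-orderings-suc (a + suc b) zs F ⟩
    ∑ (picks zs) (λ (z , zs′) → ∑ (orderings (a + suc b) zs′) (F ∘ (z ∷_)))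
      ≡⟨ ∑-picks-interleaving i _ _ _
           (λ x xs′ zs′ eq j → ∑-shuffle a (suc b) j (suc-injective (trans (sym eq) |xs|)) |ys| (F ∘ (x ∷_)))
           (λ y ys′ zs′ eq j → trans (cong (λ n → ∑ (orderings n zs′) (F ∘ (y ∷_))) (+-suc a b))
             (∑-shuffle (suc a) b j |xs| (suc-injective (trans (sym eq) |ys|)) (F ∘ (y ∷_)))) ⟩
    ∑ (picks xs) (λ (x , xs′) → ∑ (shapes a (suc b)) (λ σ → ∑-merge σ xs′ ys (F ∘ (x ∷_)))) +
    ∑ (picks ys) (λ (y , ys′) → ∑ (shapes (suc a) b) (λ σ → ∑-merge σ xs ys′ (F ∘ (y ∷_))))
      ≡⟨ cong₂ _+_ (∑-lefts a (suc b) xs ys F) (∑-rights (suc a) b xs ys F) ⟩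
    ∑ (map left (shapes a (suc b))) (λ σ → ∑-merge σ xs ys F) +
    ∑ (map right (shapes (suc a) b)) (λ σ → ∑-merge σ xs ys F)
      ≡⟨ ∑-++ (map left (shapes a (suc b))) (map right (shapes (suc a) b)) (λ σ → ∑-merge σ xs ys F) ⟨
    ∑ (shapes (suc a) (suc b)) (λ σ → ∑-merge σ xs ys F) ∎
    where open ≡-Reasoning

-- Rank sequences as functions of ordered lists

module _ {a} {A : Set a} where

  -- Stated for any `f`, since recursion on the list replaces `f` by `f ∘ (x ∷_)`, which is not the
  -- rank of the set listed.
  profile : (List A → ℕ) → List A → List ℕ
  profile f l = applyUpTo (λ j → f (take (suc j) l) ∸ f (take j l)) (length l)

  lookup-punchIn : ∀ {n} (v : Vec A (suc n)) i k → lookup v (punchIn i k) ≡ lookup (removeAt v i) k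
  lookup-punchIn (x ∷ v)         zero    k       = refl
  lookup-punchIn (x ∷ v@(_ ∷ _)) (suc i) zero    = refl
  lookup-punchIn (x ∷ v@(_ ∷ _)) (suc i) (suc k) = lookup-punchIn v i k

  ∑-removeAt : ∀ {n} (v : Vec A (suc n)) (G : A × List A → ℕ) →
    ∑ (allFin (suc n)) (λ i → G (lookup v i , toList (removeAt v i))) ≡ ∑ (picks (toList v)) G
  ∑-removeAt {zero}  (x ∷ [])        G = refl
  ∑-removeAt {suc n} (x ∷ v@(_ ∷ _)) G = cong (G (x , toList v) +_) (begin
    ∑ (List.tabulate suc) (λ i → G (lookup (x ∷ v) i , toList (removeAt (x ∷ v) i)))
      ≡⟨ cong (λ l → ∑ l (λ i → G (lookup (x ∷ v) i , toList (removeAt (x ∷ v) i)))) (map-tabulate {n = suc n} (λ i → i) suc) ⟨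
    ∑ (map suc (allFin (suc n))) (λ i → G (lookup (x ∷ v) i , toList (removeAt (x ∷ v) i)))
      ≡⟨ ∑-map suc (allFin (suc n)) (λ i → G (lookup (x ∷ v) i , toList (removeAt (x ∷ v) i))) ⟩
    ∑ (allFin (suc n)) (λ i → G (lookup v i , x ∷ toList (removeAt v i)))
      ≡⟨ ∑-removeAt v (λ (y , ys) → G (y , x ∷ ys)) ⟩
    ∑ (picks (toList v)) (λ (y , ys) → G (y , x ∷ ys))
      ≡⟨ ∑-map (λ (y , ys) → y , x ∷ ys) (picks (toList v)) G ⟨
    ∑ (map (λ (y , ys) → y , x ∷ ys) (picks (toList v))) G ∎)
    where open ≡-Reasoning

∑-cartesianProductWith : ∀ {a b c} {A : Set a} {B : Set b} {C : Set c} (h : A → B → C) xs ys F →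
  ∑ (cartesianProductWith h xs ys) F ≡ ∑ xs (λ x → ∑ ys (λ y → F (h x y)))
∑-cartesianProductWith h []       ys F = refl
∑-cartesianProductWith h (x ∷ xs) ys F = trans
  (∑-++ (map (h x) ys) (cartesianProductWith h xs ys) F)
  (cong₂ _+_ (∑-map (h x) ys F) (∑-cartesianProductWith h xs ys F))

-- Listing `v` along `insert zero i π` puts entry `i` first and then lists the remaining entries
-- along `π`, just as `orderings` picks a head and orders the rest. Permutations can thus be
-- replaced by lists.
∑-permutations : ∀ {a} {A : Set a} n (v : Vec A n) (F : List A → ℕ) →
  ∑ (permutations n) (λ π → F (List.tabulate (λ i → lookup v (π ⟨$⟩ʳ i)))) ≡
  ∑ (orderings n (toList v)) F
∑-permutations zero    v F = refl
∑-permutations (suc n) v F = begin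
  ∑ (permutations (suc n)) (λ π → F (List.tabulate (λ i → lookup v (π ⟨$⟩ʳ i))))
    ≡⟨ ∑-cartesianProductWith (insert zero) (allFin (suc n)) (permutations n)
         (λ π → F (List.tabulate (λ i → lookup v (π ⟨$⟩ʳ i)))) ⟩
  ∑ (allFin (suc n)) (λ i → ∑ (permutations n) (λ π →
    F (lookup v i ∷ List.tabulate (λ k → lookup v (punchIn i (π ⟨$⟩ʳ k))))))
    ≡⟨ ∑-cong (allFin (suc n)) (λ i → ∑-cong (permutations n) (λ π →
         cong (F ∘ (lookup v i ∷_)) (tabulate-cong (λ k → lookup-punchIn v i (π ⟨$⟩ʳ k))))) ⟩
  ∑ (allFin (suc n)) (λ i → ∑ (permutations n) (λ π →
    F (lookup v i ∷ List.tabulate (λ k → lookup (removeAt v i) (π ⟨$⟩ʳ k)))))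
    ≡⟨ ∑-cong (allFin (suc n)) (λ i → ∑-permutations n (removeAt v i) (F ∘ (lookup v i ∷_))) ⟩
  ∑ (allFin (suc n)) (λ i → ∑ (orderings n (toList (removeAt v i))) (F ∘ (lookup v i ∷_)))
    ≡⟨ ∑-removeAt v (λ (x , xs) → ∑ (orderings n xs) (F ∘ (x ∷_))) ⟩
  ∑ (picks (toList v)) (λ (x , xs) → ∑ (orderings n xs) (F ∘ (x ∷_)))
    ≡⟨ ∑-orderings-suc n (toList v) F ⟨
  ∑ (orderings (suc n) (toList v)) F ∎
  where open ≡-Reasoning

bitList : ∀ {n r} → Symbol n r → List ℕ
bitList s = map toℕ (toList (bits s))

linearOrders : ∀ {N} → Subset N → List (List (Fin N))
linearOrders E = orderings ∣ E ∣ (toList (elements E))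

module _ {N : ℕ} {E : Subset N} (M : Matroid E) where

  rankProfile : List (Fin N) → List ℕ
  rankProfile = profile (rank M ∘ fromList)

  ∑-profiles : (List ℕ → ℕ) → ℕ
  ∑-profiles Φ = ∑ (linearOrders E) (Φ ∘ rankProfile)

  private
    toList-increments : ∀ n g step →
      map toℕ (toList (increments n g step)) ≡ applyUpTo (λ j → g (suc j) ∸ g j) n
    toList-increments zero    g step = refl
    toList-increments (suc n) g step =
      cong₂ _∷_ (toℕ-fromℕ< (step 0)) (toList-increments n (g ∘ suc) (step ∘ suc))

  bitList-rankSequence : ∀ π → bitList (rankSequence M π) ≡ rankProfile (ordering E π)
  bitList-rankSequence π = trans (toList-increments ∣ E ∣ (rank M ∘ prefix E π) (rank-prefix-step E π M))
    (cong (applyUpTo _) (sym (length-tabulate (λ i → lookup (elements E) (π ⟨$⟩ʳ i)))))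

  ∑-rankSequences : ∀ Φ → ∑ (permutations ∣ E ∣) (Φ ∘ bitList ∘ rankSequence M) ≡ ∑-profiles Φ
  ∑-rankSequences Φ = trans
    (∑-cong (permutations ∣ E ∣) (λ π → cong Φ (bitList-rankSequence π)))
    (∑-permutations ∣ E ∣ (elements E) (Φ ∘ rankProfile))

-- Equality of the 𝒢-invariants with the field removed. Since `Φ` is any weight on sequences, every
-- statistic of rank sequences is transferred by instantiating it.
record SameProfiles {N N′} {E : Subset N} {E′ : Subset N′} (M : Matroid E) (M′ : Matroid E′) : Set where
  constructor sameProfiles
  field
    size  : ∣ E ∣ ≡ ∣ E′ ∣
    rk    : rank M E ≡ rank M′ E′
    sums  : ∀ Φ → ∑-profiles M Φ ≡ ∑-profiles M′ Φ

SameProfiles-sym : ∀ {N N′} {E : Subset N} {E′ : Subset N′} {M : Matroid E} {M′ : Matroid E′} →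
                   SameProfiles M M′ → SameProfiles M′ M
SameProfiles-sym (sameProfiles size rk sums) = sameProfiles (sym size) (sym rk) (sym ∘ sums)

-- Coefficients over the field and multiplicities in ℕ

module _ {c ℓ₁ ℓ₂} (K : HeytingField c ℓ₁ ℓ₂) where

  private
    module K = HeytingField K
    R = HeytingCommutativeRing.commutativeRing K.heytingCommutativeRing
    module R = CommutativeRing R
    open import Algebra.Definitions.RawMonoid R.+-rawMonoid using () renaming (_×_ to _×ᴷ_)

    _≟ᵛ_ : ∀ {n} → DecidableEquality (Vec (Fin 2) n)
    _≟ᵛ_ = ≡-dec _≟ᶠ_

    combination : ∀ {I : Set} {n r} → (I → Symbol n r) → List I → 𝒢 K n r
    combination h ps = List.foldr (_⊕_ K) (𝟎 K) (map (λ p → [_] K (h p)) ps)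

    coefficient : ∀ {I : Set} {n r} (h : I → Symbol n r) ps s →
      combination h ps s K.≈ ∑ ps (λ p → 𝟙 (bits (h p) ≟ᵛ bits s)) ×ᴷ K.1#
    coefficient h []       s = R.refl
    coefficient h (p ∷ ps) s with does (bits (h p) ≟ᵛ bits s)
    ... | true  = R.+-cong R.refl (coefficient h ps s)
    ... | false = R.trans (R.+-identityˡ _) (coefficient h ps s)

    -- Characteristic zero enters here: cancelling one unit at a time reduces to the case in which
    -- one of the multiples is zero.
    ×ᴷ-injective : CharacteristicZero K → ∀ m n → m ×ᴷ K.1# K.≈ n ×ᴷ K.1# → m ≡ n
    ×ᴷ-injective char zero    n       eq = sym (char n (R.sym eq))
    ×ᴷ-injective char (suc m) zero    eq = char (suc m) eq
    ×ᴷ-injective char (suc m) (suc n) eq =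
      cong suc (×ᴷ-injective char m n (∙-cancelˡ R.+-group K.1# _ _ eq))

    bitList-injective : ∀ {n r} {s t : Symbol n r} → bitList s ≡ bitList t → bits s ≡ bits t
    bitList-injective eq =
      trans (sym (cast-is-id refl _)) (toList-injective refl _ _ (map-injective toℕ-injective eq))

    -- The indices of the two spaces are variables here, so that matching on `equal` can identify
    -- them; for `∣ E ∣` and `∣ E′ ∣` no unifier would be found.
    Equal⇒sums : CharacteristicZero K → ∀ {I J : Set} {n r n′ r′} (h : I → Symbol n r) (h′ : J → Symbol n′ r′) ps qs →
      Equal K (combination h ps) (combination h′ qs) →
      n ≡ n′ × r ≡ r′ × (∀ Φ → ∑ ps (Φ ∘ bitList ∘ h) ≡ ∑ qs (Φ ∘ bitList ∘ h′))
    Equal⇒sums char {n = n} {r} h h′ ps qs (equal u≈v) = refl , refl , λ Φ → begin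
      ∑ ps (Φ ∘ bitList ∘ h)                                  ≡⟨ ∑-map (bits ∘ h) ps (Φ ∘ map toℕ ∘ toList) ⟨
      ∑ (map (bits ∘ h) ps) (Φ ∘ map toℕ ∘ toList)    ≡⟨ ∑-multiplicity _≟ᵛ_ (map (bits ∘ h) ps) (map (bits ∘ h′) qs) multiplicities (Φ ∘ map toℕ ∘ toList) ⟩
      ∑ (map (bits ∘ h′) qs) (Φ ∘ map toℕ ∘ toList)   ≡⟨ ∑-map (bits ∘ h′) qs (Φ ∘ map toℕ ∘ toList) ⟩
      ∑ qs (Φ ∘ bitList ∘ h′)                                 ∎
      where
      open ≡-Reasoning
      -- The field `ones` is irrelevant; its proof is recovered by deciding the equation.
      ones≡ : ∀ (s : Symbol n r) → count (_≟ᶠ 1F) (bits s) ≡ r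
      ones≡ record { bits = b ; ones = eq } = recompute (count (_≟ᶠ 1F) b ≟ r) eq
      absent : ∀ {I : Set} (h : I → Symbol n r) ps z → count (_≟ᶠ 1F) z ≢ r →
               ∑ ps (λ p → 𝟙 (bits (h p) ≟ᵛ z)) ≡ 0
      absent h ps z z≢r = ∑-zero ps (λ {p} _ → 𝟙-false (bits (h p) ≟ᵛ z)
        (λ eq → z≢r (trans (cong (count (_≟ᶠ 1F)) (sym eq)) (ones≡ (h p)))))
      multiplicities : ∀ z → multiplicity _≟ᵛ_ z (map (bits ∘ h) ps) ≡ multiplicity _≟ᵛ_ z (map (bits ∘ h′) qs)
      multiplicities z rewrite ∑-map (bits ∘ h) ps (λ y → 𝟙 (y ≟ᵛ z)) | ∑-map (bits ∘ h′) qs (λ y → 𝟙 (y ≟ᵛ z))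
        with count (_≟ᶠ 1F) z ≟ r
      ... | yes eq = ×ᴷ-injective char _ _ (R.trans (R.sym (coefficient h ps s)) (R.trans (u≈v s) (coefficient h′ qs s)))
        where
        s : Symbol n r
        s = record { bits = z ; ones = eq }
      -- A vector with the wrong number of ones is no basis symbol, so `u≈v` says nothing about it;
      -- it occurs in neither list.
      ... | no z≢r = trans (absent h ps z z≢r) (sym (absent h′ qs z z≢r))

    -- A coefficient is the sum of the weight that tests for one particular bit list.
    sums⇒Equal : ∀ {I J : Set} {n r n′ r′} (h : I → Symbol n r) (h′ : J → Symbol n′ r′) ps qs →
      n ≡ n′ → r ≡ r′ → (∀ Φ → ∑ ps (Φ ∘ bitList ∘ h) ≡ ∑ qs (Φ ∘ bitList ∘ h′)) →
      Equal K (combination h ps) (combination h′ qs)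
    sums⇒Equal {n = n} {r} h h′ ps qs refl refl sums = equal λ s → R.trans (coefficient h ps s)
      (R.trans (R.reflexive (cong (_×ᴷ K.1#) (same s))) (R.sym (coefficient h′ qs s)))
      where
      test : ∀ (s t : Symbol n r) → 𝟙 (bits s ≟ᵛ bits t) ≡ 𝟙 (Listₚ.≡-dec _≟_ (bitList s) (bitList t))
      test s t = 𝟙-cong (bits s ≟ᵛ bits t) (Listₚ.≡-dec _≟_ (bitList s) (bitList t)) (cong (map toℕ ∘ toList)) (bitList-injective {s = s} {t})
      same : ∀ s → ∑ ps (λ p → 𝟙 (bits (h p) ≟ᵛ bits s)) ≡ ∑ qs (λ q → 𝟙 (bits (h′ q) ≟ᵛ bits s))
      same s = trans (∑-cong ps (λ p → test (h p) s))
        (trans (sums (λ l → 𝟙 (Listₚ.≡-dec _≟_ l (bitList s)))) (∑-cong qs (λ q → sym (test (h′ q) s))))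

  module _ {N N′} {E : Subset N} {E′ : Subset N′} (M : Matroid E) (M′ : Matroid E′) where

    Same𝒢⇒SameProfiles : CharacteristicZero K → Same𝒢 K M M′ → SameProfiles M M′
    Same𝒢⇒SameProfiles char eq
      with Equal⇒sums char (rankSequence M) (rankSequence M′) (permutations ∣ E ∣) (permutations ∣ E′ ∣) eq
    ... | size , rk , sums = sameProfiles size rk λ Φ →
      trans (sym (∑-rankSequences M Φ)) (trans (sums Φ) (∑-rankSequences M′ Φ))

    SameProfiles⇒Same𝒢 : SameProfiles M M′ → Same𝒢 K M M′
    SameProfiles⇒Same𝒢 (sameProfiles size rk sums) =
      sums⇒Equal (rankSequence M) (rankSequence M′) (permutations ∣ E ∣) (permutations ∣ E′ ∣) size rk λ Φ →
        trans (∑-rankSequences M Φ) (trans (sums Φ) (sym (∑-rankSequences M′ Φ)))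

-- Finite subsets

private
  variable
    n : ℕ
    p q : Subset n
    x : Fin n

x∈p─q⁻ : ∀ (p q : Subset n) → x ∈ p ─ q → x ∈ p × x ∉ q
x∈p─q⁻ (inside ∷ p) (outside ∷ q) here       = here , λ ()
x∈p─q⁻ (s ∷ p)      (outside ∷ q) (there x∈) with x∈p─q⁻ p q x∈
... | x∈p , x∉q = there x∈p , λ { (there x∈q) → x∉q x∈q }
x∈p─q⁻ (s ∷ p)      (inside ∷ q)  (there x∈) with x∈p─q⁻ p q x∈
... | x∈p , x∉q = there x∈p , λ { (there x∈q) → x∉q x∈q }

∣p∪q∣+∣p∩q∣ : ∀ (p q : Subset n) → ∣ p ∪ q ∣ + ∣ p ∩ q ∣ ≡ ∣ p ∣ + ∣ q ∣
∣p∪q∣+∣p∩q∣ []            []            = refl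
∣p∪q∣+∣p∩q∣ (outside ∷ p) (outside ∷ q) = ∣p∪q∣+∣p∩q∣ p q
∣p∪q∣+∣p∩q∣ (outside ∷ p) (inside  ∷ q) = trans (cong suc (∣p∪q∣+∣p∩q∣ p q)) (sym (+-suc ∣ p ∣ ∣ q ∣))
∣p∪q∣+∣p∩q∣ (inside  ∷ p) (outside ∷ q) = cong suc (∣p∪q∣+∣p∩q∣ p q)
∣p∪q∣+∣p∩q∣ (inside  ∷ p) (inside  ∷ q) = cong suc (begin
  ∣ p ∪ q ∣ + suc ∣ p ∩ q ∣    ≡⟨ +-suc ∣ p ∪ q ∣ ∣ p ∩ q ∣ ⟩
  suc (∣ p ∪ q ∣ + ∣ p ∩ q ∣)  ≡⟨ cong suc (∣p∪q∣+∣p∩q∣ p q) ⟩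
  suc (∣ p ∣ + ∣ q ∣)          ≡⟨ +-suc ∣ p ∣ ∣ q ∣ ⟨
  ∣ p ∣ + suc ∣ q ∣            ∎)
  where open ≡-Reasoning

∣p∪q∣≤∣p∣+∣q∣ : ∀ (p q : Subset n) → ∣ p ∪ q ∣ ≤ ∣ p ∣ + ∣ q ∣
∣p∪q∣≤∣p∣+∣q∣ p q = m+n≤o⇒m≤o ∣ p ∪ q ∣ (≤-reflexive (∣p∪q∣+∣p∩q∣ p q))

∣p∪q∣-disjoint : ∀ (p q : Subset n) → (∀ {x} → x ∈ p → x ∉ q) → ∣ p ∪ q ∣ ≡ ∣ p ∣ + ∣ q ∣
∣p∪q∣-disjoint {n} p q disj = begin
  ∣ p ∪ q ∣               ≡⟨ +-identityʳ _ ⟨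
  ∣ p ∪ q ∣ + 0           ≡⟨ cong (∣ p ∪ q ∣ +_) (trans (cong ∣_∣ (Empty-unique none)) (∣⊥∣≡0 n)) ⟨
  ∣ p ∪ q ∣ + ∣ p ∩ q ∣   ≡⟨ ∣p∪q∣+∣p∩q∣ p q ⟩
  ∣ p ∣ + ∣ q ∣           ∎
  where
  open ≡-Reasoning
  none : Empty (p ∩ q)
  none (x , x∈) with x∈p∩q⁻ p q x∈
  ... | x∈p , x∈q = disj x∈p x∈q

∣p∪⁅x⁆∣ : ∀ (p : Subset n) x → x ∉ p → ∣ p ∪ ⁅ x ⁆ ∣ ≡ suc ∣ p ∣
∣p∪⁅x⁆∣ p x x∉p = begin
  ∣ p ∪ ⁅ x ⁆ ∣      ≡⟨ ∣p∪q∣-disjoint p ⁅ x ⁆ (λ y∈p y∈⁅x⁆ → x∉p (subst (_∈ p) (x∈⁅y⁆⇒x≡y x y∈⁅x⁆) y∈p)) ⟩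
  ∣ p ∣ + ∣ ⁅ x ⁆ ∣  ≡⟨ cong (∣ p ∣ +_) (∣⁅x⁆∣≡1 x) ⟩
  ∣ p ∣ + 1          ≡⟨ +-comm ∣ p ∣ 1 ⟩
  suc ∣ p ∣          ∎
  where open ≡-Reasoning

p∪q─p : p ⊆ q → p ∪ (q ─ p) ≡ q
p∪q─p {p = p} {q} p⊆q = ⊆-antisym (∪-lub {A = p} p⊆q (p─q⊆p q p)) λ {x} x∈q → x∈p∪q⁺ (split x x∈q)
  where
  split : ∀ x → x ∈ q → x ∈ p ⊎ x ∈ q ─ p
  split x x∈q with x ∈? p
  ... | yes x∈p = inj₁ x∈p
  ... | no  x∉p = inj₂ (x∈p∧x∉q⇒x∈p─q x∈q x∉p)

p⊆q⇒∣q∣≡∣p∣+∣q─p∣ : p ⊆ q → ∣ q ∣ ≡ ∣ p ∣ + ∣ q ─ p ∣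
p⊆q⇒∣q∣≡∣p∣+∣q─p∣ {p = p} {q} p⊆q = trans (cong ∣_∣ (sym (p∪q─p p⊆q)))
  (∣p∪q∣-disjoint p (q ─ p) (λ x∈p x∈q─p → proj₂ (x∈p─q⁻ q p x∈q─p) x∈p))

∣p∣≡∣p∩q∣+∣p─q∣ : ∀ (p q : Subset n) → ∣ p ∣ ≡ ∣ p ∩ q ∣ + ∣ p ─ q ∣
∣p∣≡∣p∩q∣+∣p─q∣ []            []            = refl
∣p∣≡∣p∩q∣+∣p─q∣ (outside ∷ p) (outside ∷ q) = ∣p∣≡∣p∩q∣+∣p─q∣ p q
∣p∣≡∣p∩q∣+∣p─q∣ (outside ∷ p) (inside  ∷ q) = ∣p∣≡∣p∩q∣+∣p─q∣ p q
∣p∣≡∣p∩q∣+∣p─q∣ (inside  ∷ p) (outside ∷ q) = trans (cong suc (∣p∣≡∣p∩q∣+∣p─q∣ p q)) (sym (+-suc ∣ p ∩ q ∣ ∣ p ─ q ∣))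
∣p∣≡∣p∩q∣+∣p─q∣ (inside  ∷ p) (inside  ∷ q) = cong suc (∣p∣≡∣p∩q∣+∣p─q∣ p q)

∣q─p∣-cong : ∀ {m n} {p q : Subset m} {p′ q′ : Subset n} → p ⊆ q → p′ ⊆ q′ →
              ∣ q ∣ ≡ ∣ q′ ∣ → ∣ p ∣ ≡ ∣ p′ ∣ → ∣ q ─ p ∣ ≡ ∣ q′ ─ p′ ∣
∣q─p∣-cong {p = p} {q} {p′} {q′} p⊆q p′⊆q′ ∣q∣≡ ∣p∣≡ = +-cancelˡ-≡ ∣ p ∣ _ _ (begin
  ∣ p ∣ + ∣ q ─ p ∣      ≡⟨ p⊆q⇒∣q∣≡∣p∣+∣q─p∣ p⊆q ⟨
  ∣ q ∣                  ≡⟨ ∣q∣≡ ⟩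
  ∣ q′ ∣                 ≡⟨ p⊆q⇒∣q∣≡∣p∣+∣q─p∣ p′⊆q′ ⟩
  ∣ p′ ∣ + ∣ q′ ─ p′ ∣   ≡⟨ cong (_+ ∣ q′ ─ p′ ∣) ∣p∣≡ ⟨
  ∣ p ∣ + ∣ q′ ─ p′ ∣    ∎)
  where open ≡-Reasoning

⁅x⁆⊆ : x ∈ p → ⁅ x ⁆ ⊆ p
⁅x⁆⊆ {x = x} {p} x∈p y∈ = subst (_∈ p) (sym (x∈⁅y⁆⇒x≡y x y∈)) x∈p

x∈p⇒∣p∣≡1+∣p-x∣ : x ∈ p → ∣ p ∣ ≡ suc ∣ p - x ∣
x∈p⇒∣p∣≡1+∣p-x∣ {x = x} {p} x∈p = trans (p⊆q⇒∣q∣≡∣p∣+∣q─p∣ (⁅x⁆⊆ x∈p)) (cong (_+ ∣ p - x ∣) (∣⁅x⁆∣≡1 x))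

p⊆q∧∣q∣≤∣p∣⇒p≡q : p ⊆ q → ∣ q ∣ ≤ ∣ p ∣ → p ≡ q
p⊆q∧∣q∣≤∣p∣⇒p≡q {p = p} {q} p⊆q ∣q∣≤∣p∣ = ⊆-antisym p⊆q λ {x} x∈q → in-p x x∈q
  where
  in-p : ∀ x → x ∈ q → x ∈ p
  in-p x x∈q with x ∈? p
  ... | yes x∈p = x∈p
  ... | no  x∉p = contradiction (p⊂q⇒∣p∣<∣q∣ (p⊆q , x , x∈q , x∉p)) (≤⇒≯ ∣q∣≤∣p∣)

∣p∣>0⇒nonempty : ∀ (p : Subset n) → 0 < ∣ p ∣ → Nonempty p
∣p∣>0⇒nonempty {n} p 0<∣p∣ with nonempty? p
... | yes ne = ne
... | no  ¬ne = contradiction (trans (cong ∣_∣ (Empty-unique ¬ne)) (∣⊥∣≡0 n)) (>⇒≢ 0<∣p∣)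

⊆-interpolate : ∀ {p q : Subset n} m → p ⊆ q → ∣ p ∣ ≤ m → m ≤ ∣ q ∣ →
                ∃[ s ] p ⊆ s × s ⊆ q × ∣ s ∣ ≡ m
⊆-interpolate {p = []}          {[]}          zero    p⊆q _   _   = [] , id , id , refl
⊆-interpolate {p = outside ∷ p} {outside ∷ q} m       p⊆q p≤m m≤q
  with ⊆-interpolate m (drop-∷-⊆ p⊆q) p≤m m≤q
... | s , p⊆s , s⊆q , eq = outside ∷ s , s⊆s p⊆s , s⊆s s⊆q , eq
⊆-interpolate {p = inside ∷ p}  {outside ∷ q} m       p⊆q p≤m m≤q with p⊆q here
... | ()
⊆-interpolate {p = inside ∷ p}  {inside ∷ q}  (suc m) p⊆q (s≤s p≤m) (s≤s m≤q)
  with ⊆-interpolate m (drop-∷-⊆ p⊆q) p≤m m≤q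
... | s , p⊆s , s⊆q , eq = inside ∷ s , s⊆s p⊆s , s⊆s s⊆q , cong suc eq
⊆-interpolate {p = outside ∷ p} {inside ∷ q}  m       p⊆q p≤m m≤q with m ≤? ∣ q ∣
... | yes m≤q′ with ⊆-interpolate m (drop-∷-⊆ p⊆q) p≤m m≤q′
...   | s , p⊆s , s⊆q , eq = outside ∷ s , s⊆s p⊆s , out⊆ s⊆q , eq
⊆-interpolate {p = outside ∷ p} {inside ∷ q}  m       p⊆q p≤m m≤q | no m≰q
  with ⊆-interpolate ∣ q ∣ (drop-∷-⊆ p⊆q) (p⊆q⇒∣p∣≤∣q∣ {p = p} {q} (drop-∷-⊆ p⊆q)) ≤-refl
...   | s , p⊆s , s⊆q , eq = inside ∷ s , out⊆ p⊆s , s⊆s s⊆q , trans (cong suc eq) (≤-antisym (≰⇒> m≰q) m≤q)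

fromList-map-suc : ∀ (l : List (Fin n)) → fromList (map suc l) ≡ outside ∷ fromList l
fromList-map-suc []      = refl
fromList-map-suc (x ∷ l) = cong (⁅ suc x ⁆ ∪_) (fromList-map-suc l)

fromList-elements : ∀ (p : Subset n) → fromList (toList (elements p)) ≡ p
fromList-elements []            = refl
fromList-elements (outside ∷ p) = trans (cong fromList (toList-map suc (elements p)))
  (trans (fromList-map-suc (toList (elements p))) (cong (outside ∷_) (fromList-elements p)))
fromList-elements (inside ∷ p)  = trans (cong (λ l → ⁅ zero ⁆ ∪ fromList l) (toList-map suc (elements p)))
  (trans (cong (⁅ zero ⁆ ∪_) (fromList-map-suc (toList (elements p))))
         (cong (inside ∷_) (trans (∪-identityˡ _) (fromList-elements p))))

allSubsets : ∀ n → List (Subset n)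
allSubsets zero    = [] ∷ []
allSubsets (suc n) = map (outside ∷_) (allSubsets n) ++ map (inside ∷_) (allSubsets n)

∈-allSubsets : ∀ (p : Subset n) → p ∈ˡ allSubsets n
∈-allSubsets []            = here refl
∈-allSubsets (outside ∷ p) = ∈-++⁺ˡ (∈-map⁺ (outside ∷_) (∈-allSubsets p))
∈-allSubsets (inside ∷ p)  = ∈-++⁺ʳ _ (∈-map⁺ (inside ∷_) (∈-allSubsets p))

∈-⋃⁺ : ∀ {ps : List (Subset n)} → p ∈ˡ ps → x ∈ p → x ∈ ⋃ ps
∈-⋃⁺ (here refl) x∈p = x∈p∪q⁺ (inj₁ x∈p)
∈-⋃⁺ {ps = q ∷ ps} (there p∈) x∈p = x∈p∪q⁺ {p = q} (inj₂ (∈-⋃⁺ p∈ x∈p))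

∈-⋃⁻ : ∀ (ps : List (Subset n)) → x ∈ ⋃ ps → ∃[ p ] p ∈ˡ ps × x ∈ p
∈-⋃⁻ []       x∈ = contradiction x∈ ∉⊥
∈-⋃⁻ (q ∷ ps) x∈ with x∈p∪q⁻ q (⋃ ps) x∈
... | inj₁ x∈q = q , here refl , x∈q
... | inj₂ x∈⋃ with ∈-⋃⁻ ps x∈⋃
...   | p , p∈ , x∈p = p , there p∈ , x∈p

-- Rank

module Rank {N : ℕ} {E : Subset N} (M : Matroid E) where

  open Matroid M public using (rank-bounded; rank-monotone; rank-submodular)

  ρ : Subset N → ℕ
  ρ = rank M

  rank-⊥ : ρ ⊥ ≡ 0
  rank-⊥ = n≤0⇒n≡0 (≤-trans (rank-bounded ⊥ (⊆-min E)) (≤-reflexive (∣⊥∣≡0 N)))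

  -- With `C` and `D` bounded by inclusions, no union or intersection has to be computed where
  -- submodularity is applied.
  rank-submodular′ : ∀ A B C D → A ⊆ E → B ⊆ E → C ⊆ A ∪ B → D ⊆ A → D ⊆ B → ρ C + ρ D ≤ ρ A + ρ B
  rank-submodular′ A B C D A⊆E B⊆E C⊆A∪B D⊆A D⊆B = ≤-trans
    (+-mono-≤ (rank-monotone C (A ∪ B) C⊆A∪B (∪-lub {A = A} A⊆E B⊆E))
              (rank-monotone D (A ∩ B) (λ x∈D → x∈p∩q⁺ (D⊆A x∈D , D⊆B x∈D)) (A⊆E ∘ p∩q⊆p A B)))
    (rank-submodular A B A⊆E B⊆E)

  rank-∪ : ∀ A B → A ⊆ E → B ⊆ E → ρ (A ∪ B) ≤ ρ A + ρ B
  rank-∪ A B A⊆E B⊆E = m+n≤o⇒m≤o (ρ (A ∪ B)) (rank-submodular A B A⊆E B⊆E)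

  rank-∪⁅⁆ : ∀ A e → A ⊆ E → e ∈ E → ρ (A ∪ ⁅ e ⁆) ≤ suc (ρ A)
  rank-∪⁅⁆ A e A⊆E e∈E = begin
    ρ (A ∪ ⁅ e ⁆)      ≤⟨ rank-∪ A ⁅ e ⁆ A⊆E (⁅x⁆⊆ e∈E) ⟩
    ρ A + ρ ⁅ e ⁆      ≤⟨ +-monoʳ-≤ (ρ A) (rank-bounded ⁅ e ⁆ (⁅x⁆⊆ e∈E)) ⟩
    ρ A + ∣ ⁅ e ⁆ ∣    ≡⟨ cong (ρ A +_) (∣⁅x⁆∣≡1 e) ⟩
    ρ A + 1            ≡⟨ +-comm (ρ A) 1 ⟩
    suc (ρ A)          ∎
    where open ≤-Reasoning

  -- The nullity ∣ A ∣ ∸ ρ A is monotone; both sides are moved so that no subtraction occurs.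
  rank+size : ∀ {A B} → A ⊆ B → B ⊆ E → ρ B + ∣ A ∣ ≤ ρ A + ∣ B ∣
  rank+size {A} {B} A⊆B B⊆E = begin
    ρ B + ∣ A ∣                    ≡⟨ cong (λ C → ρ C + ∣ A ∣) (p∪q─p A⊆B) ⟨
    ρ (A ∪ (B ─ A)) + ∣ A ∣        ≤⟨ +-monoˡ-≤ ∣ A ∣ (rank-∪ A (B ─ A) (B⊆E ∘ A⊆B) (B⊆E ∘ p─q⊆p B A)) ⟩
    (ρ A + ρ (B ─ A)) + ∣ A ∣      ≤⟨ +-monoˡ-≤ ∣ A ∣ (+-monoʳ-≤ (ρ A) (rank-bounded (B ─ A) (B⊆E ∘ p─q⊆p B A))) ⟩
    (ρ A + ∣ B ─ A ∣) + ∣ A ∣      ≡⟨ +-assoc (ρ A) _ _ ⟩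
    ρ A + (∣ B ─ A ∣ + ∣ A ∣)      ≡⟨ cong (ρ A +_) (+-comm ∣ B ─ A ∣ ∣ A ∣) ⟩
    ρ A + (∣ A ∣ + ∣ B ─ A ∣)      ≡⟨ cong (ρ A +_) (p⊆q⇒∣q∣≡∣p∣+∣q─p∣ A⊆B) ⟨
    ρ A + ∣ B ∣                    ∎
    where open ≤-Reasoning

  independent : ∀ {I} → I ⊆ E → ∣ I ∣ ≤ ρ I → Independent M I
  independent {I} I⊆E ∣I∣≤ = I⊆E , ≤-antisym (rank-bounded I I⊆E) ∣I∣≤

  independent-⊆ : ∀ {I J} → J ⊆ I → Independent M I → Independent M J
  independent-⊆ {I} {J} J⊆I (I⊆E , ρI≡) = independent (I⊆E ∘ J⊆I)
    (+-cancelˡ-≤ ∣ I ∣ ∣ J ∣ (ρ J) (begin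
      ∣ I ∣ + ∣ J ∣  ≡⟨ cong (_+ ∣ J ∣) ρI≡ ⟨
      ρ I + ∣ J ∣    ≤⟨ rank+size J⊆I I⊆E ⟩
      ρ J + ∣ I ∣    ≡⟨ +-comm (ρ J) ∣ I ∣ ⟩
      ∣ I ∣ + ρ J    ∎))
    where open ≤-Reasoning

  independent-size : ∀ {I A} → Independent M I → I ⊆ A → A ⊆ E → ∣ I ∣ ≤ ρ A
  independent-size {I} {A} (_ , ρI≡) I⊆A A⊆E = ≤-trans (≤-reflexive (sym ρI≡)) (rank-monotone I A I⊆A A⊆E)

  -- The elements of `Z` are added one at a time: submodularity for `A ∪ fromList l` and
  -- `A ∪ ⁅ e ⁆`, which share `A`, keeps the rank at `ρ A`.
  rank-closure : ∀ A Z → A ⊆ E → Z ⊆ E → (∀ e → e ∈ Z → ρ (A ∪ ⁅ e ⁆) ≤ ρ A) → ρ (A ∪ Z) ≤ ρ A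
  rank-closure A Z A⊆E Z⊆E absorbed = subst (λ C → ρ (A ∪ C) ≤ ρ A) (fromList-elements Z)
    (go (toList (elements Z)) (subst (_ ∈_) (fromList-elements Z) ∘ ∈-fromList⁺))
    where
    go : ∀ l → (∀ {x} → x ∈ˡ l → x ∈ Z) → ρ (A ∪ fromList l) ≤ ρ A
    go []      _  = ≤-reflexive (cong ρ (∪-identityʳ A))
    go (e ∷ l) l⊆Z = +-cancelʳ-≤ (ρ A) _ _ (≤-trans
      (rank-submodular′ (A ∪ fromList l) (A ∪ ⁅ e ⁆) (A ∪ fromList (e ∷ l)) A
        (∪-lub {A = A} A⊆E (λ x∈ → Z⊆E (l⊆Z (there (∈-fromList⁻ l x∈)))))
        (∪-lub {A = A} A⊆E (⁅x⁆⊆ (Z⊆E (l⊆Z (here refl)))))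
        (∪-lub {A = A} (p⊆p∪q _ ∘ p⊆p∪q _)
          (∪-lub {A = ⁅ e ⁆} (q⊆p∪q _ _ ∘ q⊆p∪q A ⁅ e ⁆) (p⊆p∪q _ ∘ q⊆p∪q A _)))
        (p⊆p∪q _) (p⊆p∪q _))
      (+-mono-≤ (go l (l⊆Z ∘ there)) (absorbed e (l⊆Z (here refl)))))

  -- Every added element raises the rank by exactly one, which gives the last equation. `A` is
  -- arbitrary because `separator⇒dominant` extends a set containing all of `X`.
  extend : ∀ {A Z} → A ⊆ Z → Z ⊆ E →
           ∃[ J ] A ⊆ J × J ⊆ Z × ρ J ≡ ρ Z × ∣ J ∣ + ρ A ≡ ∣ A ∣ + ρ Z
  extend {A} {Z} A⊆Z Z⊆E = go (ρ Z) A A⊆Z (m≤m+n (ρ Z) (ρ A))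
    where
    -- `d` bounds the rank still missing and makes the recursion terminate.
    go : ∀ d A → A ⊆ Z → ρ Z ≤ d + ρ A → ∃[ J ] A ⊆ J × J ⊆ Z × ρ J ≡ ρ Z × ∣ J ∣ + ρ A ≡ ∣ A ∣ + ρ Z
    go d A A⊆Z bound with any? (λ e → (e ∈? Z) ×-dec (ρ A <? ρ (A ∪ ⁅ e ⁆)))
    ... | no none = A , id , A⊆Z , ρA≡ρZ , cong (∣ A ∣ +_) ρA≡ρZ
      where
      ρA≡ρZ : ρ A ≡ ρ Z
      ρA≡ρZ = ≤-antisym (rank-monotone A Z A⊆Z Z⊆E)
        (≤-trans (rank-monotone Z (A ∪ Z) (q⊆p∪q A Z) (∪-lub {A = A} (Z⊆E ∘ A⊆Z) Z⊆E))
          (rank-closure A Z (Z⊆E ∘ A⊆Z) Z⊆E (λ e e∈Z → ≮⇒≥ (λ lt → none (e , e∈Z , lt)))))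
    ... | yes (e , e∈Z , lt) = step d bound
      where
      e∉A : e ∉ A
      e∉A e∈A = <-irrefl (cong ρ (⊆-antisym (p⊆p∪q ⁅ e ⁆) (∪-lub {A = A} id (⁅x⁆⊆ e∈A)))) lt
      ρ+e : ρ (A ∪ ⁅ e ⁆) ≡ suc (ρ A)
      ρ+e = ≤-antisym (rank-∪⁅⁆ A e (Z⊆E ∘ A⊆Z) (Z⊆E e∈Z)) lt
      A+e⊆Z : A ∪ ⁅ e ⁆ ⊆ Z
      A+e⊆Z = ∪-lub {A = A} A⊆Z (⁅x⁆⊆ e∈Z)
      step : ∀ d → ρ Z ≤ d + ρ A → ∃[ J ] A ⊆ J × J ⊆ Z × ρ J ≡ ρ Z × ∣ J ∣ + ρ A ≡ ∣ A ∣ + ρ Z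
      step zero    bound = contradiction (≤-trans lt (≤-trans (rank-monotone (A ∪ ⁅ e ⁆) Z A+e⊆Z Z⊆E) bound)) (<-irrefl refl)
      step (suc d) bound with go d (A ∪ ⁅ e ⁆) A+e⊆Z
                               (≤-trans bound (≤-reflexive (trans (sym (+-suc d (ρ A))) (cong (d +_) (sym ρ+e)))))
      ... | J , A+e⊆J , J⊆Z , ρJ , ∣J∣ = J , A+e⊆J ∘ p⊆p∪q ⁅ e ⁆ , J⊆Z , ρJ , suc-injective (begin
        suc (∣ J ∣ + ρ A)        ≡⟨ +-suc ∣ J ∣ (ρ A) ⟨
        ∣ J ∣ + suc (ρ A)        ≡⟨ cong (∣ J ∣ +_) ρ+e ⟨
        ∣ J ∣ + ρ (A ∪ ⁅ e ⁆)    ≡⟨ ∣J∣ ⟩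
        ∣ A ∪ ⁅ e ⁆ ∣ + ρ Z      ≡⟨ cong (_+ ρ Z) (∣p∪⁅x⁆∣ A e e∉A) ⟩
        suc ∣ A ∣ + ρ Z          ∎)
        where open ≡-Reasoning

  extend-independent : ∀ {I Z} → Independent M I → I ⊆ Z → Z ⊆ E →
                       ∃[ J ] I ⊆ J × J ⊆ Z × Independent M J × ∣ J ∣ ≡ ρ Z
  extend-independent {I} {Z} (I⊆E , ρI) I⊆Z Z⊆E with extend I⊆Z Z⊆E
  ... | J , I⊆J , J⊆Z , ρJ , eq = J , I⊆J , J⊆Z , (Z⊆E ∘ J⊆Z , trans ρJ (sym ∣J∣)) , ∣J∣
    where
    ∣J∣ : ∣ J ∣ ≡ ρ Z
    ∣J∣ = +-cancelʳ-≡ ∣ I ∣ _ _ (trans (cong (∣ J ∣ +_) (sym ρI)) (trans eq (+-comm ∣ I ∣ (ρ Z))))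

  ⊥-independent : Independent M ⊥
  ⊥-independent = ⊆-min E , trans rank-⊥ (sym (∣⊥∣≡0 N))

  -- The closure of `B`, reached by adding elements as long as the rank does not grow.
  flat-hull : ∀ {B} → B ⊆ E → ∃[ F ] B ⊆ F × Flat M F × ρ F ≡ ρ B
  flat-hull {B} B⊆E = go ∣ E ∣ B B⊆E (m≤m+n ∣ E ∣ ∣ B ∣)
    where
    go : ∀ d B → B ⊆ E → ∣ E ∣ ≤ d + ∣ B ∣ → ∃[ F ] B ⊆ F × Flat M F × ρ F ≡ ρ B
    go d B B⊆E bound with any? (λ e → ((e ∈? E) ×-dec ¬? (e ∈? B)) ×-dec (ρ (B ∪ ⁅ e ⁆) ≤? ρ B))
    ... | no none = B , id , (B⊆E , λ e e∈E e∉B → ≰⇒> (λ le → none (e , (e∈E , e∉B) , le))) , refl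
    ... | yes (e , (e∈E , e∉B) , le) = step d bound
      where
      B+e⊆E : B ∪ ⁅ e ⁆ ⊆ E
      B+e⊆E = ∪-lub {A = B} B⊆E (⁅x⁆⊆ e∈E)
      step : ∀ d → ∣ E ∣ ≤ d + ∣ B ∣ → ∃[ F ] B ⊆ F × Flat M F × ρ F ≡ ρ B
      step zero    bound = contradiction
        (≤-trans (≤-reflexive (sym (∣p∪⁅x⁆∣ B e e∉B))) (≤-trans (p⊆q⇒∣p∣≤∣q∣ {p = B ∪ ⁅ e ⁆} {E} B+e⊆E) bound)) (<-irrefl refl)
      step (suc d) bound with go d (B ∪ ⁅ e ⁆) B+e⊆E
                               (≤-trans bound (≤-reflexive (trans (sym (+-suc d ∣ B ∣)) (cong (d +_) (sym (∣p∪⁅x⁆∣ B e e∉B))))))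
      ... | F , B+e⊆F , flat , ρF = F , B+e⊆F ∘ p⊆p∪q ⁅ e ⁆ , flat ,
        trans ρF (≤-antisym le (rank-monotone B (B ∪ ⁅ e ⁆) (p⊆p∪q ⁅ e ⁆) B+e⊆E))

  E-flat : Flat M E
  E-flat = id , λ e e∈E e∉E → contradiction e∈E e∉E

  -- Circuits and cyclic flats

  -- A decidable form of `Circuit`: testing the deletion of single elements is enough, as subsets of
  -- independent sets are independent.
  MinimalDependent : Subset N → Set
  MinimalDependent C = (C ⊆ E × ρ C < ∣ C ∣) × (∀ e → e ∈ C → ∣ C - e ∣ ≤ ρ (C - e))

  minimalDependent? : ∀ C → Dec (MinimalDependent C)
  minimalDependent? C = ((C ⊆? E) ×-dec (ρ C <? ∣ C ∣)) ×-dec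
                        all? (λ e → (e ∈? C) →-dec (∣ C - e ∣ ≤? ρ (C - e)))

  minimalDependent⇒circuit : ∀ {C} → MinimalDependent C → Circuit M C
  minimalDependent⇒circuit {C} ((C⊆E , dep) , min) = C⊆E , (λ (_ , ρC) → <-irrefl ρC dep) , proper
    where
    proper : ∀ D → D ⊂ C → Independent M D
    proper D (D⊆C , x , x∈C , x∉D) = independent-⊆
      (λ y∈D → x∈p∧x≢y⇒x∈p-y (D⊆C y∈D) (λ y≡x → x∉D (subst (_∈ D) y≡x y∈D)))
      (independent (C⊆E ∘ p─q⊆p C ⁅ x ⁆) (min x x∈C))

  ∃-circuit : ∀ {D} → D ⊆ E → ρ D < ∣ D ∣ → ∃[ C ] C ⊆ D × MinimalDependent C
  ∃-circuit {D} = go ∣ D ∣ D ≤-refl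
    where
    go : ∀ d D → ∣ D ∣ ≤ d → D ⊆ E → ρ D < ∣ D ∣ → ∃[ C ] C ⊆ D × MinimalDependent C
    go d D bound D⊆E dep with any? (λ e → (e ∈? D) ×-dec (ρ (D - e) <? ∣ D - e ∣))
    ... | no none = D , id , (D⊆E , dep) , λ e e∈D → ≮⇒≥ (λ lt → none (e , e∈D , lt))
    ... | yes (e , e∈D , lt) with d
    ...   | zero  = contradiction (≤-trans dep bound) (λ ())
    ...   | suc d with go d (D - e) (s≤s⁻¹ (≤-trans (≤-reflexive (sym (x∈p⇒∣p∣≡1+∣p-x∣ e∈D))) bound))
                         (D⊆E ∘ p─q⊆p D ⁅ e ⁆) lt
    ...     | C , C⊆ , min = C , p─q⊆p D ⁅ e ⁆ ∘ C⊆ , min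

  private
    circuitsIn : Subset N → List (Subset N)
    circuitsIn A = filter (λ C → minimalDependent? C ×-dec (C ⊆? A)) (allSubsets N)

    cyclicPart : Subset N → Subset N
    cyclicPart A = ⋃ (circuitsIn A)

    cyclicPart-⊆ : ∀ A → cyclicPart A ⊆ A
    cyclicPart-⊆ A x∈ with ∈-⋃⁻ (circuitsIn A) x∈
    ... | C , C∈ , x∈C = proj₂ (proj₂ (∈-filter⁻ (λ C → minimalDependent? C ×-dec (C ⊆? A)) {xs = allSubsets N} C∈)) x∈C

    ⊆-cyclicPart : ∀ {A C} → MinimalDependent C → C ⊆ A → C ⊆ cyclicPart A
    ⊆-cyclicPart {A} {C} min C⊆A = ∈-⋃⁺
      (∈-filter⁺ (λ C → minimalDependent? C ×-dec (C ⊆? A)) (∈-allSubsets C) (min , C⊆A))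

    -- Suppose `e ∉ Z` does not raise the rank of `Z`. Then a basis `I` of `Z` together with `e`
    -- contains a circuit `C`, and `e ∈ A` since `A` is a flat. So `C` is one of the circuits united
    -- in `Z`; hence it avoids `e` and lies in the independent set `I`, which is impossible.
    cyclicPart-cyclicFlat : ∀ {A} → Flat M A → CyclicFlat M (cyclicPart A)
    cyclicPart-cyclicFlat {A} (A⊆E , A-closed) = (Z⊆E , closed) , circuitsIn A , circuits , refl
      where
      Z : Subset N
      Z = cyclicPart A
      Z⊆E : Z ⊆ E
      Z⊆E = A⊆E ∘ cyclicPart-⊆ A
      circuits : All (Circuit M) (circuitsIn A)
      circuits = All.tabulate λ {C} C∈ → minimalDependent⇒circuit
        (proj₁ (proj₂ (∈-filter⁻ (λ C → minimalDependent? C ×-dec (C ⊆? A)) {xs = allSubsets N} C∈)))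
      closed : ∀ e → e ∈ E → e ∉ Z → ρ Z < ρ (Z ∪ ⁅ e ⁆)
      closed e e∈E e∉Z = ≰⇒> λ le → absurd le
        where
        absurd : ρ (Z ∪ ⁅ e ⁆) ≤ ρ Z → _
        absurd le with extend-independent ⊥-independent (⊆-min Z) Z⊆E
        ... | I , _ , I⊆Z , I-indep , ∣I∣ with ∃-circuit {I ∪ ⁅ e ⁆} (∪-lub {A = I} (Z⊆E ∘ I⊆Z) (⁅x⁆⊆ e∈E)) dep
          where
          Z+e⊆E : Z ∪ ⁅ e ⁆ ⊆ E
          Z+e⊆E = ∪-lub {A = Z} Z⊆E (⁅x⁆⊆ e∈E)
          dep : ρ (I ∪ ⁅ e ⁆) < ∣ I ∪ ⁅ e ⁆ ∣
          dep = begin-strict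
            ρ (I ∪ ⁅ e ⁆)   ≤⟨ rank-monotone (I ∪ ⁅ e ⁆) (Z ∪ ⁅ e ⁆) (∪-lub {A = I} (p⊆p∪q _ ∘ I⊆Z) (q⊆p∪q Z ⁅ e ⁆)) Z+e⊆E ⟩
            ρ (Z ∪ ⁅ e ⁆)   ≤⟨ le ⟩
            ρ Z             ≡⟨ ∣I∣ ⟨
            ∣ I ∣           <⟨ n<1+n ∣ I ∣ ⟩
            suc ∣ I ∣       ≡⟨ ∣p∪⁅x⁆∣ I e (e∉Z ∘ I⊆Z) ⟨
            ∣ I ∪ ⁅ e ⁆ ∣   ∎
            where open ≤-Reasoning
        ...   | C , C⊆I+e , min@((C⊆E , C-dep) , _) = <-irrefl (proj₂ (independent-⊆ C⊆I I-indep)) C-dep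
          where
          e∈A : e ∈ A
          e∈A with e ∈? A
          ... | yes e∈A = e∈A
          ... | no  e∉A = contradiction
            (rank-submodular′ A (Z ∪ ⁅ e ⁆) (A ∪ ⁅ e ⁆) Z A⊆E (∪-lub {A = Z} Z⊆E (⁅x⁆⊆ e∈E))
              (∪-lub {A = A} (p⊆p∪q _) (q⊆p∪q A _ ∘ q⊆p∪q Z ⁅ e ⁆)) (cyclicPart-⊆ A) (p⊆p∪q ⁅ e ⁆))
            (<⇒≱ (+-mono-<-≤ (A-closed e e∈E e∉A) le))
          C⊆Z : C ⊆ Z
          C⊆Z = ⊆-cyclicPart min (∪-lub {A = I} (cyclicPart-⊆ A ∘ I⊆Z) (⁅x⁆⊆ e∈A) ∘ C⊆I+e)
          C⊆I : C ⊆ I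
          C⊆I x∈C with x∈p∪q⁻ I ⁅ e ⁆ (C⊆I+e x∈C)
          ... | inj₁ x∈I = x∈I
          ... | inj₂ x∈⁅e⁆ = contradiction (subst (_∈ Z) (x∈⁅y⁆⇒x≡y e x∈⁅e⁆) (C⊆Z x∈C)) e∉Z

  abstract
    largest-cyclicFlat : ∀ {A} → Flat M A →
      ∃[ Z ] CyclicFlat M Z × Z ⊆ A × (∀ {C} → MinimalDependent C → C ⊆ A → C ⊆ Z)
    largest-cyclicFlat {A} flat =
      cyclicPart A , cyclicPart-cyclicFlat flat , cyclicPart-⊆ A , λ {C} → ⊆-cyclicPart {A} {C}

-- Loops, coloops and free separators

module _ {N : ℕ} {E : Subset N} (M : Matroid E) where

  open Rank M

  -- S is then the set of loops, and all other elements are coloops.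

  LoopColoopSum : Set
  LoopColoopSum = ∃[ S ] S ⊆ E × ρ S ≡ 0 × ∣ E ∣ ≤ ∣ S ∣ + ρ E

  -- Compared are the largest cyclic flats inside the set `L` of loops and inside `E`. If they
  -- coincide, every circuit lies in `L`, so `E ─ L` is independent and `M` is a sum of loops and
  -- coloops.
  ¬loopColoopSum⇒twoCyclicFlats : ¬ LoopColoopSum → AtLeastTwoCyclicFlats M
  ¬loopColoopSum⇒twoCyclicFlats ¬sum with flat-hull {⊥} (⊆-min E)
  ... | L , _ , L-flat@(L⊆E , _) , ρL with largest-cyclicFlat L-flat | largest-cyclicFlat E-flat
  ...   | Z , Z-cf , Z⊆L , _ | U , U-cf , _ , ⊆U =
    Z , U , Z-cf , U-cf , λ { refl → ¬sum (L , L⊆E , trans ρL rank-⊥ , large (λ {C} → ⊆U {C}) Z⊆L) }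
    where
    large : ∀ {U} → (∀ {C} → MinimalDependent C → C ⊆ E → C ⊆ U) → U ⊆ L → ∣ E ∣ ≤ ∣ L ∣ + ρ E
    large ⊆U U⊆L with ρ (E ─ L) <? ∣ E ─ L ∣
    ... | no  ≮ = ≤-trans (≤-reflexive (p⊆q⇒∣q∣≡∣p∣+∣q─p∣ L⊆E))
                    (+-monoʳ-≤ ∣ L ∣ (≤-trans (≮⇒≥ ≮) (rank-monotone (E ─ L) E (p─q⊆p E L) id)))
    ... | yes dep with ∃-circuit (p─q⊆p E L) dep
    ...   | C , C⊆ , min@((C⊆E , C-dep) , _) with ∣p∣>0⇒nonempty C (≤-trans (s≤s z≤n) C-dep)
    ...     | x , x∈C = contradiction (U⊆L (⊆U min C⊆E x∈C)) (proj₂ (x∈p─q⁻ E L (C⊆ x∈C)))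

  -- When `S` consists of loops and `E ─ S` is independent, every circuit lies in `S` while every
  -- flat contains `S`, so `S` is the only possible cyclic flat.
  twoCyclicFlats⇒¬loopColoopSum : AtLeastTwoCyclicFlats M → ¬ LoopColoopSum
  twoCyclicFlats⇒¬loopColoopSum (X , Y , X-cf , Y-cf , X≢Y) (S , S⊆E , ρS≡0 , large) =
    X≢Y (trans (unique X X-cf) (sym (unique Y Y-cf)))
    where
    E─S⊆E : E ─ S ⊆ E
    E─S⊆E = p─q⊆p E S
    independent-E─S : Independent M (E ─ S)
    independent-E─S = independent E─S⊆E (begin
      ∣ E ─ S ∣           ≤⟨ +-cancelˡ-≤ ∣ S ∣ _ _ (≤-trans (≤-reflexive (sym (p⊆q⇒∣q∣≡∣p∣+∣q─p∣ S⊆E))) large) ⟩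
      ρ E                 ≡⟨ cong ρ (p∪q─p S⊆E) ⟨
      ρ (S ∪ (E ─ S))     ≤⟨ rank-∪ S (E ─ S) S⊆E E─S⊆E ⟩
      ρ S + ρ (E ─ S)     ≡⟨ cong (_+ ρ (E ─ S)) ρS≡0 ⟩
      ρ (E ─ S)           ∎)
      where open ≤-Reasoning
    circuit-⊆ : ∀ {C} → Circuit M C → C ⊆ S
    circuit-⊆ {C} (C⊆E , ¬indep , proper) {x} x∈C with x ∈? S
    ... | yes x∈S = x∈S
    ... | no  x∉S = contradiction (independent-⊆ C⊆E─S independent-E─S) ¬indep
      where
      C⊆E─S : C ⊆ E ─ S
      C⊆E─S {s} s∈C with s ∈? S
      ... | no  s∉S = x∈p∧x∉q⇒x∈p─q (C⊆E s∈C) s∉S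
      -- As `x ∈ C` is not in `S`, the singleton of `s` is a proper subset of `C`, hence
      -- independent, although `s` is a loop.
      ... | yes s∈S = contradiction (≤-trans (≤-reflexive (trans (sym (∣⁅x⁆∣≡1 s)) (sym (proj₂
                        (proper ⁅ s ⁆ (⁅x⁆⊆ s∈C , x , x∈C , x∉S ∘ λ x∈⁅s⁆ → subst (_∈ S) (sym (x∈⁅y⁆⇒x≡y s x∈⁅s⁆)) s∈S))))))
                        (≤-trans (rank-monotone ⁅ s ⁆ S (⁅x⁆⊆ s∈S) S⊆E) (≤-reflexive ρS≡0))) (λ ())
    unique : ∀ Z → CyclicFlat M Z → Z ≡ S
    unique Z ((Z⊆E , closed) , 𝒞 , circuits , refl) = ⊆-antisym Z⊆S S⊆Z
      where
      Z⊆S : Z ⊆ S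
      Z⊆S x∈Z with ∈-⋃⁻ 𝒞 x∈Z
      ... | C , C∈𝒞 , x∈C = circuit-⊆ (All.lookup circuits C∈𝒞) x∈C
      S⊆Z : S ⊆ Z
      S⊆Z {s} s∈S with s ∈? Z
      ... | yes s∈Z = s∈Z
      ... | no  s∉Z = contradiction (begin
        ρ (Z ∪ ⁅ s ⁆)    ≤⟨ rank-∪ Z ⁅ s ⁆ Z⊆E (⁅x⁆⊆ (S⊆E s∈S)) ⟩
        ρ Z + ρ ⁅ s ⁆    ≤⟨ +-monoʳ-≤ (ρ Z) (rank-monotone ⁅ s ⁆ S (⁅x⁆⊆ s∈S) S⊆E) ⟩
        ρ Z + ρ S        ≡⟨ cong (ρ Z +_) ρS≡0 ⟩
        ρ Z + 0          ≡⟨ +-identityʳ (ρ Z) ⟩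
        ρ Z              ∎) (<⇒≱ (closed s (S⊆E s∈S) s∉Z))
        where open ≤-Reasoning

  -- X is a free separator when M is the free product of M|X and M/X.

  FreeSeparator : Subset N → Set
  FreeSeparator X = ∀ B → B ⊆ E → ∣ B ∣ ≡ ρ E → ρ (B ∩ X) ≡ ∣ B ∩ X ∣ → ρ (B ∪ X) ≡ ρ E → ρ B ≡ ρ E

  Coloopless : Subset N → Set
  Coloopless X = ∀ e → e ∈ X → ρ X ≤ ρ (X - e)

  Dominant : Subset N → Set
  Dominant X = ∀ A → A ⊆ E → ∣ X ∣ ≤ ∣ A ∣ → ρ A ≤ ρ X → A ≡ X

  -- The last two fields say that neither M|X nor M/X is a direct sum of loops and coloops.

  record ProperSeparator (X : Subset N) : Set where
    field
      ⊆-ground       : X ⊆ E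
      separator      : FreeSeparator X
      restrict-large : ∀ S → S ⊆ X → ρ S ≡ 0 → ∣ S ∣ + ρ X < ∣ X ∣
      contract-large : ∀ T → X ⊆ T → T ⊆ E → ρ T ≡ ρ X → ∣ T ∣ + ρ E < ∣ E ∣ + ρ X

  -- A coloop `e` of M|X can be handed to the other factor: adding it to an independent subset of
  -- `X - e` keeps independence, so the conditions on `B` for `X - e` imply those for `X`. Size and
  -- rank of `X` both drop by one, which preserves the strict inequalities.
  remove-coloop : ∀ {X e} → e ∈ X → ρ (X - e) < ρ X → ProperSeparator X → ProperSeparator (X - e)
  remove-coloop {X} {e} e∈X lt sep = record
    { ⊆-ground = X-e⊆E
    ; separator = separator′
    ; restrict-large = λ S S⊆X-e ρS≡0 → s≤s⁻¹ (begin-strict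
        suc (∣ S ∣ + ρ (X - e))  ≡⟨ +-suc ∣ S ∣ (ρ (X - e)) ⟨
        ∣ S ∣ + suc (ρ (X - e))  ≡⟨ cong (∣ S ∣ +_) ρX ⟨
        ∣ S ∣ + ρ X              <⟨ restrict-large S (p─q⊆p X ⁅ e ⁆ ∘ S⊆X-e) ρS≡0 ⟩
        ∣ X ∣                    ≡⟨ x∈p⇒∣p∣≡1+∣p-x∣ e∈X ⟩
        suc ∣ X - e ∣            ∎)
    ; contract-large = contract′
    }
    where
    open ProperSeparator sep
    open ≤-Reasoning
    X-e⊆E : X - e ⊆ E
    X-e⊆E = ⊆-ground ∘ p─q⊆p X ⁅ e ⁆
    X⊆X-e+e : X ⊆ (X - e) ∪ ⁅ e ⁆
    X⊆X-e+e {x} x∈X with x ∈? ⁅ e ⁆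
    ... | yes x∈⁅e⁆ = q⊆p∪q (X - e) ⁅ e ⁆ x∈⁅e⁆
    ... | no  x∉⁅e⁆ = p⊆p∪q ⁅ e ⁆ (x∈p∧x∉q⇒x∈p─q x∈X x∉⁅e⁆)
    ρX : ρ X ≡ suc (ρ (X - e))
    ρX = ≤-antisym (≤-trans (rank-monotone X ((X - e) ∪ ⁅ e ⁆) X⊆X-e+e (∪-lub {A = X - e} X-e⊆E (⁅x⁆⊆ (⊆-ground e∈X))))
                            (rank-∪⁅⁆ (X - e) e X-e⊆E (⊆-ground e∈X))) lt
    separator′ : FreeSeparator (X - e)
    separator′ B B⊆E ∣B∣ indep span = separator B B⊆E ∣B∣
      (proj₂ (independent (B⊆E ∘ p∩q⊆p B X) ∣B∩X∣≤))
      (≤-antisym (rank-monotone (B ∪ X) E (∪-lub {A = B} B⊆E ⊆-ground) id)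
        (≤-trans (≤-reflexive (sym span))
          (rank-monotone (B ∪ (X - e)) (B ∪ X) (∪-lub {A = B} (p⊆p∪q X) (q⊆p∪q B X ∘ p─q⊆p X ⁅ e ⁆)) (∪-lub {A = B} B⊆E ⊆-ground))))
      where
      B∩X⊆E : B ∩ X ⊆ E
      B∩X⊆E = B⊆E ∘ p∩q⊆p B X
      B∩[X-e]⊆B∩X : B ∩ (X - e) ⊆ B ∩ X
      B∩[X-e]⊆B∩X x∈ with x∈p∩q⁻ B (X - e) x∈
      ... | x∈B , x∈X-e = x∈p∩q⁺ (x∈B , p─q⊆p X ⁅ e ⁆ x∈X-e)
      B∩X⊆ : B ∩ X ⊆ (B ∩ (X - e)) ∪ ⁅ e ⁆
      B∩X⊆ {x} x∈ with x∈p∩q⁻ B X x∈ | x ∈? ⁅ e ⁆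
      ... | x∈B , x∈X | yes x∈⁅e⁆ = q⊆p∪q (B ∩ (X - e)) ⁅ e ⁆ x∈⁅e⁆
      ... | x∈B , x∈X | no  x∉⁅e⁆ = p⊆p∪q ⁅ e ⁆ (x∈p∩q⁺ (x∈B , x∈p∧x∉q⇒x∈p─q x∈X x∉⁅e⁆))
      ∣B∩X∣≤ : ∣ B ∩ X ∣ ≤ ρ (B ∩ X)
      ∣B∩X∣≤ with e ∈? B
      ... | no e∉B = begin
        ∣ B ∩ X ∣          ≤⟨ p⊆q⇒∣p∣≤∣q∣ {p = B ∩ X} {B ∩ (X - e)} avoid ⟩
        ∣ B ∩ (X - e) ∣    ≡⟨ indep ⟨
        ρ (B ∩ (X - e))    ≤⟨ rank-monotone (B ∩ (X - e)) (B ∩ X) B∩[X-e]⊆B∩X B∩X⊆E ⟩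
        ρ (B ∩ X)          ∎
        where
        avoid : B ∩ X ⊆ B ∩ (X - e)
        avoid x∈ with x∈p∩q⁻ B X x∈
        ... | x∈B , x∈X = x∈p∩q⁺ (x∈B , x∈p∧x≢y⇒x∈p-y x∈X (λ x≡e → e∉B (subst (_∈ B) x≡e x∈B)))
      -- Submodularity for `X - e` and `B ∩ X`, whose union is `X` and whose intersection is
      -- `B ∩ (X - e)`, passes the rank increase at `e` on to `B ∩ X`.
      ... | yes e∈B = +-cancelˡ-≤ (ρ (X - e)) _ _ (begin
        ρ (X - e) + ∣ B ∩ X ∣
          ≤⟨ +-monoʳ-≤ (ρ (X - e)) (p⊆q⇒∣p∣≤∣q∣ {p = B ∩ X} {(B ∩ (X - e)) ∪ ⁅ e ⁆} B∩X⊆) ⟩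
        ρ (X - e) + ∣ (B ∩ (X - e)) ∪ ⁅ e ⁆ ∣
          ≤⟨ +-monoʳ-≤ (ρ (X - e)) (∣p∪q∣≤∣p∣+∣q∣ (B ∩ (X - e)) ⁅ e ⁆) ⟩
        ρ (X - e) + (∣ B ∩ (X - e) ∣ + ∣ ⁅ e ⁆ ∣)
          ≡⟨ cong (λ k → ρ (X - e) + (∣ B ∩ (X - e) ∣ + k)) (∣⁅x⁆∣≡1 e) ⟩
        ρ (X - e) + (∣ B ∩ (X - e) ∣ + 1)
          ≡⟨ cong (ρ (X - e) +_) (+-comm _ 1) ⟩
        ρ (X - e) + suc ∣ B ∩ (X - e) ∣
          ≡⟨ +-suc (ρ (X - e)) _ ⟩
        suc (ρ (X - e)) + ∣ B ∩ (X - e) ∣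
          ≡⟨ cong₂ _+_ (sym ρX) (sym indep) ⟩
        ρ X + ρ (B ∩ (X - e))
          ≤⟨ rank-submodular′ (X - e) (B ∩ X) X (B ∩ (X - e)) X-e⊆E B∩X⊆E
               (∪-lub {A = X - e} (p⊆p∪q _) (λ x∈ → q⊆p∪q (X - e) (B ∩ X)
                  (x∈p∩q⁺ (⁅x⁆⊆ e∈B x∈ , ⁅x⁆⊆ e∈X x∈))) ∘ X⊆X-e+e)
               (p∩q⊆q B (X - e)) B∩[X-e]⊆B∩X ⟩
        ρ (X - e) + ρ (B ∩ X) ∎)
    contract′ : ∀ T → X - e ⊆ T → T ⊆ E → ρ T ≡ ρ (X - e) → ∣ T ∣ + ρ E < ∣ E ∣ + ρ (X - e)
    contract′ T X-e⊆T T⊆E ρT = s≤s⁻¹ (begin-strict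
      suc ∣ T ∣ + ρ E             ≡⟨ cong (_+ ρ E) (∣p∪⁅x⁆∣ T e e∉T) ⟨
      ∣ T ∪ ⁅ e ⁆ ∣ + ρ E         <⟨ contract-large (T ∪ ⁅ e ⁆) X⊆T+e T+e⊆E ρT+e ⟩
      ∣ E ∣ + ρ X                 ≡⟨ cong (∣ E ∣ +_) ρX ⟩
      ∣ E ∣ + suc (ρ (X - e))     ≡⟨ +-suc ∣ E ∣ _ ⟩
      suc (∣ E ∣ + ρ (X - e))     ∎)
      where
      T+e⊆E : T ∪ ⁅ e ⁆ ⊆ E
      T+e⊆E = ∪-lub {A = T} T⊆E (⁅x⁆⊆ (⊆-ground e∈X))
      X⊆T+e : X ⊆ T ∪ ⁅ e ⁆
      X⊆T+e = ∪-lub {A = X - e} (p⊆p∪q _ ∘ X-e⊆T) (q⊆p∪q T ⁅ e ⁆) ∘ X⊆X-e+e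
      e∉T : e ∉ T
      e∉T e∈T = <-irrefl (sym ρT) (≤-trans lt (rank-monotone X T (∪-lub {A = X - e} X-e⊆T (⁅x⁆⊆ e∈T) ∘ X⊆X-e+e) T⊆E))
      ρT+e : ρ (T ∪ ⁅ e ⁆) ≡ ρ X
      ρT+e = ≤-antisym (≤-trans (rank-∪⁅⁆ T e T⊆E (⊆-ground e∈X)) (≤-reflexive (trans (cong suc ρT) (sym ρX))))
                       (rank-monotone X (T ∪ ⁅ e ⁆) X⊆T+e T+e⊆E)

  remove-coloops : ∀ {X} → ProperSeparator X → ∃[ Y ] ProperSeparator Y × Coloopless Y
  remove-coloops {X} = go ∣ X ∣ X ≤-refl
    where
    go : ∀ d X → ∣ X ∣ ≤ d → ProperSeparator X → ∃[ Y ] ProperSeparator Y × Coloopless Y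
    go d X bound sep with any? (λ e → (e ∈? X) ×-dec (ρ (X - e) <? ρ X))
    ... | no none = X , sep , λ e e∈X → ≮⇒≥ (λ lt → none (e , e∈X , lt))
    ... | yes (e , e∈X , lt) with d | ≤-trans (≤-reflexive (sym (x∈p⇒∣p∣≡1+∣p-x∣ e∈X))) bound
    ...   | suc d | bound′ = go d (X - e) (s≤s⁻¹ bound′) (remove-coloop e∈X lt sep)

  -- Closing moves the loops of M/X to the first factor. Since `B ∪ F` has the rank of `B ∪ X` and
  -- `B ∩ X ⊆ B ∩ F`, the conditions on `B` for `F` imply those for `X`. No element of `F ─ X` is a
  -- coloop, as `X` already has the rank of `F`.
  close : ∀ {X} → ProperSeparator X → Coloopless X →
          ∃[ F ] ProperSeparator F × Coloopless F × Flat M F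
  close {X} sep coloopless with flat-hull (ProperSeparator.⊆-ground sep)
  ... | F , X⊆F , flat@(F⊆E , _) , ρF = F , record
    { ⊆-ground = F⊆E
    ; separator = separator′
    ; restrict-large = restrict′
    ; contract-large = λ T F⊆T T⊆E ρT → subst (λ k → ∣ T ∣ + ρ E < ∣ E ∣ + k) (sym ρF)
        (contract-large T (F⊆T ∘ X⊆F) T⊆E (trans ρT ρF))
    } , coloopless′ , flat
    where
    open ProperSeparator sep
    open ≤-Reasoning
    separator′ : FreeSeparator F
    separator′ B B⊆E ∣B∣ indep span = separator B B⊆E ∣B∣
      (proj₂ (independent-⊆ {B ∩ F} B∩X⊆B∩F (B⊆E ∘ p∩q⊆p B F , indep)))
      (≤-antisym (rank-monotone (B ∪ X) E B∪X⊆E id) (+-cancelʳ-≤ (ρ X) _ _ (begin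
        ρ E + ρ X            ≡⟨ cong (_+ ρ X) span ⟨
        ρ (B ∪ F) + ρ X      ≤⟨ rank-submodular′ (B ∪ X) F (B ∪ F) X B∪X⊆E F⊆E
                                  (∪-lub {A = B} (p⊆p∪q F ∘ p⊆p∪q X) (q⊆p∪q (B ∪ X) F)) (q⊆p∪q B X) X⊆F ⟩
        ρ (B ∪ X) + ρ F      ≡⟨ cong (ρ (B ∪ X) +_) ρF ⟩
        ρ (B ∪ X) + ρ X      ∎)))
      where
      B∪X⊆E : B ∪ X ⊆ E
      B∪X⊆E = ∪-lub {A = B} B⊆E ⊆-ground
      B∩X⊆B∩F : B ∩ X ⊆ B ∩ F
      B∩X⊆B∩F x∈ with x∈p∩q⁻ B X x∈
      ... | x∈B , x∈X = x∈p∩q⁺ (x∈B , X⊆F x∈X)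
    restrict′ : ∀ S → S ⊆ F → ρ S ≡ 0 → ∣ S ∣ + ρ F < ∣ F ∣
    restrict′ S S⊆F ρS≡0 = begin-strict
      ∣ S ∣ + ρ F                        ≡⟨ cong₂ _+_ (∣p∣≡∣p∩q∣+∣p─q∣ S X) ρF ⟩
      (∣ S ∩ X ∣ + ∣ S ─ X ∣) + ρ X      ≡⟨ +-assoc ∣ S ∩ X ∣ _ _ ⟩
      ∣ S ∩ X ∣ + (∣ S ─ X ∣ + ρ X)      ≡⟨ cong (∣ S ∩ X ∣ +_) (+-comm ∣ S ─ X ∣ (ρ X)) ⟩
      ∣ S ∩ X ∣ + (ρ X + ∣ S ─ X ∣)      ≡⟨ +-assoc ∣ S ∩ X ∣ _ _ ⟨
      (∣ S ∩ X ∣ + ρ X) + ∣ S ─ X ∣      <⟨ +-mono-<-≤ (restrict-large (S ∩ X) (p∩q⊆q S X) ρS∩X≡0)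
                                                       (p⊆q⇒∣p∣≤∣q∣ {p = S ─ X} {F ─ X} S─X⊆F─X) ⟩
      ∣ X ∣ + ∣ F ─ X ∣                  ≡⟨ p⊆q⇒∣q∣≡∣p∣+∣q─p∣ X⊆F ⟨
      ∣ F ∣                              ∎
      where
      ρS∩X≡0 : ρ (S ∩ X) ≡ 0
      ρS∩X≡0 = n≤0⇒n≡0 (≤-trans (rank-monotone (S ∩ X) S (p∩q⊆p S X) (F⊆E ∘ S⊆F)) (≤-reflexive ρS≡0))
      S─X⊆F─X : S ─ X ⊆ F ─ X
      S─X⊆F─X x∈ with x∈p─q⁻ S X x∈
      ... | x∈S , x∉X = x∈p∧x∉q⇒x∈p─q (S⊆F x∈S) x∉X
    coloopless′ : Coloopless F
    coloopless′ e e∈F with e ∈? X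
    ... | yes e∈X = begin
      ρ F         ≡⟨ ρF ⟩
      ρ X         ≤⟨ coloopless e e∈X ⟩
      ρ (X - e)   ≤⟨ rank-monotone (X - e) (F - e) X-e⊆F-e (F⊆E ∘ p─q⊆p F ⁅ e ⁆) ⟩
      ρ (F - e)   ∎
      where
      X-e⊆F-e : X - e ⊆ F - e
      X-e⊆F-e x∈ with x∈p─q⁻ X ⁅ e ⁆ x∈
      ... | x∈X , x∉⁅e⁆ = x∈p∧x∉q⇒x∈p─q (X⊆F x∈X) x∉⁅e⁆
    ... | no e∉X = begin
      ρ F         ≡⟨ ρF ⟩
      ρ X         ≤⟨ rank-monotone X (F - e) (λ x∈X → x∈p∧x≢y⇒x∈p-y (X⊆F x∈X) (λ x≡e → e∉X (subst (_∈ X) x≡e x∈X))) (F⊆E ∘ p─q⊆p F ⁅ e ⁆) ⟩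
      ρ (F - e)   ∎

  -- If A ⊈ X were a counterexample, a basis of A ∩ X together with enough elements of A ─ X
  -- would, by freeness, be an independent subset of A of size ρ X + 1.

  separator⇒dominant : ∀ {X} → Flat M X → Coloopless X → FreeSeparator X → Dominant X
  separator⇒dominant {X} (X⊆E , closed) coloopless separator A A⊆E ∣X∣≤∣A∣ ρA≤ρX with A ⊆? X
  ... | yes A⊆X = p⊆q∧∣q∣≤∣p∣⇒p≡q A⊆X ∣X∣≤∣A∣
  ... | no  A⊈X = contradiction (≤-trans k<ρA ρA≤ρX) (<-irrefl refl)
    where
    open ≤-Reasoning
    k r : ℕ
    k = ρ X
    r = ρ E
    A₁ A₂ : Subset N
    A₁ = A ∩ X
    A₂ = A ─ X
    A₁⊆E : A₁ ⊆ E
    A₁⊆E = A⊆E ∘ p∩q⊆p A X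
    A₂-nonempty : 0 < ∣ A₂ ∣
    A₂-nonempty = n≢0⇒n>0 λ ∣A₂∣≡0 → A⊈X λ {x} → in-X ∣A₂∣≡0 x
      where
      in-X : ∣ A₂ ∣ ≡ 0 → ∀ x → x ∈ A → x ∈ X
      in-X ∣A₂∣≡0 x x∈A with x ∈? X
      ... | yes x∈X = x∈X
      ... | no  x∉X = contradiction
        (≤-trans (≤-reflexive (sym (∣⁅x⁆∣≡1 x))) (≤-trans (p⊆q⇒∣p∣≤∣q∣ {p = ⁅ x ⁆} {A₂} (⁅x⁆⊆ (x∈p∧x∉q⇒x∈p─q x∈A x∉X))) (≤-reflexive ∣A₂∣≡0))) (λ ())
    -- If `A` contains `X`, one element outside `X` is enough. Otherwise `A₁` lies in some `X - e`,
    -- which still has rank `k`, and the nullity of `A₁` is at most that of `X - e`, one less than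
    -- the nullity of `X`.
    enough : suc k ≤ ρ A₁ + ∣ A₂ ∣
    enough with X ⊆? A₁
    ... | yes X⊆A₁ = ≤-trans (≤-reflexive (+-comm 1 k)) (+-mono-≤ (rank-monotone X A₁ X⊆A₁ A₁⊆E) A₂-nonempty)
    ... | no  X⊈A₁ with any? (λ e → (e ∈? (X ─ A₁)))
    ...   | no none = contradiction (λ {x} → X⊆A₁ x) X⊈A₁
      where
      X⊆A₁ : ∀ x → x ∈ X → x ∈ A₁
      X⊆A₁ x x∈X with x ∈? A₁
      ... | yes x∈A₁ = x∈A₁
      ... | no  x∉A₁ = contradiction (x , x∈p∧x∉q⇒x∈p─q x∈X x∉A₁) none
    ...   | yes (e , e∈) with x∈p─q⁻ X A₁ e∈
    ...     | e∈X , e∉A₁ = +-cancelʳ-≤ ∣ A₁ ∣ _ _ (begin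
      suc k + ∣ A₁ ∣               ≤⟨ s≤s (+-monoˡ-≤ ∣ A₁ ∣ (coloopless e e∈X)) ⟩
      suc (ρ (X - e) + ∣ A₁ ∣)     ≤⟨ s≤s (rank+size A₁⊆X-e (X⊆E ∘ p─q⊆p X ⁅ e ⁆)) ⟩
      suc (ρ A₁ + ∣ X - e ∣)       ≡⟨ +-suc (ρ A₁) _ ⟨
      ρ A₁ + suc ∣ X - e ∣         ≡⟨ cong (ρ A₁ +_) (x∈p⇒∣p∣≡1+∣p-x∣ e∈X) ⟨
      ρ A₁ + ∣ X ∣                 ≤⟨ +-monoʳ-≤ (ρ A₁) ∣X∣≤∣A∣ ⟩
      ρ A₁ + ∣ A ∣                 ≡⟨ cong (ρ A₁ +_) (∣p∣≡∣p∩q∣+∣p─q∣ A X) ⟩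
      ρ A₁ + (∣ A₁ ∣ + ∣ A₂ ∣)     ≡⟨ cong (ρ A₁ +_) (+-comm ∣ A₁ ∣ ∣ A₂ ∣) ⟩
      ρ A₁ + (∣ A₂ ∣ + ∣ A₁ ∣)     ≡⟨ +-assoc (ρ A₁) _ _ ⟨
      (ρ A₁ + ∣ A₂ ∣) + ∣ A₁ ∣     ∎)
      where
      A₁⊆X-e : A₁ ⊆ X - e
      A₁⊆X-e x∈A₁ = x∈p∧x≢y⇒x∈p-y (p∩q⊆q A X x∈A₁) (λ x≡e → e∉A₁ (subst (_∈ A₁) x≡e x∈A₁))
    k<ρA : suc k ≤ ρ A
    k<ρA with extend-independent ⊥-independent (⊆-min A₁) A₁⊆E
    ... | I , _ , I⊆A₁ , I-indep , ∣I∣ with extend-independent I-indep (p∩q⊆q A X ∘ I⊆A₁) X⊆E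
    ... | J , I⊆J , J⊆X , J-indep , ∣J∣
      -- The size of `D` makes `I ∪ D` have `k + 1` elements.
      with ⊆-interpolate (suc k ∸ ρ A₁) (⊆-min A₂) (≤-trans (≤-reflexive (∣⊥∣≡0 N)) z≤n)
             (≤-trans (∸-monoˡ-≤ (ρ A₁) enough) (≤-reflexive (m+n∸m≡n (ρ A₁) ∣ A₂ ∣)))
    ... | D , _ , D⊆A₂ , ∣D∣ with extend {X ∪ D} (∪-lub {A = X} X⊆E (A⊆E ∘ p─q⊆p A X ∘ D⊆A₂)) id
    -- With `W = Q ─ X`, every set `B` between `I ∪ W` and `J ∪ W` meets `X` inside the independent
    -- set `J`, and `B ∪ X` contains the spanning set `Q`. It remains to choose `B` of size `r`;
    -- then `B` is a basis containing `I ∪ D`.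
    ... | Q , X∪D⊆Q , Q⊆E , ρQ , ∣Q∣ with ⊆-interpolate r Low⊆High ∣Low∣≤r r≤∣High∣
      where
      ρA₁≤k : ρ A₁ ≤ k
      ρA₁≤k = rank-monotone A₁ X (p∩q⊆q A X) X⊆E
      ρA₁+∣D∣ : ρ A₁ + ∣ D ∣ ≡ suc k
      ρA₁+∣D∣ = trans (cong (ρ A₁ +_) ∣D∣) (m+[n∸m]≡n (≤-trans ρA₁≤k (n≤1+n k)))
      X∪D⊆E : X ∪ D ⊆ E
      X∪D⊆E = Q⊆E ∘ X∪D⊆Q
      -- Flatness of `X` enters here; without this extra unit of rank, `I ∪ W` might already exceed
      -- `r` elements.
      k<ρX∪D : suc k ≤ ρ (X ∪ D)
      k<ρX∪D with ∣p∣>0⇒nonempty D (≤-trans (m<n⇒0<n∸m (s≤s ρA₁≤k)) (≤-reflexive (sym ∣D∣)))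
      ... | d , d∈D with x∈p─q⁻ A X (D⊆A₂ d∈D)
      ...   | d∈A , d∉X = ≤-trans (closed d (A⊆E d∈A) d∉X)
        (rank-monotone (X ∪ ⁅ d ⁆) (X ∪ D) (∪-lub {A = X} (p⊆p∪q D) (q⊆p∪q X D ∘ ⁅x⁆⊆ d∈D)) X∪D⊆E)
      W : Subset N
      W = Q ─ X
      ∣W∣ : ∣ W ∣ + ρ (X ∪ D) ≡ ∣ D ∣ + r
      ∣W∣ = +-cancelˡ-≡ ∣ X ∣ _ _ (≡.begin
        ∣ X ∣ + (∣ W ∣ + ρ (X ∪ D))   ≡.≡⟨ +-assoc ∣ X ∣ _ _ ⟨
        (∣ X ∣ + ∣ W ∣) + ρ (X ∪ D)   ≡.≡⟨ cong (_+ ρ (X ∪ D)) (p⊆q⇒∣q∣≡∣p∣+∣q─p∣ {p = X} {Q} (X∪D⊆Q ∘ p⊆p∪q D)) ⟨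
        ∣ Q ∣ + ρ (X ∪ D)             ≡.≡⟨ ∣Q∣ ⟩
        ∣ X ∪ D ∣ + r                 ≡.≡⟨ cong (_+ r) (∣p∪q∣-disjoint X D (λ x∈X x∈D → proj₂ (x∈p─q⁻ A X (D⊆A₂ x∈D)) x∈X)) ⟩
        (∣ X ∣ + ∣ D ∣) + r           ≡.≡⟨ +-assoc ∣ X ∣ _ _ ⟩
        ∣ X ∣ + (∣ D ∣ + r)           ≡.∎)
        where module ≡ = ≡-Reasoning
      disjoint-W : ∀ {P} → P ⊆ X → ∣ P ∪ W ∣ ≡ ∣ P ∣ + ∣ W ∣
      disjoint-W {P} P⊆X = ∣p∪q∣-disjoint P W (λ x∈P x∈W → proj₂ (x∈p─q⁻ Q X x∈W) (P⊆X x∈P))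
      Low⊆High : I ∪ W ⊆ J ∪ W
      Low⊆High = ∪-lub {A = I} (p⊆p∪q W ∘ I⊆J) (q⊆p∪q J W)
      ∣Low∣≤r : ∣ I ∪ W ∣ ≤ r
      ∣Low∣≤r = +-cancelʳ-≤ (ρ (X ∪ D)) _ _ (begin
        ∣ I ∪ W ∣ + ρ (X ∪ D)            ≡⟨ cong (_+ ρ (X ∪ D)) (trans (disjoint-W (p∩q⊆q A X ∘ I⊆A₁)) (cong (_+ ∣ W ∣) ∣I∣)) ⟩
        (ρ A₁ + ∣ W ∣) + ρ (X ∪ D)       ≡⟨ +-assoc (ρ A₁) _ _ ⟩
        ρ A₁ + (∣ W ∣ + ρ (X ∪ D))       ≡⟨ cong (ρ A₁ +_) ∣W∣ ⟩
        ρ A₁ + (∣ D ∣ + r)               ≡⟨ +-assoc (ρ A₁) _ _ ⟨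
        (ρ A₁ + ∣ D ∣) + r               ≡⟨ cong (_+ r) ρA₁+∣D∣ ⟩
        suc k + r                        ≤⟨ +-monoˡ-≤ r k<ρX∪D ⟩
        ρ (X ∪ D) + r                    ≡⟨ +-comm _ r ⟩
        r + ρ (X ∪ D)                    ∎)
      r≤∣High∣ : r ≤ ∣ J ∪ W ∣
      r≤∣High∣ = +-cancelʳ-≤ (ρ (X ∪ D)) _ _ (begin
        r + ρ (X ∪ D)                    ≤⟨ +-monoʳ-≤ r (≤-trans (rank-∪ X D X⊆E (X∪D⊆E ∘ q⊆p∪q X D)) (+-monoʳ-≤ k (rank-bounded D (X∪D⊆E ∘ q⊆p∪q X D)))) ⟩
        r + (k + ∣ D ∣)                  ≡⟨ +-comm r _ ⟩
        (k + ∣ D ∣) + r                  ≡⟨ +-assoc k _ _ ⟩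
        k + (∣ D ∣ + r)                  ≡⟨ cong₂ _+_ (sym ∣J∣) (sym ∣W∣) ⟩
        ∣ J ∣ + (∣ W ∣ + ρ (X ∪ D))      ≡⟨ +-assoc ∣ J ∣ _ _ ⟨
        (∣ J ∣ + ∣ W ∣) + ρ (X ∪ D)      ≡⟨ cong (_+ ρ (X ∪ D)) (disjoint-W J⊆X) ⟨
        ∣ J ∪ W ∣ + ρ (X ∪ D)            ∎)
    ... | B , Low⊆B , B⊆High , ∣B∣ = begin
      suc k              ≡⟨ m+[n∸m]≡n (≤-trans (rank-monotone A₁ X (p∩q⊆q A X) X⊆E) (n≤1+n k)) ⟨
      ρ A₁ + (suc k ∸ ρ A₁) ≡⟨ cong₂ _+_ (sym ∣I∣) (sym ∣D∣) ⟩
      ∣ I ∣ + ∣ D ∣      ≡⟨ ∣p∪q∣-disjoint I D (λ x∈I x∈D → proj₂ (x∈p─q⁻ A X (D⊆A₂ x∈D)) (p∩q⊆q A X (I⊆A₁ x∈I))) ⟨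
      ∣ I ∪ D ∣          ≤⟨ independent-size {I ∪ D} (independent-⊆ {B} (∪-lub {A = I} (Low⊆B ∘ p⊆p∪q _) (Low⊆B ∘ q⊆p∪q I _ ∘ D⊆W)) B-indep)
                              (∪-lub {A = I} (p∩q⊆p A X ∘ I⊆A₁) (p─q⊆p A X ∘ D⊆A₂)) A⊆E ⟩
      ρ A                ∎
      where
      D⊆W : D ⊆ Q ─ X
      D⊆W d∈D = x∈p∧x∉q⇒x∈p─q (X∪D⊆Q (q⊆p∪q X D d∈D)) (proj₂ (x∈p─q⁻ A X (D⊆A₂ d∈D)))
      B⊆E : B ⊆ E
      B⊆E = ∪-lub {A = J} (X⊆E ∘ J⊆X) (Q⊆E ∘ p─q⊆p Q X) ∘ B⊆High
      B∩X⊆J : B ∩ X ⊆ J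
      B∩X⊆J x∈ with x∈p∩q⁻ B X x∈
      ... | x∈B , x∈X with x∈p∪q⁻ J (Q ─ X) (B⊆High x∈B)
      ...   | inj₁ x∈J = x∈J
      ...   | inj₂ x∈W = contradiction x∈X (proj₂ (x∈p─q⁻ Q X x∈W))
      Q⊆B∪X : Q ⊆ B ∪ X
      Q⊆B∪X {x} x∈Q with x ∈? X
      ... | yes x∈X = q⊆p∪q B X x∈X
      ... | no  x∉X = p⊆p∪q X (Low⊆B (q⊆p∪q I (Q ─ X) (x∈p∧x∉q⇒x∈p─q x∈Q x∉X)))
      B∪X⊆E : B ∪ X ⊆ E
      B∪X⊆E = ∪-lub {A = B} B⊆E X⊆E
      ρB : ρ B ≡ r
      ρB = separator B B⊆E ∣B∣ (proj₂ (independent-⊆ {J} B∩X⊆J J-indep))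
        (≤-antisym (rank-monotone (B ∪ X) E B∪X⊆E id)
                   (≤-trans (≤-reflexive (sym ρQ)) (rank-monotone Q (B ∪ X) Q⊆B∪X B∪X⊆E)))
      B-indep : Independent M B
      B-indep = B⊆E , trans ρB (sym ∣B∣)

  properSeparator⇒dominant : ∀ {X} → ProperSeparator X → ∃[ Y ] ProperSeparator Y × Dominant Y
  properSeparator⇒dominant sep with remove-coloops sep
  ... | Y , sepY , colooplessY with close sepY colooplessY
  ...   | F , sepF , colooplessF , flatF =
    F , sepF , separator⇒dominant flatF colooplessF (ProperSeparator.separator sepF)

  -- Each `e ∈ X` lies on a circuit `C ⊆ X`, and `C - e` has the rank of `C`; submodularity for
  -- `X - e` and `C` carries this over to `X`.
  cyclicFlat⇒coloopless : ∀ {X} → CyclicFlat M X → Coloopless X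
  cyclicFlat⇒coloopless {X} ((X⊆E , _) , 𝒞 , circuits , refl) e e∈X with ∈-⋃⁻ 𝒞 e∈X
  ... | C , C∈𝒞 , e∈C with All.lookup circuits C∈𝒞
  ...   | C⊆E , ¬indep , proper = +-cancelʳ-≤ (ρ (C - e)) _ _ (begin
    ρ X + ρ (C - e)         ≤⟨ rank-submodular′ (X - e) C X (C - e) (X⊆E ∘ p─q⊆p X ⁅ e ⁆) C⊆E X⊆ C-e⊆X-e (p─q⊆p C ⁅ e ⁆) ⟩
    ρ (X - e) + ρ C         ≤⟨ +-monoʳ-≤ (ρ (X - e)) ρC≤ ⟩
    ρ (X - e) + ρ (C - e)   ∎)
    where
    open ≤-Reasoning
    X⊆ : X ⊆ (X - e) ∪ C
    X⊆ {x} x∈X with x ∈? ⁅ e ⁆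
    ... | yes x∈⁅e⁆ = q⊆p∪q (X - e) C (⁅x⁆⊆ e∈C x∈⁅e⁆)
    ... | no  x∉⁅e⁆ = p⊆p∪q C (x∈p∧x∉q⇒x∈p─q x∈X x∉⁅e⁆)
    C-e⊆X-e : C - e ⊆ X - e
    C-e⊆X-e x∈ with x∈p─q⁻ C ⁅ e ⁆ x∈
    ... | x∈C , x∉⁅e⁆ = x∈p∧x∉q⇒x∈p─q (∈-⋃⁺ C∈𝒞 x∈C) x∉⁅e⁆
    ρC≤ : ρ C ≤ ρ (C - e)
    ρC≤ = s≤s⁻¹ (begin-strict
      ρ C               <⟨ ≤∧≢⇒< (rank-bounded C C⊆E) (λ ρC → ¬indep (C⊆E , ρC)) ⟩
      ∣ C ∣             ≡⟨ x∈p⇒∣p∣≡1+∣p-x∣ e∈C ⟩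
      suc ∣ C - e ∣     ≡⟨ cong suc (proj₂ (proper (C - e) (x∈p⇒p-x⊂p e∈C))) ⟨
      suc (ρ (C - e))   ∎)

  -- A circuit inside a dependent set B whose closure misses part of X would lie inside X.

  pinchpoint⇒separator : ∀ X → Pinchpoint M X → FreeSeparator (proj₁ X)
  pinchpoint⇒separator (X , (X⊆E , _) , _) (_ , _ , comparable) B B⊆E ∣B∣ indep span =
    ≤-antisym (rank-monotone B E B⊆E id) (≮⇒≥ λ lt → absurd (<-≤-trans lt (≤-reflexive (sym ∣B∣))) lt)
    where
    absurd : ρ B < ∣ B ∣ → ρ B < ρ E → Empty.⊥
    absurd dep lt with flat-hull B⊆E
    ... | F , B⊆F , flat@(F⊆E , _) , ρF with largest-cyclicFlat flat
    ...   | Y , Y-cf , Y⊆F , ⊆Y = [ above , below ]′ (comparable (Y , Y-cf))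
      where
      open ≤-Reasoning
      -- In this case the closure `F` of `B` contains `X`, so `B ∪ X` has only the rank of `B` and
      -- does not span.
      above : X ⊆ Y → Empty.⊥
      above X⊆Y = <⇒≱ lt (begin
        ρ E         ≡⟨ span ⟨
        ρ (B ∪ X)   ≤⟨ rank-monotone (B ∪ X) F (∪-lub {A = B} B⊆F (Y⊆F ∘ X⊆Y)) F⊆E ⟩
        ρ F         ≡⟨ ρF ⟩
        ρ B         ∎)
      below : Y ⊆ X → Empty.⊥
      below Y⊆X with ∃-circuit B⊆E dep
      ... | C , C⊆B , min@((_ , C-dep) , _) = <-irrefl (proj₂ C-indep) C-dep
        where
        C⊆B∩X : C ⊆ B ∩ X
        C⊆B∩X x∈C = x∈p∩q⁺ (C⊆B x∈C , Y⊆X (⊆Y min (B⊆F ∘ C⊆B) x∈C))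
        C-indep : Independent M C
        C-indep = independent-⊆ {B ∩ X} C⊆B∩X (B⊆E ∘ p∩q⊆p B X , indep)

  pinchpoint⇒dominant : ∀ X → Pinchpoint M X → Dominant (proj₁ X)
  pinchpoint⇒dominant X@(_ , cf@(flat , _)) pinch =
    separator⇒dominant flat (cyclicFlat⇒coloopless cf) (pinchpoint⇒separator X pinch)

-- Free products and separators

module _ {N : ℕ} {E E₁ E₂ : Subset N} (M : Matroid E) (M₁ : Matroid E₁) (M₂ : Matroid E₂)
         (M≡M₁□M₂ : IsFreeProduct M M₁ M₂) where

  private
    open IsFreeProduct M≡M₁□M₂
    open Rank M
    module R₁ = Rank M₁
    module R₂ = Rank M₂

    E₁⊆E : E₁ ⊆ E
    E₁⊆E = subst (_ ∈_) (sym ground) ∘ p⊆p∪q E₂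

    E₂⊆E : E₂ ⊆ E
    E₂⊆E = subst (_ ∈_) (sym ground) ∘ q⊆p∪q E₁ E₂

    ∉E₂ : ∀ {x} → x ∈ E₁ → x ∉ E₂
    ∉E₂ x∈E₁ x∈E₂ = disjoint (_ , x∈p∩q⁺ (x∈E₁ , x∈E₂))

    glue : ∀ {B₁ B₂} → Independent M₁ B₁ → ∣ B₁ ∣ ≡ rank M₁ E₁ → Independent M₂ B₂ → ∣ B₂ ∣ ≡ rank M₂ E₂ →
           Basis M (B₁ ∪ B₂)
    glue {B₁} {B₂} indep₁@(B₁⊆E₁ , _) ∣B₁∣ indep₂@(B₂⊆E₂ , ρB₂) ∣B₂∣ =
      Equivalence.from (bases (B₁ ∪ B₂) (∪-lub {A = B₁} (E₁⊆E ∘ B₁⊆E₁) (E₂⊆E ∘ B₂⊆E₂)))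
        ( trans (∣p∪q∣-disjoint B₁ B₂ (λ x∈B₁ x∈B₂ → ∉E₂ (B₁⊆E₁ x∈B₁) (B₂⊆E₂ x∈B₂))) (cong₂ _+_ ∣B₁∣ ∣B₂∣)
        , subst (Independent M₁) (sym part₁) indep₁
        , subst (Spanning M₂) (sym part₂) (B₂⊆E₂ , trans ρB₂ ∣B₂∣))
      where
      part₁ : (B₁ ∪ B₂) ∩ E₁ ≡ B₁
      part₁ = ⊆-antisym to λ x∈B₁ → x∈p∩q⁺ (p⊆p∪q B₂ x∈B₁ , B₁⊆E₁ x∈B₁)
        where
        to : (B₁ ∪ B₂) ∩ E₁ ⊆ B₁
        to x∈ with x∈p∩q⁻ (B₁ ∪ B₂) E₁ x∈
        ... | x∈∪ , x∈E₁ with x∈p∪q⁻ B₁ B₂ x∈∪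
        ...   | inj₁ x∈B₁ = x∈B₁
        ...   | inj₂ x∈B₂ = contradiction (B₂⊆E₂ x∈B₂) (∉E₂ x∈E₁)
      part₂ : (B₁ ∪ B₂) ∩ E₂ ≡ B₂
      part₂ = ⊆-antisym to λ x∈B₂ → x∈p∩q⁺ (q⊆p∪q B₁ B₂ x∈B₂ , B₂⊆E₂ x∈B₂)
        where
        to : (B₁ ∪ B₂) ∩ E₂ ⊆ B₂
        to x∈ with x∈p∩q⁻ (B₁ ∪ B₂) E₂ x∈
        ... | x∈∪ , x∈E₂ with x∈p∪q⁻ B₁ B₂ x∈∪
        ...   | inj₁ x∈B₁ = contradiction x∈E₂ (∉E₂ (B₁⊆E₁ x∈B₁))
        ...   | inj₂ x∈B₂ = x∈B₂

    independent₁⇒independent : ∀ {I} → Independent M₁ I → Independent M I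
    independent₁⇒independent {I} indep@(I⊆E₁ , _)
      with R₁.extend-independent indep I⊆E₁ id | R₂.extend-independent R₂.⊥-independent (⊆-min E₂) id
    ... | B₁ , I⊆B₁ , _ , indep₁ , ∣B₁∣ | B₂ , _ , _ , indep₂ , ∣B₂∣ =
      independent-⊆ {B₁ ∪ B₂} (p⊆p∪q B₂ ∘ I⊆B₁) (proj₁ (glue indep₁ ∣B₁∣ indep₂ ∣B₂∣))

    independent⇒independent₁ : ∀ {I} → I ⊆ E₁ → Independent M I → Independent M₁ I
    independent⇒independent₁ {I} I⊆E₁ indep with extend-independent indep (proj₁ indep) id
    ... | B , I⊆B , B⊆E , B-indep@(_ , ρB) , ∣B∣ = R₁.independent-⊆ {B ∩ E₁}
      (λ x∈I → x∈p∩q⁺ (I⊆B x∈I , I⊆E₁ x∈I))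
      (proj₁ (proj₂ (Equivalence.to (bases B B⊆E) (B-indep , B⊆E , trans ρB ∣B∣))))

    -- Both ranks are the sizes of largest independent subsets of `A`, and on `E₁` the two notions
    -- of independence agree. Thus `M₁` is M|E₁.
    rank≡rank₁ : ∀ {A} → A ⊆ E₁ → ρ A ≡ rank M₁ A
    rank≡rank₁ {A} A⊆E₁ = ≤-antisym ρ≤ ≤ρ
      where
      ρ≤ : ρ A ≤ rank M₁ A
      ρ≤ with extend-independent ⊥-independent (⊆-min A) (E₁⊆E ∘ A⊆E₁)
      ... | I , _ , I⊆A , indep , ∣I∣ = ≤-trans (≤-reflexive (sym ∣I∣))
        (R₁.independent-size (independent⇒independent₁ (A⊆E₁ ∘ I⊆A) indep) I⊆A A⊆E₁)
      ≤ρ : rank M₁ A ≤ ρ A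
      ≤ρ with R₁.extend-independent R₁.⊥-independent (⊆-min A) A⊆E₁
      ... | I , _ , I⊆A , indep , ∣I∣ = ≤-trans (≤-reflexive (sym ∣I∣))
        (independent-size (independent₁⇒independent indep) I⊆A (E₁⊆E ∘ A⊆E₁))

    rank-E : ρ E ≡ rank M₁ E₁ + rank M₂ E₂
    rank-E with extend-independent ⊥-independent (⊆-min E) id
    ... | B , _ , B⊆E , B-indep@(_ , ρB) , ∣B∣ =
      trans (sym ∣B∣) (proj₁ (Equivalence.to (bases B B⊆E) (B-indep , B⊆E , trans ρB ∣B∣)))

    separator : FreeSeparator M E₁
    separator B B⊆E ∣B∣ indep span = proj₂ (proj₂ (Equivalence.from (bases B B⊆E)
      ( trans ∣B∣ rank-E
      , independent⇒independent₁ (p∩q⊆q B E₁) (B⊆E ∘ p∩q⊆p B E₁ , indep)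
      , p∩q⊆q B E₂ , ≤-antisym (R₂.rank-monotone (B ∩ E₂) E₂ (p∩q⊆q B E₂) id) spanning₂)))
      where
      B∪E₁⊆E : B ∪ E₁ ⊆ E
      B∪E₁⊆E = ∪-lub {A = B} B⊆E E₁⊆E
      -- `B ∪ E₁` spans `M`, hence contains a basis `J`; its part `J ∩ E₂` spans `M₂` and lies in
      -- `B`.
      spanning₂ : rank M₂ E₂ ≤ rank M₂ (B ∩ E₂)
      spanning₂ with R₁.extend-independent R₁.⊥-independent (⊆-min E₁) id
      ... | B₁ , _ , B₁⊆E₁ , B₁-indep , ∣B₁∣
        with extend-independent (independent₁⇒independent B₁-indep) (q⊆p∪q B E₁ ∘ B₁⊆E₁) B∪E₁⊆E
      ... | J , B₁⊆J , J⊆B∪E₁ , J-indep@(J⊆E , ρJ) , ∣J∣ = begin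
        rank M₂ E₂         ≡⟨ proj₂ (proj₂ (proj₂ (Equivalence.to (bases J J⊆E) (J-indep , J⊆E , trans ρJ (trans ∣J∣ span))))) ⟨
        rank M₂ (J ∩ E₂)   ≤⟨ R₂.rank-monotone (J ∩ E₂) (B ∩ E₂) J∩E₂⊆B∩E₂ (p∩q⊆q B E₂) ⟩
        rank M₂ (B ∩ E₂)   ∎
        where
        open ≤-Reasoning
        J∩E₂⊆B∩E₂ : J ∩ E₂ ⊆ B ∩ E₂
        J∩E₂⊆B∩E₂ x∈ with x∈p∩q⁻ J E₂ x∈
        ... | x∈J , x∈E₂ with x∈p∪q⁻ B E₁ (J⊆B∪E₁ x∈J)
        ...   | inj₁ x∈B  = x∈p∩q⁺ (x∈B , x∈E₂)
        ...   | inj₂ x∈E₁ = contradiction x∈E₂ (∉E₂ x∈E₁)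

    -- A basis of `M₁` and a basis of `T ─ E₁` in `M₂` are together independent in `M` and lie in
    -- `T`, where the first alone already has full size.
    loops₂ : ∀ {T} → E₁ ⊆ T → T ⊆ E → ρ T ≡ ρ E₁ → T ─ E₁ ⊆ E₂ → rank M₂ (T ─ E₁) ≡ 0
    loops₂ {T} E₁⊆T T⊆E ρT S⊆E₂
      with R₁.extend-independent R₁.⊥-independent (⊆-min E₁) id | R₂.extend-independent R₂.⊥-independent (⊆-min (T ─ E₁)) S⊆E₂
    ... | B₁ , _ , B₁⊆E₁ , B₁-indep , ∣B₁∣ | I , _ , I⊆S , I-indep , ∣I∣
      with R₂.extend-independent I-indep (S⊆E₂ ∘ I⊆S) id
    ... | B₂ , I⊆B₂ , _ , B₂-indep , ∣B₂∣ = n≤0⇒n≡0 (+-cancelˡ-≤ (rank M₁ E₁) _ _ (begin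
      rank M₁ E₁ + rank M₂ (T ─ E₁)  ≡⟨ cong₂ _+_ (sym ∣B₁∣) (sym ∣I∣) ⟩
      ∣ B₁ ∣ + ∣ I ∣                 ≡⟨ ∣p∪q∣-disjoint B₁ I (λ x∈B₁ x∈I → ∉E₂ (B₁⊆E₁ x∈B₁) (S⊆E₂ (I⊆S x∈I))) ⟨
      ∣ B₁ ∪ I ∣                     ≤⟨ independent-size {B₁ ∪ I}
                                          (independent-⊆ {B₁ ∪ B₂} (∪-lub {A = B₁} (p⊆p∪q B₂) (q⊆p∪q B₁ B₂ ∘ I⊆B₂))
                                            (proj₁ (glue B₁-indep ∣B₁∣ B₂-indep ∣B₂∣)))
                                          (∪-lub {A = B₁} (E₁⊆T ∘ B₁⊆E₁) (p─q⊆p T E₁ ∘ I⊆S)) T⊆E ⟩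
      ρ T                            ≡⟨ trans ρT (rank≡rank₁ id) ⟩
      rank M₁ E₁                     ≡⟨ +-identityʳ _ ⟨
      rank M₁ E₁ + 0                 ∎))
      where open ≤-Reasoning

  freeProduct⇒properSeparator : ¬ LoopColoopSum M₁ → ¬ LoopColoopSum M₂ → ProperSeparator M E₁
  freeProduct⇒properSeparator ¬sum₁ ¬sum₂ = record
    { ⊆-ground = E₁⊆E
    ; separator = separator
    ; restrict-large = λ S S⊆E₁ ρS≡0 → ≰⇒> λ le → ¬sum₁
        (S , S⊆E₁ , trans (sym (rank≡rank₁ S⊆E₁)) ρS≡0 , subst (λ k → ∣ E₁ ∣ ≤ ∣ S ∣ + k) (rank≡rank₁ id) le)
    ; contract-large = λ T E₁⊆T T⊆E ρT → ≰⇒> λ le → ¬sum₂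
        (T ─ E₁ , T─E₁⊆E₂ T⊆E , loops₂ E₁⊆T T⊆E ρT (T─E₁⊆E₂ T⊆E) , size E₁⊆T le)
    }
    where
    T─E₁⊆E₂ : ∀ {T} → T ⊆ E → T ─ E₁ ⊆ E₂
    T─E₁⊆E₂ {T} T⊆E x∈ with x∈p─q⁻ T E₁ x∈
    ... | x∈T , x∉E₁ with x∈p∪q⁻ E₁ E₂ (subst (_ ∈_) ground (T⊆E x∈T))
    ...   | inj₁ x∈E₁ = contradiction x∈E₁ x∉E₁
    ...   | inj₂ x∈E₂ = x∈E₂
    size : ∀ {T} → E₁ ⊆ T → ∣ E ∣ + ρ E₁ ≤ ∣ T ∣ + ρ E → ∣ E₂ ∣ ≤ ∣ T ─ E₁ ∣ + rank M₂ E₂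
    size {T} E₁⊆T le = +-cancelˡ-≤ (∣ E₁ ∣ + rank M₁ E₁) _ _ (begin
      (∣ E₁ ∣ + rank M₁ E₁) + ∣ E₂ ∣
        ≡⟨ xy∙z≈xz∙y (∣ E₁ ∣) (rank M₁ E₁) _ ⟩
      (∣ E₁ ∣ + ∣ E₂ ∣) + rank M₁ E₁
        ≡⟨ cong₂ _+_ (trans (cong ∣_∣ ground) (∣p∪q∣-disjoint E₁ E₂ ∉E₂)) (rank≡rank₁ id) ⟨
      ∣ E ∣ + ρ E₁
        ≤⟨ le ⟩
      ∣ T ∣ + ρ E
        ≡⟨ cong₂ _+_ (p⊆q⇒∣q∣≡∣p∣+∣q─p∣ E₁⊆T) rank-E ⟩
      (∣ E₁ ∣ + ∣ T ─ E₁ ∣) + (rank M₁ E₁ + rank M₂ E₂)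
        ≡⟨ interchange (∣ E₁ ∣) _ _ _ ⟩
      (∣ E₁ ∣ + rank M₁ E₁) + (∣ T ─ E₁ ∣ + rank M₂ E₂) ∎)
      where
      open ≤-Reasoning

module _ {N : ℕ} {E : Subset N} (M : Matroid E) {X : Subset N} (X⊆E : X ⊆ E) where

  open Rank M

  rank-contract : rank (contract M X X⊆E) (E ─ X) ≡ ρ E ∸ ρ X
  rank-contract = cong (λ A → ρ A ∸ ρ X) (trans (∪-comm (E ─ X) X) (p∪q─p X⊆E))

  -- `B ∩ (E ─ X)` spans M/X exactly when `B ∪ X` spans `M`, so the description of the bases becomes
  -- the condition in `FreeSeparator`.
  separator⇒freeProduct : FreeSeparator M X → IsFreeProduct M (restrict M X X⊆E) (contract M X X⊆E)
  separator⇒freeProduct separator = record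
    { disjoint = λ (x , x∈) → disjoint′ (x∈p∩q⁻ X (E ─ X) x∈)
    ; ground   = sym (p∪q─p X⊆E)
    ; bases    = λ B B⊆E → mk⇔ (to B B⊆E) (from B B⊆E)
    }
    where
    disjoint′ : ∀ {x} → ¬ (x ∈ X × x ∈ E ─ X)
    disjoint′ (x∈X , x∈E─X) = proj₂ (x∈p─q⁻ E X x∈E─X) x∈X
    rank-sum : ρ X + rank (contract M X X⊆E) (E ─ X) ≡ ρ E
    rank-sum = trans (cong (ρ X +_) rank-contract) (m+[n∸m]≡n (rank-monotone X E X⊆E id))
    absorb : ∀ {B} → B ⊆ E → (B ∩ (E ─ X)) ∪ X ≡ B ∪ X
    absorb {B} B⊆E = ⊆-antisym (∪-lub {A = B ∩ (E ─ X)} (p⊆p∪q X ∘ p∩q⊆p B (E ─ X)) (q⊆p∪q B X))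
                               (∪-lub {A = B} B⊆ (q⊆p∪q (B ∩ (E ─ X)) X))
      where
      B⊆ : B ⊆ (B ∩ (E ─ X)) ∪ X
      B⊆ {x} x∈B with x ∈? X
      ... | yes x∈X = q⊆p∪q (B ∩ (E ─ X)) X x∈X
      ... | no  x∉X = p⊆p∪q X (x∈p∩q⁺ (x∈B , x∈p∧x∉q⇒x∈p─q (B⊆E x∈B) x∉X))
    to : ∀ B → B ⊆ E → Basis M B →
         ∣ B ∣ ≡ ρ X + rank (contract M X X⊆E) (E ─ X) ×
         Independent (restrict M X X⊆E) (B ∩ X) × Spanning (contract M X X⊆E) (B ∩ (E ─ X))
    to B B⊆E (indep@(_ , ρB≡∣B∣) , (_ , ρB≡ρE)) =
      trans (sym ρB≡∣B∣) (trans ρB≡ρE (sym rank-sum)) ,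
      (p∩q⊆q B X , proj₂ (independent-⊆ {B} (p∩q⊆p B X) indep)) ,
      p∩q⊆q B (E ─ X) , trans (cong (λ A → ρ A ∸ ρ X) (absorb B⊆E)) (trans (cong (_∸ ρ X) spanning) (sym rank-contract))
      where
      B∪X⊆E : B ∪ X ⊆ E
      B∪X⊆E = ∪-lub {A = B} B⊆E X⊆E
      spanning : ρ (B ∪ X) ≡ ρ E
      spanning = ≤-antisym (rank-monotone (B ∪ X) E B∪X⊆E id)
        (≤-trans (≤-reflexive (sym ρB≡ρE)) (rank-monotone B (B ∪ X) (p⊆p∪q X) B∪X⊆E))
    from : ∀ B → B ⊆ E →
           ∣ B ∣ ≡ ρ X + rank (contract M X X⊆E) (E ─ X) ×
           Independent (restrict M X X⊆E) (B ∩ X) × Spanning (contract M X X⊆E) (B ∩ (E ─ X)) → Basis M B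
    from B B⊆E (∣B∣ , (_ , indep) , (_ , span)) = (B⊆E , trans ρB (sym ∣B∣≡ρE)) , B⊆E , ρB
      where
      ∣B∣≡ρE : ∣ B ∣ ≡ ρ E
      ∣B∣≡ρE = trans ∣B∣ rank-sum
      spanning : ρ (B ∪ X) ≡ ρ E
      spanning = ∸-cancelʳ-≡ (rank-monotone X (B ∪ X) (q⊆p∪q B X) (∪-lub {A = B} B⊆E X⊆E)) (rank-monotone X E X⊆E id)
        (trans (cong (λ A → ρ A ∸ ρ X) (sym (absorb B⊆E))) (trans span rank-contract))
      ρB : ρ B ≡ ρ E
      ρB = separator B B⊆E ∣B∣≡ρE indep spanning

  restrict-¬loopColoopSum : (∀ S → S ⊆ X → ρ S ≡ 0 → ∣ S ∣ + ρ X < ∣ X ∣) → ¬ LoopColoopSum (restrict M X X⊆E)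
  restrict-¬loopColoopSum large (S , S⊆X , ρS≡0 , le) = <⇒≱ (large S S⊆X ρS≡0) le

  -- A set `S` of loops of M/X corresponds to the set `T = S ∪ X`, which has the rank of `X`.
  contract-¬loopColoopSum : (∀ T → X ⊆ T → T ⊆ E → ρ T ≡ ρ X → ∣ T ∣ + ρ E < ∣ E ∣ + ρ X) →
                            ¬ LoopColoopSum (contract M X X⊆E)
  contract-¬loopColoopSum large (S , S⊆E─X , ρS≡0 , le) = <⇒≱ (large (S ∪ X) (q⊆p∪q S X) S∪X⊆E ρS∪X) (begin
    ∣ E ∣ + ρ X                                    ≡⟨ cong (_+ ρ X) (p⊆q⇒∣q∣≡∣p∣+∣q─p∣ X⊆E) ⟩
    (∣ X ∣ + ∣ E ─ X ∣) + ρ X                      ≤⟨ +-monoˡ-≤ (ρ X) (+-monoʳ-≤ ∣ X ∣ (≤-trans le (≤-reflexive (cong (∣ S ∣ +_) rank-contract)))) ⟩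
    (∣ X ∣ + (∣ S ∣ + (ρ E ∸ ρ X))) + ρ X          ≡⟨ cong (_+ ρ X) (+-assoc ∣ X ∣ ∣ S ∣ _) ⟨
    ((∣ X ∣ + ∣ S ∣) + (ρ E ∸ ρ X)) + ρ X          ≡⟨ +-assoc (∣ X ∣ + ∣ S ∣) _ _ ⟩
    (∣ X ∣ + ∣ S ∣) + ((ρ E ∸ ρ X) + ρ X)          ≡⟨ cong₂ _+_ (trans (+-comm ∣ X ∣ ∣ S ∣) (sym ∣S∪X∣)) (m∸n+n≡m (rank-monotone X E X⊆E id)) ⟩
    ∣ S ∪ X ∣ + ρ E                                ∎)
    where
    open ≤-Reasoning
    S∪X⊆E : S ∪ X ⊆ E
    S∪X⊆E = ∪-lub {A = S} (p─q⊆p E X ∘ S⊆E─X) X⊆E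
    ∣S∪X∣ : ∣ S ∪ X ∣ ≡ ∣ S ∣ + ∣ X ∣
    ∣S∪X∣ = ∣p∪q∣-disjoint S X (λ x∈S → proj₂ (x∈p─q⁻ E X (S⊆E─X x∈S)))
    ρS∪X : ρ (S ∪ X) ≡ ρ X
    ρS∪X = ≤-antisym (m∸n≡0⇒m≤n ρS≡0) (rank-monotone X (S ∪ X) (q⊆p∪q S X) S∪X⊆E)

-- Prefixes, merges and telescoping profiles of lists

module _ {a} {A : Set a} where

  take-≤-++ : ∀ i (xs ys : List A) → i ≤ length xs → take i (xs ++ ys) ≡ take i xs
  take-≤-++ zero    xs       ys _        = refl
  take-≤-++ (suc i) (x ∷ xs) ys (s≤s i≤) = cong (x ∷_) (take-≤-++ i xs ys i≤)

  take-length+-++ : ∀ (xs ys : List A) j → take (length xs + j) (xs ++ ys) ≡ xs ++ take j ys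
  take-length+-++ []       ys j = refl
  take-length+-++ (x ∷ xs) ys j = cong (x ∷_) (take-length+-++ xs ys j)

  take-length-++ : ∀ (xs ys : List A) → take (length xs) (xs ++ ys) ≡ xs
  take-length-++ []       ys = refl
  take-length-++ (x ∷ xs) ys = cong (x ∷_) (take-length-++ xs ys)

  drop-length-++ : ∀ (xs ys : List A) → drop (length xs) (xs ++ ys) ≡ ys
  drop-length-++ []       ys = refl
  drop-length-++ (x ∷ xs) ys = drop-length-++ xs ys

  merge-↭ : ∀ {a b} (σ : Shape a b) (α β : List A) → length α ≡ a → length β ≡ b → merge σ α β ↭ α ++ β
  merge-↭ σ α β ∣α∣ ∣β∣ = toPermutation (interleaving σ α β ∣α∣ ∣β∣)
    where
    interleaving : ∀ {a b} (σ : Shape a b) α β → length α ≡ a → length β ≡ b → Interleaving α β (merge σ α β)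
    interleaving []        []      []      _   _   = []
    interleaving (left σ)  (x ∷ α) β       ∣α∣ ∣β∣ = consˡ (interleaving σ α β (suc-injective ∣α∣) ∣β∣)
    interleaving (right σ) α       (y ∷ β) ∣α∣ ∣β∣ = consʳ (interleaving σ α β ∣α∣ (suc-injective ∣β∣))

  sum-take-profile : ∀ (f : List A → ℕ) l → (∀ j → f (take j l) ≤ f (take (suc j) l)) →
                     ∀ j → f [] + sum (take j (profile f l)) ≡ f (take j l)
  sum-take-profile f l       mono zero    = +-identityʳ (f [])
  sum-take-profile f []      mono (suc j) = +-identityʳ (f [])
  sum-take-profile f (x ∷ l) mono (suc j) = begin
    f [] + ((f (x ∷ []) ∸ f []) + s)   ≡⟨ +-assoc (f []) _ s ⟨
    (f [] + (f (x ∷ []) ∸ f [])) + s   ≡⟨ cong (_+ s) (m+[n∸m]≡n (mono 0)) ⟩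
    f (x ∷ []) + s                     ≡⟨ sum-take-profile (f ∘ (x ∷_)) l (mono ∘ suc) j ⟩
    f (x ∷ take j l)                   ∎
    where
    open ≡-Reasoning
    s : ℕ
    s = sum (take j (profile (f ∘ (x ∷_)) l))

  profile-++ : ∀ f (xs ys : List A) → profile f (xs ++ ys) ≡ profile f xs ++ profile (f ∘ (xs ++_)) ys
  profile-++ f []       ys = refl
  profile-++ f (x ∷ xs) ys = cong (_ ∷_) (profile-++ (f ∘ (x ∷_)) xs ys)

applyUpTo-cong : ∀ {a} {A : Set a} {f g : ℕ → A} n → (∀ j → f j ≡ g j) → applyUpTo f n ≡ applyUpTo g n
applyUpTo-cong zero    f≡g = refl
applyUpTo-cong (suc n) f≡g = cong₂ _∷_ (f≡g 0) (applyUpTo-cong n (f≡g ∘ suc))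

-- Linear orders of a subset and their prefixes

_≟ˢ_ : ∀ {N} (A B : Subset N) → Dec (A ≡ B)
_≟ˢ_ = ≡-dec Boolₚ._≟_

fromList-++ : ∀ {N} (xs ys : List (Fin N)) → fromList (xs ++ ys) ≡ fromList xs ∪ fromList ys
fromList-++ []       ys = sym (∪-identityˡ _)
fromList-++ (x ∷ xs) ys = trans (cong (⁅ x ⁆ ∪_) (fromList-++ xs ys)) (sym (∪-assoc ⁅ x ⁆ _ _))

fromList-↭ : ∀ {N} {xs ys : List (Fin N)} → xs ↭ ys → fromList xs ≡ fromList ys
fromList-↭ {xs = xs} {ys} xs↭ys = ⊆-antisym
  (∈-fromList⁺ ∘ ∈-resp-↭ xs↭ys ∘ ∈-fromList⁻ xs)
  (∈-fromList⁺ ∘ ∈-resp-↭ (↭-sym xs↭ys) ∘ ∈-fromList⁻ ys)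

∣fromList∣≤length : ∀ {N} (xs : List (Fin N)) → ∣ fromList xs ∣ ≤ length xs
∣fromList∣≤length {N} []   = ≤-reflexive (∣⊥∣≡0 N)
∣fromList∣≤length (x ∷ xs) = ≤-trans (∣p∪q∣≤∣p∣+∣q∣ ⁅ x ⁆ (fromList xs))
  (+-mono-≤ (≤-reflexive (∣⁅x⁆∣≡1 x)) (∣fromList∣≤length xs))

interleaving-map : ∀ {a b} {A : Set a} {B : Set b} (f : A → B) {xs ys zs} →
                   Interleaving xs ys zs → Interleaving (map f xs) (map f ys) (map f zs)
interleaving-map f []        = []
interleaving-map f (consˡ i) = consˡ (interleaving-map f i)
interleaving-map f (consʳ i) = consʳ (interleaving-map f i)

elementList : ∀ {N} → Subset N → List (Fin N)
elementList E = toList (elements E)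

elementList-interleaving : ∀ {N} {X E : Subset N} → X ⊆ E →
                           Interleaving (elementList X) (elementList (E ─ X)) (elementList E)
elementList-interleaving {X = []}    {[]}    X⊆E = []
elementList-interleaving {X = x ∷ X} {e ∷ E} X⊆E = cons x e X⊆E
  where
  shift : Interleaving (toList (Vec.map Fin.suc (elements X))) (toList (Vec.map Fin.suc (elements (E ─ X))))
                       (toList (Vec.map Fin.suc (elements E)))
  shift rewrite toList-map Fin.suc (elements X) | toList-map Fin.suc (elements (E ─ X)) | toList-map Fin.suc (elements E) =
    interleaving-map Fin.suc (elementList-interleaving (drop-∷-⊆ X⊆E))
  cons : ∀ x e → x ∷ X ⊆ e ∷ E →
         Interleaving (elementList (x ∷ X)) (elementList ((e ∷ E) ─ (x ∷ X))) (elementList (e ∷ E))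
  cons outside outside _ = shift
  cons outside inside  _ = consʳ shift
  cons inside  inside  _ = consˡ shift
  cons inside  outside X⊆E with X⊆E Vec.here
  ... | ()

elementList-↭ : ∀ {N} {X E : Subset N} → X ⊆ E → elementList E ↭ elementList X ++ elementList (E ─ X)
elementList-↭ X⊆E = toPermutation (elementList-interleaving X⊆E)

-- Membership in `linearOrders E` unfolds to a type from which `E` is hard to infer; the record
-- keeps `E` as a parameter.
record LinearOrder {N} (E : Subset N) (l : List (Fin N)) : Set where
  constructor linearOrder
  field
    listed : l ∈ˡ linearOrders E

∑-cong-linearOrders : ∀ {N} (E : Subset N) {F G : List (Fin N) → ℕ} →
  (∀ {l} → LinearOrder E l → F l ≡ G l) → ∑ (linearOrders E) F ≡ ∑ (linearOrders E) G
∑-cong-linearOrders E F≡G = ∑-cong-∈ (linearOrders E) (F≡G ∘ linearOrder)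

module _ {N : ℕ} {E : Subset N} where

  length-elementList : length (elementList E) ≡ ∣ E ∣
  length-elementList = length-toList (elements E)

  ↭⇒linearOrder : ∀ {l} → l ↭ elementList E → LinearOrder E l
  ↭⇒linearOrder l↭ = linearOrder (↭⇒∈-orderings ∣ E ∣ (elementList E) (trans (↭-length l↭) length-elementList) l↭)

  module _ {l : List (Fin N)} (l∈ : LinearOrder E l) where

    linearOrder-↭ : l ↭ elementList E
    linearOrder-↭ = ∈-orderings⇒↭ ∣ E ∣ (elementList E) length-elementList (LinearOrder.listed l∈)

    linearOrder-length : length l ≡ ∣ E ∣
    linearOrder-length = trans (↭-length linearOrder-↭) length-elementList

    fromList-linearOrder : fromList l ≡ E
    fromList-linearOrder = trans (fromList-↭ linearOrder-↭) (fromList-elements E)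

    take-⊆ : ∀ j → fromList (take j l) ⊆ E
    take-⊆ j = subst (_ ∈_) fromList-linearOrder ∘ ∈-fromList⁺ ∘ ∈-take j l ∘ ∈-fromList⁻ (take j l)

    -- The two pieces of `l` together cover `E`, so neither can have fewer elements than entries.
    ∣take∣ : ∀ j → j ≤ ∣ E ∣ → ∣ fromList (take j l) ∣ ≡ j
    ∣take∣ j j≤ = ≤-antisym
      (≤-trans (∣fromList∣≤length (take j l)) (≤-trans (≤-reflexive (length-take j l)) (m⊓n≤m j (length l))))
      (+-cancelʳ-≤ (∣ E ∣ ∸ j) _ _ (begin
        j + (∣ E ∣ ∸ j)                                          ≡⟨ m+[n∸m]≡n j≤ ⟩
        ∣ E ∣                                                    ≡⟨ cong ∣_∣ fromList-linearOrder ⟨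
        ∣ fromList l ∣                                           ≡⟨ cong (λ l → ∣ fromList l ∣) (take++drop≡id j l) ⟨
        ∣ fromList (take j l ++ drop j l) ∣                      ≡⟨ cong ∣_∣ (fromList-++ (take j l) (drop j l)) ⟩
        ∣ fromList (take j l) ∪ fromList (drop j l) ∣            ≤⟨ ∣p∪q∣≤∣p∣+∣q∣ (fromList (take j l)) _ ⟩
        ∣ fromList (take j l) ∣ + ∣ fromList (drop j l) ∣        ≤⟨ +-monoʳ-≤ ∣ fromList (take j l) ∣ (∣fromList∣≤length (drop j l)) ⟩
        ∣ fromList (take j l) ∣ + length (drop j l)              ≡⟨ cong (∣ fromList (take j l) ∣ +_) (trans (length-drop j l) (cong (_∸ j) linearOrder-length)) ⟩
        ∣ fromList (take j l) ∣ + (∣ E ∣ ∸ j)                    ∎))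
      where open ≤-Reasoning

    take-take : ∀ {i j} → i ≤ j → fromList (take i l) ⊆ fromList (take j l)
    take-take {i} {j} i≤j = ∈-fromList⁺ ∘ go i≤j l ∘ ∈-fromList⁻ (take i l)
      where
      go : ∀ {i j x} → i ≤ j → ∀ (l : List (Fin N)) → x ∈ˡ take i l → x ∈ˡ take j l
      go (s≤s i≤j) (y ∷ l) (here refl) = here refl
      go (s≤s i≤j) (y ∷ l) (there x∈)  = there (go i≤j l x∈)

  abstract
    -- The order lists `A` first, then `B ─ A`, then the rest.
    linearOrder-through : ∀ {A B} → A ⊆ B → B ⊆ E →
      ∃[ l ] LinearOrder E l × fromList (take ∣ A ∣ l) ≡ A × fromList (take ∣ B ∣ l) ≡ B
    linearOrder-through {A} {B} A⊆B B⊆E = l , ↭⇒linearOrder l↭ , take-A , take-B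
      where
      α β : List (Fin N)
      α = elementList A ++ elementList (B ─ A)
      β = elementList (E ─ B)
      l : List (Fin N)
      l = α ++ β
      B↭α : elementList B ↭ α
      B↭α = elementList-↭ A⊆B
      l↭ : l ↭ elementList E
      l↭ = ↭-sym (↭-trans (elementList-↭ B⊆E) (++⁺ʳ β B↭α))
      take-B : fromList (take ∣ B ∣ l) ≡ B
      take-B = trans (cong (λ j → fromList (take j l)) (trans (sym (length-toList (elements B))) (↭-length B↭α)))
        (trans (cong fromList (take-length-++ α β)) (trans (fromList-↭ (↭-sym B↭α)) (fromList-elements B)))
      take-A : fromList (take ∣ A ∣ l) ≡ A
      take-A = trans (cong fromList (trans
        (take-≤-++ ∣ A ∣ α β (≤-trans (p⊆q⇒∣p∣≤∣q∣ {p = A} {B} A⊆B) (≤-reflexive (trans (sym (length-toList (elements B))) (↭-length B↭α)))))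
        (trans (cong (λ j → take j α) (sym (length-toList (elements A)))) (take-length-++ (elementList A) (elementList (B ─ A))))))
        (fromList-elements A)

module _ {N : ℕ} {X E : Subset N} (X⊆E : X ⊆ E) where

  module _ {α β : List (Fin N)} (α∈ : LinearOrder X α) (β∈ : LinearOrder (E ─ X) β) where

    merge-linearOrder : ∀ (σ : Shape ∣ X ∣ ∣ E ─ X ∣) → LinearOrder E (merge σ α β)
    merge-linearOrder σ = ↭⇒linearOrder
      (↭-trans (merge-↭ σ α β (linearOrder-length α∈) (linearOrder-length β∈))
        (↭-trans (++⁺ (linearOrder-↭ α∈) (linearOrder-↭ β∈)) (↭-sym (elementList-↭ X⊆E))))

    ++-linearOrder : LinearOrder E (α ++ β)
    ++-linearOrder = subst (LinearOrder E)
      (merge-blocks ∣ X ∣ ∣ E ─ X ∣ α β (linearOrder-length α∈) (linearOrder-length β∈))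
      (merge-linearOrder (blocks ∣ X ∣ ∣ E ─ X ∣))

    take-merge : ∀ (σ : Shape ∣ X ∣ ∣ E ─ X ∣) j →
      fromList (take j (merge σ α β)) ≡ fromList (take (lefts j σ) α) ∪ fromList (take (rights j σ) β)
    take-merge σ j = trans
      (fromList-↭ (toPermutation (merge-interleaving σ α β (linearOrder-length α∈) (linearOrder-length β∈) j)))
      (fromList-++ (take (lefts j σ) α) (take (rights j σ) β))

  ∑-linearOrders : ∀ F → ∑ (linearOrders E) F ≡
    ∑ (shapes ∣ X ∣ ∣ E ─ X ∣) (λ σ → ∑ (linearOrders X) (λ α → ∑ (linearOrders (E ─ X)) (λ β → F (merge σ α β))))
  ∑-linearOrders F = trans
    (cong (λ n → ∑ (orderings n (elementList E)) F) (p⊆q⇒∣q∣≡∣p∣+∣q─p∣ X⊆E))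
    (∑-shuffle ∣ X ∣ ∣ E ─ X ∣ (elementList-interleaving X⊆E) (length-elementList {E = X}) (length-elementList {E = E ─ X}) F)

  -- A shape with a `right` among its first `∣ X ∣` letters puts an element outside `X` there, where
  -- `F` vanishes. Only the shape `blocks` is left, and its merge is concatenation.
  ∑-linearOrders-through : ∀ F → (∀ {l} → LinearOrder E l → fromList (take ∣ X ∣ l) ≢ X → F l ≡ 0) →
    ∑ (linearOrders E) F ≡ ∑ (linearOrders X) (λ α → ∑ (linearOrders (E ─ X)) (λ β → F (α ++ β)))
  ∑-linearOrders-through F vanish = begin
    ∑ (linearOrders E) F
      ≡⟨ ∑-linearOrders F ⟩
    ∑ (shapes ∣ X ∣ ∣ E ─ X ∣) H
      ≡⟨ ∑-shapes-blocks ∣ X ∣ ∣ E ─ X ∣ H (λ σ pos →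
           ∑-zero (linearOrders X) λ α∈ → ∑-zero (linearOrders (E ─ X)) λ β∈ →
             vanish (merge-linearOrder (linearOrder α∈) (linearOrder β∈) σ) (leaves σ (linearOrder α∈) (linearOrder β∈) pos)) ⟩
    H (blocks ∣ X ∣ ∣ E ─ X ∣)
      ≡⟨ ∑-cong-linearOrders X (λ α∈ → ∑-cong-linearOrders (E ─ X) λ β∈ →
           cong F (merge-blocks ∣ X ∣ ∣ E ─ X ∣ _ _ (linearOrder-length α∈) (linearOrder-length β∈))) ⟩
    ∑ (linearOrders X) (λ α → ∑ (linearOrders (E ─ X)) (λ β → F (α ++ β))) ∎
    where
    open ≡-Reasoning
    H : Shape ∣ X ∣ ∣ E ─ X ∣ → ℕ
    H σ = ∑ (linearOrders X) (λ α → ∑ (linearOrders (E ─ X)) (λ β → F (merge σ α β)))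
    leaves : ∀ σ {α β} → LinearOrder X α → LinearOrder (E ─ X) β →
             0 < rights ∣ X ∣ σ → fromList (take ∣ X ∣ (merge σ α β)) ≢ X
    leaves σ {α} {β} α∈ β∈ pos eq
      with ∣p∣>0⇒nonempty (fromList (take (rights ∣ X ∣ σ) β))
             (≤-trans pos (≤-reflexive (sym (∣take∣ β∈ (rights ∣ X ∣ σ) (rights≤ ∣ X ∣ σ)))))
    ... | y , y∈ = proj₂ (x∈p─q⁻ E X (take-⊆ β∈ (rights ∣ X ∣ σ) y∈))
      (subst (y ∈_) (trans (sym (take-merge α∈ β∈ σ ∣ X ∣)) eq) (q⊆p∪q (fromList (take (lefts ∣ X ∣ σ) α)) _ y∈))

∣linearOrders∣ : ∀ {N} (E : Subset N) → length (linearOrders E) ≡ ∣ E ∣ !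
∣linearOrders∣ E = length-orderings ∣ E ∣ (elementList E) (length-elementList {E = E})

-- Rank sequences of the orders starting with X

prefixRank : ℕ → List ℕ → ℕ
prefixRank j t = sum (take j t)

module _ {N : ℕ} {E : Subset N} (M : Matroid E) where

  open Rank M

  prefixRank-profile : ∀ {l} → LinearOrder E l → ∀ j → prefixRank j (rankProfile M l) ≡ ρ (fromList (take j l))
  prefixRank-profile {l} l∈ j = trans
    (cong (_+ prefixRank j (rankProfile M l)) (sym rank-⊥))
    (sum-take-profile (ρ ∘ fromList) l
      (λ j → rank-monotone _ _ (take-take l∈ (n≤1+n j)) (take-⊆ l∈ (suc j))) j)

  -- The part of dominance that concerns sets of the same size. It makes the orders starting with
  -- `X` recognisable, and it can be carried to `M′` by counting.
  Unique : Subset N → Set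
  Unique X = ∀ A → A ⊆ E → ∣ A ∣ ≡ ∣ X ∣ → ρ A ≤ ρ X → A ≡ X

  dominant⇒unique : ∀ {X} → Dominant M X → Unique X
  dominant⇒unique dominant A A⊆E ∣A∣ = dominant A A⊆E (≤-reflexive (sym ∣A∣))

  -- For a unique `X` this selects the orders starting with `X`, seeing nothing but the rank
  -- sequence.
  through? : Subset N → List ℕ → ℕ
  through? X t = 𝟙 (prefixRank ∣ X ∣ t ≤? ρ X)

  module _ {X : Subset N} (X⊆E : X ⊆ E) where

    take-++ˡ : ∀ {α β} → LinearOrder X α → ∀ {i} → i ≤ ∣ X ∣ → take i (α ++ β) ≡ take i α
    take-++ˡ {α} {β} α∈ i≤ = take-≤-++ _ α β (≤-trans i≤ (≤-reflexive (sym (linearOrder-length α∈))))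

    take-++ʳ : ∀ {α β} → LinearOrder X α → ∀ j → fromList (take (∣ X ∣ + j) (α ++ β)) ≡ X ∪ fromList (take j β)
    take-++ʳ {α} {β} α∈ j = begin
      fromList (take (∣ X ∣ + j) (α ++ β))        ≡⟨ cong (λ m → fromList (take (m + j) (α ++ β))) (linearOrder-length α∈) ⟨
      fromList (take (length α + j) (α ++ β))     ≡⟨ cong fromList (take-length+-++ α β j) ⟩
      fromList (α ++ take j β)                    ≡⟨ fromList-++ α (take j β) ⟩
      fromList α ∪ fromList (take j β)            ≡⟨ cong (_∪ fromList (take j β)) (fromList-linearOrder α∈) ⟩
      X ∪ fromList (take j β)                     ∎
      where open ≡-Reasoning

    take-++≡X : ∀ {α β} → LinearOrder X α → fromList (take ∣ X ∣ (α ++ β)) ≡ X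
    take-++≡X {α} {β} α∈ = trans (cong (λ m → fromList (take m (α ++ β))) (sym (linearOrder-length α∈)))
      (trans (cong fromList (take-length-++ α β)) (fromList-linearOrder α∈))

    -- Past `α` every prefix contains `X`, and its rank exceeds `ρ X` by the rank in M/X of a prefix
    -- of `β`; `ρ X` cancels in the differences.
    rankProfile-++ : ∀ {α β} → LinearOrder X α → LinearOrder (E ─ X) β →
      rankProfile M (α ++ β) ≡ rankProfile (restrict M X X⊆E) α ++ rankProfile (contract M X X⊆E) β
    rankProfile-++ {α} {β} α∈ β∈ = trans (profile-++ (ρ ∘ fromList) α β)
      (cong (rankProfile M α ++_) (applyUpTo-cong (length β) (λ j → begin
        ρ (fromList (α ++ take (suc j) β)) ∸ ρ (fromList (α ++ take j β))
          ≡⟨ cong₂ (λ A B → ρ A ∸ ρ B) (union (suc j)) (union j) ⟩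
        ρ (P (suc j) ∪ X) ∸ ρ (P j ∪ X)
          ≡⟨ cong (ρ (P (suc j) ∪ X) ∸_) (m+[n∸m]≡n {ρ X} (rank-monotone X (P j ∪ X) (q⊆p∪q (P j) X) (P∪X⊆E j))) ⟨
        ρ (P (suc j) ∪ X) ∸ (ρ X + (ρ (P j ∪ X) ∸ ρ X))
          ≡⟨ ∸-+-assoc (ρ (P (suc j) ∪ X)) (ρ X) _ ⟨
        (ρ (P (suc j) ∪ X) ∸ ρ X) ∸ (ρ (P j ∪ X) ∸ ρ X) ∎)))
      where
      open ≡-Reasoning
      P : ℕ → Subset N
      P j = fromList (take j β)
      P∪X⊆E : ∀ j → P j ∪ X ⊆ E
      P∪X⊆E j = ∪-lub {A = P j} (p─q⊆p E X ∘ take-⊆ β∈ j) X⊆E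
      union : ∀ j → fromList (α ++ take j β) ≡ P j ∪ X
      union j = trans (fromList-++ α (take j β)) (trans (cong (_∪ P j) (fromList-linearOrder α∈)) (∪-comm X (P j)))

    module _ (unique : Unique X) where

      through?-sound : ∀ {l} → LinearOrder E l → prefixRank ∣ X ∣ (rankProfile M l) ≤ ρ X → fromList (take ∣ X ∣ l) ≡ X
      through?-sound {l} l∈ le = unique _ (take-⊆ l∈ ∣ X ∣)
        (∣take∣ l∈ ∣ X ∣ (p⊆q⇒∣p∣≤∣q∣ {p = X} {E} X⊆E))
        (≤-trans (≤-reflexive (sym (prefixRank-profile l∈ ∣ X ∣))) le)

      through?-++ : ∀ {α β} → LinearOrder X α → LinearOrder (E ─ X) β →
                    through? X (rankProfile M (α ++ β)) ≡ 1
      through?-++ {α} {β} α∈ β∈ = 𝟙-true (prefixRank ∣ X ∣ (rankProfile M (α ++ β)) ≤? ρ X) (≤-reflexive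
        (trans (prefixRank-profile (++-linearOrder X⊆E α∈ β∈) ∣ X ∣) (cong ρ (take-++≡X α∈))))

      ∑-through : ∀ (Φ : List ℕ → ℕ) → ∑-profiles M (λ t → through? X t * Φ t) ≡
        ∑ (linearOrders X) (λ α → ∑ (linearOrders (E ─ X)) (λ β → Φ (rankProfile M (α ++ β))))
      ∑-through Φ = trans
        (∑-linearOrders-through X⊆E (λ l → through? X (rankProfile M l) * Φ (rankProfile M l))
          (λ {l} l∈ ≢X → cong (_* Φ (rankProfile M l))
            (𝟙-false (prefixRank ∣ X ∣ (rankProfile M l) ≤? ρ X) (≢X ∘ through?-sound l∈))))
        (∑-cong-linearOrders X (λ {α} α∈ → ∑-cong-linearOrders (E ─ X) λ {β} β∈ →
          trans (cong (_* Φ (rankProfile M (α ++ β))) (through?-++ α∈ β∈)) (+-identityʳ _)))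

      length-restrict-profile : ∀ {α} → LinearOrder X α → length (rankProfile (restrict M X X⊆E) α) ≡ ∣ X ∣
      length-restrict-profile {α} α∈ = trans (length-applyUpTo _ (length α)) (linearOrder-length α∈)

      -- The first `∣ X ∣` bits depend on `α` alone, so each order of `X` is counted once for every
      -- order of `E ─ X`.
      ∑-through-restrict : ∀ (Φ : List ℕ → ℕ) → ∑-profiles M (λ t → through? X t * Φ (take ∣ X ∣ t)) ≡
                           ∣ E ─ X ∣ ! * ∑-profiles (restrict M X X⊆E) Φ
      ∑-through-restrict Φ = begin
        ∑-profiles M (λ t → through? X t * Φ (take ∣ X ∣ t))
          ≡⟨ ∑-through (Φ ∘ take ∣ X ∣) ⟩
        ∑ (linearOrders X) (λ α → ∑ (linearOrders (E ─ X)) (λ β → Φ (take ∣ X ∣ (rankProfile M (α ++ β)))))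
          ≡⟨ ∑-cong-linearOrders X (λ {α} α∈ → trans
               (∑-cong-linearOrders (E ─ X) (λ {β} β∈ → cong Φ (trans
                 (cong₂ take (sym (length-restrict-profile α∈)) (rankProfile-++ α∈ β∈))
                 (take-length-++ (rankProfile (restrict M X X⊆E) α) _))))
               (trans (∑-const (linearOrders (E ─ X)) _) (cong (_* Φ (rankProfile (restrict M X X⊆E) α)) (∣linearOrders∣ (E ─ X))))) ⟩
        ∑ (linearOrders X) (λ α → ∣ E ─ X ∣ ! * Φ (rankProfile (restrict M X X⊆E) α))
          ≡⟨ ∑-*-distribˡ (∣ E ─ X ∣ !) (linearOrders X) (Φ ∘ rankProfile (restrict M X X⊆E)) ⟩
        ∣ E ─ X ∣ ! * ∑-profiles (restrict M X X⊆E) Φ ∎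
        where open ≡-Reasoning

      ∑-through-contract : ∀ (Φ : List ℕ → ℕ) → ∑-profiles M (λ t → through? X t * Φ (drop ∣ X ∣ t)) ≡
                           ∣ X ∣ ! * ∑-profiles (contract M X X⊆E) Φ
      ∑-through-contract Φ = begin
        ∑-profiles M (λ t → through? X t * Φ (drop ∣ X ∣ t))
          ≡⟨ ∑-through (Φ ∘ drop ∣ X ∣) ⟩
        ∑ (linearOrders X) (λ α → ∑ (linearOrders (E ─ X)) (λ β → Φ (drop ∣ X ∣ (rankProfile M (α ++ β)))))
          ≡⟨ ∑-cong-linearOrders X (λ {α} α∈ → ∑-cong-linearOrders (E ─ X) (λ {β} β∈ → cong Φ (trans
                 (cong₂ drop (sym (length-restrict-profile α∈)) (rankProfile-++ α∈ β∈))
                 (drop-length-++ (rankProfile (restrict M X X⊆E) α) _)))) ⟩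
        ∑ (linearOrders X) (λ _ → ∑-profiles (contract M X X⊆E) Φ)
          ≡⟨ ∑-const (linearOrders X) _ ⟩
        length (linearOrders X) * ∑-profiles (contract M X X⊆E) Φ
          ≡⟨ cong (_* ∑-profiles (contract M X X⊆E) Φ) (∣linearOrders∣ X) ⟩
        ∣ X ∣ ! * ∑-profiles (contract M X X⊆E) Φ ∎
        where open ≡-Reasoning

      ∑-through-1 : ∑-profiles M (λ t → through? X t * 1) ≡ ∣ X ∣ ! * ∣ E ─ X ∣ !
      ∑-through-1 = trans (∑-through (λ _ → 1)) (trans
        (∑-cong (linearOrders X) (λ α → trans (∑-const (linearOrders (E ─ X)) 1)
          (trans (*-identityʳ _) (∣linearOrders∣ (E ─ X)))))
        (trans (∑-const (linearOrders X) _) (cong (_* ∣ E ─ X ∣ !) (∣linearOrders∣ X))))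

-- Tests whether the prefixes of sizes `i` and `j` have ranks `h` and `k`, in this pairing.
chainTest : ℕ → ℕ → ℕ → ℕ → List ℕ → ℕ
chainTest i j h k t = 𝟙 ((prefixRank i t ≟ h) ×-dec (prefixRank j t ≟ k))

-- Transfer of chains, sizes and factors

module _ {N N′ : ℕ} {E : Subset N} {E′ : Subset N′} {M : Matroid E} {M′ : Matroid E′}
         (same : SameProfiles M M′) where

  open SameProfiles same

  abstract
    -- An order through `A` and `B` shows their ranks in its rank sequence. So the number of orders
    -- with these two prefix ranks is positive in `M`, hence in `M′`, where two prefixes of such an
    -- order are the sets wanted.
    transfer-chain : ∀ {A B} → A ⊆ B → B ⊆ E → ∃[ A′ ] ∃[ B′ ] A′ ⊆ B′ × B′ ⊆ E′ ×
      ∣ A′ ∣ ≡ (∣ A ∣) × (∣ B′ ∣) ≡ (∣ B ∣) × rank M′ A′ ≡ rank M A × rank M′ B′ ≡ rank M B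
    transfer-chain {A} {B} A⊆B B⊆E = locate (linearOrder-through A⊆B B⊆E)
      where
      Target : Set
      Target = ∃[ A′ ] ∃[ B′ ] A′ ⊆ B′ × B′ ⊆ E′ ×
        ∣ A′ ∣ ≡ (∣ A ∣) × (∣ B′ ∣) ≡ (∣ B ∣) × rank M′ A′ ≡ rank M A × rank M′ B′ ≡ rank M B
      onChain? : ∀ t → Dec (prefixRank (∣ A ∣) t ≡ rank M A × prefixRank (∣ B ∣) t ≡ rank M B)
      onChain? t = (prefixRank (∣ A ∣) t ≟ rank M A) ×-dec (prefixRank (∣ B ∣) t ≟ rank M B)
      ∣A∣≤∣B∣ : ∣ A ∣ ≤ ∣ B ∣
      ∣A∣≤∣B∣ = p⊆q⇒∣p∣≤∣q∣ {p = A} {B} A⊆B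
      ∣B∣≤∣E′∣ : ∣ B ∣ ≤ ∣ E′ ∣
      ∣B∣≤∣E′∣ = ≤-trans (p⊆q⇒∣p∣≤∣q∣ {p = B} {E} B⊆E) (≤-reflexive size)
      read : ∀ {l′} → LinearOrder E′ l′ →
             prefixRank (∣ A ∣) (rankProfile M′ l′) ≡ rank M A × prefixRank (∣ B ∣) (rankProfile M′ l′) ≡ rank M B → Target
      read {l′} l′∈ (ρA′ , ρB′) = fromList (take (∣ A ∣) l′) , fromList (take (∣ B ∣) l′) ,
        take-take l′∈ ∣A∣≤∣B∣ , take-⊆ l′∈ (∣ B ∣) ,
        ∣take∣ l′∈ (∣ A ∣) (≤-trans ∣A∣≤∣B∣ ∣B∣≤∣E′∣) , ∣take∣ l′∈ (∣ B ∣) ∣B∣≤∣E′∣ ,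
        trans (sym (prefixRank-profile M′ l′∈ ∣ A ∣)) ρA′ , trans (sym (prefixRank-profile M′ l′∈ ∣ B ∣)) ρB′
      find : ∃[ l′ ] l′ ∈ˡ linearOrders E′ × 0 < 𝟙 (onChain? (rankProfile M′ l′)) → Target
      find (l′ , listed , 0<𝟙) = read (linearOrder listed) (𝟙-positive⁻ (onChain? (rankProfile M′ l′)) 0<𝟙)
      locate : ∃[ l ] LinearOrder E l × fromList (take (∣ A ∣) l) ≡ A × fromList (take (∣ B ∣) l) ≡ B → Target
      locate (l , l∈ , l-A , l-B) = find (∑-positive⁻ (linearOrders E′)
        (subst (0 <_) (sums (λ t → 𝟙 (onChain? t))) (∑-positive (LinearOrder.listed l∈)
          (≤-reflexive (sym (𝟙-true (onChain? (rankProfile M l))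
            ( trans (prefixRank-profile M l∈ ∣ A ∣) (cong (rank M) l-A)
            , trans (prefixRank-profile M l∈ ∣ B ∣) (cong (rank M) l-B))))))))

module _ {N N′ : ℕ} {E : Subset N} {E′ : Subset N′} {M : Matroid E} {M′ : Matroid E′}
         (same : SameProfiles M M′) where

  -- Some set of `M′` has the size and rank of `X`. It is at least as large as `X′` and of no
  -- greater rank, so by dominance it is `X′`.
  dominant-size-≤ : ∀ {X X′} → X ⊆ E → Dominant M′ X′ → rank M X ≡ rank M′ X′ → ∣ X′ ∣ ≤ ∣ X ∣ → ∣ X ∣ ≡ ∣ X′ ∣
  dominant-size-≤ {X} {X′} X⊆E dominant′ ρX≡ ∣X′∣≤∣X∣ with transfer-chain same {X} id X⊆E
  ... | A , _ , A⊆B , B⊆E′ , ∣A∣ , _ , ρA , _ = trans (sym ∣A∣) (cong ∣_∣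
    (dominant′ A (B⊆E′ ∘ A⊆B) (≤-trans ∣X′∣≤∣X∣ (≤-reflexive (sym ∣A∣))) (≤-reflexive (trans ρA ρX≡))))

dominant-size : ∀ {N N′} {E : Subset N} {E′ : Subset N′} {M : Matroid E} {M′ : Matroid E′} → SameProfiles M M′ →
  ∀ {X X′} → X ⊆ E → X′ ⊆ E′ → Dominant M X → Dominant M′ X′ → rank M X ≡ rank M′ X′ → ∣ X ∣ ≡ ∣ X′ ∣
dominant-size same {X} {X′} X⊆E X′⊆E′ dominant dominant′ ρX≡ with ≤-total (∣ X ∣) (∣ X′ ∣)
... | inj₁ ∣X∣≤∣X′∣ = sym (dominant-size-≤ (SameProfiles-sym same) X′⊆E′ dominant (sym ρX≡) ∣X∣≤∣X′∣)
... | inj₂ ∣X′∣≤∣X∣ = dominant-size-≤ same X⊆E dominant′ ρX≡ ∣X′∣≤∣X∣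

module _ {N N′ : ℕ} {E : Subset N} {E′ : Subset N′} {M : Matroid E} {M′ : Matroid E′}
         (same : SameProfiles M M′)
         {X : Subset N} {X′ : Subset N′} (X⊆E : X ⊆ E) (X′⊆E′ : X′ ⊆ E′)
         (unique : Unique M X) (unique′ : Unique M′ X′)
         (∣X∣≡ : ∣ X ∣ ≡ ∣ X′ ∣) (ρX≡ : rank M X ≡ rank M′ X′) where

  open SameProfiles same

  private
    ∣E─X∣≡ : ∣ E ─ X ∣ ≡ ∣ E′ ─ X′ ∣
    ∣E─X∣≡ = ∣q─p∣-cong X⊆E X′⊆E′ size ∣X∣≡

  ∑-through-same : ∀ (Ψ : List ℕ → ℕ) → ∑-profiles M (λ t → through? M X t * Ψ t) ≡ ∑-profiles M′ (λ t → through? M′ X′ t * Ψ t)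
  ∑-through-same Ψ = trans (sums (λ t → through? M X t * Ψ t))
    (cong₂ (λ m k → ∑-profiles M′ (λ t → 𝟙 (prefixRank m t ≤? k) * Ψ t)) ∣X∣≡ ρX≡)

  -- The factor contributed by the orders of the complement is the same nonzero factorial on both
  -- sides and cancels in ℕ.
  same-restrict : SameProfiles (restrict M X X⊆E) (restrict M′ X′ X′⊆E′)
  same-restrict = sameProfiles ∣X∣≡ ρX≡ λ Φ →
    *-cancelˡ-≡ _ _ (∣ E ─ X ∣ !) {{(∣ E ─ X ∣) !≢0}} (begin
      ∣ E ─ X ∣ ! * ∑-profiles (restrict M X X⊆E) Φ                ≡⟨ ∑-through-restrict M X⊆E unique Φ ⟨
      ∑-profiles M (λ t → through? M X t * Φ (take (∣ X ∣) t))       ≡⟨ ∑-through-same (Φ ∘ take ∣ X ∣) ⟩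
      ∑-profiles M′ (λ t → through? M′ X′ t * Φ (take (∣ X ∣) t))    ≡⟨ cong (λ m → ∑-profiles M′ (λ t → through? M′ X′ t * Φ (take m t))) ∣X∣≡ ⟩
      ∑-profiles M′ (λ t → through? M′ X′ t * Φ (take (∣ X′ ∣) t))   ≡⟨ ∑-through-restrict M′ X′⊆E′ unique′ Φ ⟩
      ∣ E′ ─ X′ ∣ ! * ∑-profiles (restrict M′ X′ X′⊆E′) Φ          ≡⟨ cong (λ b → b ! * ∑-profiles (restrict M′ X′ X′⊆E′) Φ) ∣E─X∣≡ ⟨
      ∣ E ─ X ∣ ! * ∑-profiles (restrict M′ X′ X′⊆E′) Φ            ∎)
    where open ≡-Reasoning

  same-contract : SameProfiles (contract M X X⊆E) (contract M′ X′ X′⊆E′)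
  same-contract = sameProfiles ∣E─X∣≡
    (trans (rank-contract M X⊆E) (trans (cong₂ _∸_ rk ρX≡) (sym (rank-contract M′ X′⊆E′)))) λ Φ →
    *-cancelˡ-≡ _ _ (∣ X ∣ !) {{(∣ X ∣) !≢0}} (begin
      ∣ X ∣ ! * ∑-profiles (contract M X X⊆E) Φ                    ≡⟨ ∑-through-contract M X⊆E unique Φ ⟨
      ∑-profiles M (λ t → through? M X t * Φ (drop (∣ X ∣) t))       ≡⟨ ∑-through-same (Φ ∘ drop ∣ X ∣) ⟩
      ∑-profiles M′ (λ t → through? M′ X′ t * Φ (drop (∣ X ∣) t))    ≡⟨ cong (λ m → ∑-profiles M′ (λ t → through? M′ X′ t * Φ (drop m t))) ∣X∣≡ ⟩
      ∑-profiles M′ (λ t → through? M′ X′ t * Φ (drop (∣ X′ ∣) t))   ≡⟨ ∑-through-contract M′ X′⊆E′ unique′ Φ ⟩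
      ∣ X′ ∣ ! * ∑-profiles (contract M′ X′ X′⊆E′) Φ               ≡⟨ cong (λ a → a ! * ∑-profiles (contract M′ X′ X′⊆E′) Φ) ∣X∣≡ ⟨
      ∣ X ∣ ! * ∑-profiles (contract M′ X′ X′⊆E′) Φ                ∎)
    where open ≡-Reasoning

-- Free separators recognised by counting bases

module _ {N : ℕ} {E : Subset N} (M : Matroid E) where

  open Rank M

  FreeBasis? : ∀ X B → Dec (ρ (B ∩ X) ≡ ∣ B ∩ X ∣ × ρ (B ∪ X) ≡ ρ E)
  FreeBasis? X B = (ρ (B ∩ X) ≟ ∣ B ∩ X ∣) ×-dec (ρ (B ∪ X) ≟ ρ E)

  -- These count linear orders by their first ρ E elements, so every basis is counted
  -- (ρ E)! (∣ E ∣ ∸ ρ E)! times.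

  freeBasisCount : Subset N → ℕ
  freeBasisCount X = ∑ (linearOrders E) (λ l → 𝟙 (FreeBasis? X (fromList (take (ρ E) l))))

  basisCount : ℕ
  basisCount = ∑-profiles M (λ t → 𝟙 (prefixRank (ρ E) t ≟ ρ E))

  rank-E≤∣E∣ : ρ E ≤ ∣ E ∣
  rank-E≤∣E∣ = rank-bounded E id

  basis⇒freeBasis : ∀ {X B} → X ⊆ E → B ⊆ E → ∣ B ∣ ≡ ρ E → ρ B ≡ ρ E → ρ (B ∩ X) ≡ ∣ B ∩ X ∣ × ρ (B ∪ X) ≡ ρ E
  basis⇒freeBasis {X} {B} X⊆E B⊆E ∣B∣ ρB =
    proj₂ (independent-⊆ {B} (p∩q⊆p B X) (B⊆E , trans ρB (sym ∣B∣))) ,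
    ≤-antisym (rank-monotone (B ∪ X) E B∪X⊆E id) (≤-trans (≤-reflexive (sym ρB)) (rank-monotone B (B ∪ X) (p⊆p∪q X) B∪X⊆E))
    where
    B∪X⊆E : B ∪ X ⊆ E
    B∪X⊆E = ∪-lub {A = B} B⊆E X⊆E

  basisTest≤freeBasisTest : ∀ {X} → X ⊆ E → ∀ {l} → LinearOrder E l →
    𝟙 (prefixRank (ρ E) (rankProfile M l) ≟ ρ E) ≤ 𝟙 (FreeBasis? X (fromList (take (ρ E) l)))
  basisTest≤freeBasisTest {X} X⊆E {l} l∈ = 𝟙-mono (prefixRank (ρ E) (rankProfile M l) ≟ ρ E) (FreeBasis? X (fromList (take (ρ E) l)))
    (λ eq → basis⇒freeBasis X⊆E (take-⊆ l∈ (ρ E)) (∣take∣ l∈ (ρ E) rank-E≤∣E∣) (trans (sym (prefixRank-profile M l∈ (ρ E))) eq))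

  separator⇒counts-agree : ∀ {X} → X ⊆ E → FreeSeparator M X → basisCount ≡ freeBasisCount X
  separator⇒counts-agree {X} X⊆E separator = ∑-cong-linearOrders E λ {l} l∈ →
    ≤-antisym (basisTest≤freeBasisTest X⊆E l∈)
      (𝟙-mono (FreeBasis? X (fromList (take (ρ E) l))) (prefixRank (ρ E) (rankProfile M l) ≟ ρ E) λ (indep , span) →
        trans (prefixRank-profile M l∈ (ρ E))
          (separator _ (take-⊆ l∈ (ρ E)) (∣take∣ l∈ (ρ E) rank-E≤∣E∣) indep span))

  -- The test for a basis never exceeds the test for a free basis, so equal totals force equality at
  -- every order; a given `B` is tested by an order that lists it first.
  counts-agree⇒separator : ∀ {X} → X ⊆ E → freeBasisCount X ≤ basisCount → FreeSeparator M X
  counts-agree⇒separator {X} X⊆E ≤basisCount B B⊆E ∣B∣ indep span with linearOrder-through {A = B} id B⊆E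
  ... | l , l∈@(linearOrder listed) , l-B , _ = trans (cong ρ (sym l-r)) (trans (sym (prefixRank-profile M l∈ (ρ E)))
    (𝟙-positive⁻ (prefixRank (ρ E) (rankProfile M l) ≟ ρ E) (≤-trans (≤-reflexive (sym free))
      (∑-tight (linearOrders E) (basisTest≤freeBasisTest X⊆E ∘ linearOrder) ≤basisCount listed))))
    where
    l-r : fromList (take (ρ E) l) ≡ B
    l-r = trans (cong (λ j → fromList (take j l)) (sym ∣B∣)) l-B
    free : 𝟙 (FreeBasis? X (fromList (take (ρ E) l))) ≡ 1
    free = 𝟙-true (FreeBasis? X (fromList (take (ρ E) l))) (subst (λ B → ρ (B ∩ X) ≡ ∣ B ∩ X ∣ × ρ (B ∪ X) ≡ ρ E) (sym l-r) (indep , span))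

  module _ {X : Subset N} (X⊆E : X ⊆ E) where

    private
      a b r : ℕ
      a = (∣ X ∣)
      b = (∣ E ─ X ∣)
      r = ρ E

    -- A shape σ meets X in i = lefts r σ of its first r positions, so the merged order
    -- starts with a free basis exactly when α starts with an independent i-set and β with
    -- r ∸ i elements that span the contraction: a condition on the ranks of α ++ β.

    freeBasis-merge : ∀ {α β} → LinearOrder X α → LinearOrder (E ─ X) β → ∀ (σ : Shape a b) →
      𝟙 (FreeBasis? X (fromList (take r (merge σ α β)))) ≡
      chainTest (lefts r σ) (a + (r ∸ lefts r σ)) (lefts r σ) r (rankProfile M (α ++ β))
    freeBasis-merge {α} {β} α∈ β∈ σ = 𝟙-cong (FreeBasis? X (fromList (take r (merge σ α β))))
      ((prefixRank i t ≟ i) ×-dec (prefixRank (a + (r ∸ i)) t ≟ r))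
      (λ (indep , span) → trans rankI (trans (cong ρ (sym meet)) (trans indep (trans (cong ∣_∣ meet) ∣A∣))) ,
                          trans rankJ (trans (cong ρ (sym join)) span))
      (λ (indep , span) → trans (cong ρ meet) (trans (sym rankI) (trans indep (sym (trans (cong ∣_∣ meet) ∣A∣)))) ,
                          trans (cong ρ join) (trans (sym rankJ) span))
      where
      t : List ℕ
      t = rankProfile M (α ++ β)
      i j : ℕ
      i = lefts r σ
      j = rights r σ
      A B : Subset N
      A = fromList (take i α)
      B = fromList (take j β)
      i≤a : i ≤ a
      i≤a = lefts≤ r σ
      r∸i≡j : r ∸ i ≡ j
      r∸i≡j = trans (cong (_∸ i) (sym (lefts+rights r σ (≤-trans rank-E≤∣E∣ (≤-reflexive (p⊆q⇒∣q∣≡∣p∣+∣q─p∣ X⊆E)))))) (m+n∸m≡n i j)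
      ∣A∣ : ∣ A ∣ ≡ i
      ∣A∣ = ∣take∣ α∈ i i≤a
      A⊆X : A ⊆ X
      A⊆X = take-⊆ α∈ i
      B⊆E─X : B ⊆ E ─ X
      B⊆E─X = take-⊆ β∈ j
      meet : fromList (take r (merge σ α β)) ∩ X ≡ A
      meet = trans (cong (_∩ X) (take-merge X⊆E α∈ β∈ σ r)) (⊆-antisym to (λ x∈A → x∈p∩q⁺ (p⊆p∪q B x∈A , A⊆X x∈A)))
        where
        to : (A ∪ B) ∩ X ⊆ A
        to x∈ with x∈p∩q⁻ (A ∪ B) X x∈
        ... | x∈∪ , x∈X with x∈p∪q⁻ A B x∈∪
        ...   | inj₁ x∈A = x∈A
        ...   | inj₂ x∈B = contradiction x∈X (proj₂ (x∈p─q⁻ E X (B⊆E─X x∈B)))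
      join : fromList (take r (merge σ α β)) ∪ X ≡ X ∪ B
      join = trans (cong (_∪ X) (take-merge X⊆E α∈ β∈ σ r)) (⊆-antisym
        (∪-lub {A = A ∪ B} (∪-lub {A = A} (p⊆p∪q B ∘ A⊆X) (q⊆p∪q X B)) (p⊆p∪q B))
        (∪-lub {A = X} (q⊆p∪q (A ∪ B) X) (p⊆p∪q X ∘ q⊆p∪q A B)))
      αβ∈ : LinearOrder E (α ++ β)
      αβ∈ = ++-linearOrder X⊆E α∈ β∈
      rankI : prefixRank i t ≡ ρ A
      rankI = trans (prefixRank-profile M αβ∈ i) (cong (ρ ∘ fromList) (take-++ˡ M X⊆E α∈ i≤a))
      rankJ : prefixRank (a + (r ∸ i)) t ≡ ρ (X ∪ B)
      rankJ = trans (prefixRank-profile M αβ∈ (a + (r ∸ i))) (cong ρ (trans (take-++ʳ M X⊆E α∈ (r ∸ i)) (cong (λ j → X ∪ fromList (take j β)) r∸i≡j)))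

    -- On the right `M` enters only through weights of rank sequences of orders starting with `X`.
    -- Shapes and test parameters are fixed by `a`, `b` and `r`, which makes the count comparable
    -- between two matroids.
    freeBasisCount-shapes : Unique M X → freeBasisCount X ≡
      ∑ (shapes a b) (λ σ → ∑-profiles M (λ t → through? M X t * chainTest (lefts r σ) (a + (r ∸ lefts r σ)) (lefts r σ) r t))
    freeBasisCount-shapes unique = trans
      (∑-linearOrders X⊆E (λ l → 𝟙 (FreeBasis? X (fromList (take r l)))))
      (∑-cong (shapes a b) (λ σ → trans
        (∑-cong-linearOrders X (λ α∈ → ∑-cong-linearOrders (E ─ X) (λ β∈ → freeBasis-merge α∈ β∈ σ)))
        (sym (∑-through M X⊆E unique (chainTest (lefts r σ) (a + (r ∸ lefts r σ)) (lefts r σ) r)))))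

module _ {N N′ : ℕ} {E : Subset N} {E′ : Subset N′} {M : Matroid E} {M′ : Matroid E′}
         (same : SameProfiles M M′) where

  open SameProfiles same

  -- In both matroids the orders whose first ∣ X ∣ elements have rank at most ρ X number
  -- ∣ X ∣ ! * ∣ E ─ X ∣ !, and in M′ this is already the number of orders starting with X′.

  transfer-unique : ∀ {X X′} → X ⊆ E → X′ ⊆ E′ → ∣ X ∣ ≡ ∣ X′ ∣ → rank M X ≡ rank M′ X′ → Unique M X → Unique M′ X′
  transfer-unique {X} {X′} X⊆E X′⊆E′ ∣X∣≡ ρX≡ unique A A⊆E′ ∣A∣ ρA with linearOrder-through {A = A} id A⊆E′
  ... | l , l∈@(linearOrder listed) , l-A , _ = trans (sym l-X) (𝟙-positive⁻ (fromList (take (∣ X′ ∣) l) ≟ˢ X′)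
    (≤-trans (≤-reflexive (sym test)) (∑-tight (linearOrders E′) (sub ∘ linearOrder) counts listed)))
    where
    starts : ∀ l → ℕ
    starts l = 𝟙 (fromList (take (∣ X′ ∣) l) ≟ˢ X′)
    l-X : fromList (take (∣ X′ ∣) l) ≡ A
    l-X = trans (cong (λ j → fromList (take j l)) (sym ∣A∣)) l-A
    test : through? M′ X′ (rankProfile M′ l) ≡ 1
    test = 𝟙-true (prefixRank (∣ X′ ∣) (rankProfile M′ l) ≤? rank M′ X′)
      (≤-trans (≤-reflexive (trans (prefixRank-profile M′ l∈ ∣ X′ ∣) (cong (rank M′) l-X))) ρA)
    sub : ∀ {l} → LinearOrder E′ l → starts l ≤ through? M′ X′ (rankProfile M′ l)
    sub {l} l∈ = 𝟙-mono (fromList (take (∣ X′ ∣) l) ≟ˢ X′) (prefixRank (∣ X′ ∣) (rankProfile M′ l) ≤? rank M′ X′)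
      (λ eq → ≤-reflexive (trans (prefixRank-profile M′ l∈ ∣ X′ ∣) (cong (rank M′) eq)))
    open ≤-Reasoning
    counts : ∑-profiles M′ (through? M′ X′) ≤ ∑ (linearOrders E′) starts
    counts = begin
      ∑-profiles M′ (through? M′ X′)
        ≡⟨ cong₂ (λ m k → ∑-profiles M′ (λ t → 𝟙 (prefixRank m t ≤? k))) ∣X∣≡ ρX≡ ⟨
      ∑-profiles M′ (through? M X)
        ≡⟨ sums (through? M X) ⟨
      ∑-profiles M (through? M X)
        ≡⟨ ∑-cong (linearOrders E) (λ l → *-identityʳ (through? M X (rankProfile M l))) ⟨
      ∑-profiles M (λ t → through? M X t * 1)
        ≡⟨ ∑-through-1 M X⊆E unique ⟩
      ∣ X ∣ ! * ∣ E ─ X ∣ !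
        ≡⟨ cong₂ (λ a b → a ! * b !) ∣X∣≡ (∣q─p∣-cong X⊆E X′⊆E′ size ∣X∣≡) ⟩
      ∣ X′ ∣ ! * ∣ E′ ─ X′ ∣ !
        ≡⟨ cong₂ _*_ (∣linearOrders∣ X′) (trans (*-identityʳ _) (∣linearOrders∣ (E′ ─ X′))) ⟨
      length (linearOrders X′) * (length (linearOrders (E′ ─ X′)) * 1)
        ≡⟨ trans (∑-cong (linearOrders X′) (λ _ → ∑-const (linearOrders (E′ ─ X′)) 1)) (∑-const (linearOrders X′) _) ⟨
      ∑ (linearOrders X′) (λ _ → ∑ (linearOrders (E′ ─ X′)) (λ _ → 1))
        ≡⟨ ∑-cong-linearOrders X′ (λ {α} α∈ → ∑-cong-linearOrders (E′ ─ X′) (λ {β} β∈ →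
             𝟙-true (fromList (take (∣ X′ ∣) (α ++ β)) ≟ˢ X′) (take-++≡X M′ X′⊆E′ α∈))) ⟨
      ∑ (linearOrders X′) (λ α → ∑ (linearOrders (E′ ─ X′)) (λ β → starts (α ++ β)))
        ≡⟨ ∑-linearOrders-through X′⊆E′ starts (λ {l} _ → 𝟙-false (fromList (take (∣ X′ ∣) l) ≟ˢ X′)) ⟨
      ∑ (linearOrders E′) starts ∎

  -- Any set of `M′` with the size and rank of `X` serves as `X′`. Freeness follows from the counts,
  -- and the two inequalities by carrying chains of `M′` back to `M`.
  transfer-properSeparator : ∀ {X} → ProperSeparator M X → Unique M X → ∃[ X′ ] ProperSeparator M′ X′
  transfer-properSeparator {X} sep unique with transfer-chain same {X} id (ProperSeparator.⊆-ground sep)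
  ... | X′ , _ , X′⊆B , B⊆E′ , ∣X′∣ , _ , ρX′ , _ = X′ , record
    { ⊆-ground       = X′⊆E′
    ; separator      = counts-agree⇒separator M′ X′⊆E′ (≤-reflexive counts)
    ; restrict-large = restrict′
    ; contract-large = contract′
    }
    where
    open ProperSeparator sep
    X′⊆E′ : X′ ⊆ E′
    X′⊆E′ = B⊆E′ ∘ X′⊆B
    unique′ : Unique M′ X′
    unique′ = transfer-unique ⊆-ground X′⊆E′ (sym ∣X′∣) (sym ρX′) unique
    counts : freeBasisCount M′ X′ ≡ basisCount M′
    counts = begin
      freeBasisCount M′ X′
        ≡⟨ freeBasisCount-shapes M′ X′⊆E′ unique′ ⟩
      total (rank M′ E′) (∣ X′ ∣) (∣ E′ ─ X′ ∣) M′ (through? M′ X′)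
        ≡⟨ ∑-cong (shapes (∣ X′ ∣) ∣ E′ ─ X′ ∣) (λ σ → ∑-through-same same ⊆-ground X′⊆E′ unique unique′ (sym ∣X′∣) (sym ρX′)
             (chainTest (lefts (rank M′ E′) σ) (∣ X′ ∣ + (rank M′ E′ ∸ lefts (rank M′ E′) σ)) (lefts (rank M′ E′) σ) (rank M′ E′))) ⟨
      total (rank M′ E′) (∣ X′ ∣) (∣ E′ ─ X′ ∣) M (through? M X)
        ≡⟨ cong (λ r → total r (∣ X′ ∣) (∣ E′ ─ X′ ∣) M (through? M X)) rk ⟨
      total (rank M E) (∣ X′ ∣) (∣ E′ ─ X′ ∣) M (through? M X)
        ≡⟨ cong₂ (λ a b → total (rank M E) a b M (through? M X)) ∣X′∣
             (∣q─p∣-cong X′⊆E′ ⊆-ground (sym size) ∣X′∣) ⟩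
      total (rank M E) (∣ X ∣) (∣ E ─ X ∣) M (through? M X)
        ≡⟨ freeBasisCount-shapes M ⊆-ground unique ⟨
      freeBasisCount M X
        ≡⟨ separator⇒counts-agree M ⊆-ground separator ⟨
      basisCount M
        ≡⟨ sums (λ t → 𝟙 (prefixRank (rank M E) t ≟ rank M E)) ⟩
      ∑-profiles M′ (λ t → 𝟙 (prefixRank (rank M E) t ≟ rank M E))
        ≡⟨ cong (λ r → ∑-profiles M′ (λ t → 𝟙 (prefixRank r t ≟ r))) rk ⟩
      basisCount M′ ∎
      where
      open ≡-Reasoning
      -- The sizes index the type of the shapes, so they are made arguments in order to be replaced
      -- throughout.
      total : ℕ → ℕ → ℕ → ∀ {N} {E : Subset N} → Matroid E → (List ℕ → ℕ) → ℕ
      total r a b M w = ∑ (shapes a b) (λ σ → ∑-profiles M (λ t →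
        w t * chainTest (lefts r σ) (a + (r ∸ lefts r σ)) (lefts r σ) r t))
    -- A chain through `X′` is carried back to one through some `X₀` with the size and rank of `X`;
    -- uniqueness makes it a chain through `X` itself.
    X₀≡X : ∀ {X₀} → X₀ ⊆ E → ∣ X₀ ∣ ≡ ∣ X′ ∣ → rank M X₀ ≡ rank M′ X′ → X₀ ≡ X
    X₀≡X X₀⊆E ∣X₀∣ ρX₀ = unique _ X₀⊆E (trans ∣X₀∣ ∣X′∣) (≤-reflexive (trans ρX₀ ρX′))
    restrict′ : ∀ S → S ⊆ X′ → rank M′ S ≡ 0 → ∣ S ∣ + rank M′ X′ < ∣ X′ ∣
    restrict′ S S⊆X′ ρS≡0 with transfer-chain (SameProfiles-sym same) S⊆X′ X′⊆E′
    ... | S₀ , X₀ , S₀⊆X₀ , X₀⊆E , ∣S₀∣ , ∣X₀∣ , ρS₀ , ρX₀ =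
      subst₂ _<_ (cong₂ _+_ ∣S₀∣ (sym ρX′)) (sym ∣X′∣)
        (restrict-large S₀ (subst (_ ∈_) (X₀≡X X₀⊆E ∣X₀∣ ρX₀) ∘ S₀⊆X₀) (trans ρS₀ ρS≡0))
    contract′ : ∀ T → X′ ⊆ T → T ⊆ E′ → rank M′ T ≡ rank M′ X′ → ∣ T ∣ + rank M′ E′ < ∣ E′ ∣ + rank M′ X′
    contract′ T X′⊆T T⊆E′ ρT with transfer-chain (SameProfiles-sym same) X′⊆T T⊆E′
    ... | X₀ , T₀ , X₀⊆T₀ , T₀⊆E , ∣X₀∣ , ∣T₀∣ , ρX₀ , ρT₀ =
      subst₂ _<_ (cong₂ _+_ ∣T₀∣ rk) (cong₂ _+_ size (sym ρX′))
        (contract-large T₀ (λ x∈X → X₀⊆T₀ (subst (_ ∈_) (sym (X₀≡X (T₀⊆E ∘ X₀⊆T₀) ∣X₀∣ ρX₀)) x∈X)) T₀⊆E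
          (trans ρT₀ (trans ρT ρX′)))

-- Proper free products and the sharp factors

properSeparator⇒properFreeProduct : ∀ {N} {E : Subset N} {M : Matroid E} {X} → ProperSeparator M X → IsProperFreeProduct M
properSeparator⇒properFreeProduct {E = E} {M} {X} sep =
  X , E ─ X , restrict M X ⊆-ground , contract M X ⊆-ground , separator⇒freeProduct M ⊆-ground separator ,
  ¬loopColoopSum⇒twoCyclicFlats (restrict M X ⊆-ground) (restrict-¬loopColoopSum M ⊆-ground restrict-large) ,
  ¬loopColoopSum⇒twoCyclicFlats (contract M X ⊆-ground) (contract-¬loopColoopSum M ⊆-ground contract-large)
  where open ProperSeparator sep

transfer-properFreeProduct : ∀ {N N′} {E : Subset N} {E′ : Subset N′} {M : Matroid E} {M′ : Matroid E′} →
                             SameProfiles M M′ → IsProperFreeProduct M → IsProperFreeProduct M′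
transfer-properFreeProduct {M = M} {M′} same (E₁ , E₂ , M₁ , M₂ , M≡M₁□M₂ , two₁ , two₂) =
  transfer (properSeparator⇒dominant M (freeProduct⇒properSeparator M M₁ M₂ M≡M₁□M₂
    (twoCyclicFlats⇒¬loopColoopSum M₁ two₁) (twoCyclicFlats⇒¬loopColoopSum M₂ two₂)))
  where
  transfer : ∃[ X ] ProperSeparator M X × Dominant M X → IsProperFreeProduct M′
  transfer (X , sep , dominant) =
    properSeparator⇒properFreeProduct (proj₂ (transfer-properSeparator same sep (dominant⇒unique M dominant)))

theorem8p1 : ∀ {c ℓ₁ ℓ₂} (K : HeytingField c ℓ₁ ℓ₂) → CharacteristicZero K →
    ∀ {N N′ : ℕ} {E : Subset N} {E′ : Subset N′} (M : Matroid E) (M′ : Matroid E′) →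
    Same𝒢 K M M′ →
    (IsProperFreeProduct M ⇔ IsProperFreeProduct M′) ×
    (∀ (X : 𝓩 M) (X′ : 𝓩 M′) → Pinchpoint M X → Pinchpoint M′ X′ →
    rank M (proj₁ X) ≡ rank M′ (proj₁ X′) →
    Same𝒢 K (restrictZ M X) (restrictZ M′ X′) ×
    Same𝒢 K (contractZ M X) (contractZ M′ X′))
theorem8p1 K char M M′ same𝒢 =
  mk⇔ (transfer-properFreeProduct same) (transfer-properFreeProduct (SameProfiles-sym same)) , factors
  where
  same : SameProfiles M M′
  same = Same𝒢⇒SameProfiles K M M′ char same𝒢
  factors : ∀ (X : 𝓩 M) (X′ : 𝓩 M′) → Pinchpoint M X → Pinchpoint M′ X′ →
    rank M (proj₁ X) ≡ rank M′ (proj₁ X′) →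
    Same𝒢 K (restrictZ M X) (restrictZ M′ X′) × Same𝒢 K (contractZ M X) (contractZ M′ X′)
  factors X@(_ , (X⊆E , _) , _) X′@(_ , (X′⊆E′ , _) , _) pinch pinch′ ρX≡ =
    SameProfiles⇒Same𝒢 K (restrictZ M X) (restrictZ M′ X′) (same-restrict same X⊆E X′⊆E′ unique unique′ ∣X∣≡ ρX≡) ,
    SameProfiles⇒Same𝒢 K (contractZ M X) (contractZ M′ X′) (same-contract same X⊆E X′⊆E′ unique unique′ ∣X∣≡ ρX≡)
    where
    unique : Unique M (proj₁ X)
    unique = dominant⇒unique M (pinchpoint⇒dominant M X pinch)
    unique′ : Unique M′ (proj₁ X′)
    unique′ = dominant⇒unique M′ (pinchpoint⇒dominant M′ X′ pinch′)
    ∣X∣≡ : ∣ proj₁ X ∣ ≡ ∣ proj₁ X′ ∣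
    -- Only the ranks are assumed equal; full dominance, not just uniqueness, is what forces equal
    -- sizes.
    ∣X∣≡ = dominant-size same X⊆E X′⊆E′ (pinchpoint⇒dominant M X pinch) (pinchpoint⇒dominant M′ X′ pinch′) ρX≡
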